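{- Let $F(X)=X^2+1$ and $\Psi_F(x,y):=\#\{n\le x:\ P^+(n^2+1)\le y\}$, where $n$ runs over positive integers. If $x<y\le x^2$ and $u:=\frac{\log x}{\log y}\in[\frac12,1)$, then $$\Psi_F(x,y)\ \ge\ \{1-u+o(1)\}\,x$$ as $x\to\infty$.
   Context: $P^+(n)$ denotes the largest prime factor of $n\ge1$, with $P^+(1):=1$. -}

module Defs where

open import Data.Empty using (⊥-elim)
open import Data.Integer.Base as ℤ using (+_)
import Data.Integer.Properties as ℤP
open import Data.List.Base using (List; foldr; length)
open import Data.List.Membership.Propositional using (_∈_)
open import Data.List.Relation.Unary.Unique.Propositional using (Unique)
open import Data.Nat.Base as ℕ using (ℕ; zero; suc)
open import Data.Nat.Primality.Factorisation using (factors; factorise)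
import Data.Nat.Properties as ℕP
open import Data.Product.Base using (∃-syntax; _×_; _,_; proj₁; proj₂)
open import Data.Rational.Base
open import Data.Rational.Properties
open import Data.Rational.Solver using (module +-*-Solver)
import Data.Rational.Unnormalised.Base as ℚᵘ
import Data.Rational.Unnormalised.Properties as ℚᵘP
open import Data.Sum.Base using (_⊎_; inj₁; inj₂)
open import Function.Bundles using (_⇔_)
open import Relation.Binary.PropositionalEquality
open import Relation.Nullary using (¬_; yes; no)

open +-*-Solver using (solve; _:+_; _:*_; _:-_; :-_; _:=_; con)

ι : ℕ → ℚ
ι n = + n / 1

½^ : ℕ → ℚ
½^ zero    = 1ℚ
½^ (suc n) = ½ * ½^ n

-- The reciprocal, extended by inv 0 = 0.
inv : ℚ → ℚ
inv q with q ≟ 0ℚ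
... | yes _  = 0ℚ
... | no q≢0 = (1/ q) {{≢-nonZero q≢0}}

-- Σ_{i=1}^{k} h / (1 + i h): the k right-endpoint rectangles of width h
-- below 1/t, starting at t = 1.
rectangles : ℚ → ℕ → ℚ
rectangles h zero    = 0ℚ
rectangles h (suc k) = rectangles h k + h * inv (1ℚ + ι (suc k) * h)

-- Riemann sum of ∫₁^q dt/t for the partition of [1,q] (or, with h < 0, of
-- [q,1]) into 2ⁿ equal pieces.
riemann : ℕ → ℚ → ℚ
riemann n q = rectangles ((q - 1ℚ) * ½^ n) (2 ℕ.^ n)

------------------------------------------------------------------------

module RationalLemmas where
  0≤1 : 0ℚ ≤ 1ℚ
  0≤1 = nonNegative⁻¹ 1ℚ

  0<1 : 0ℚ < 1ℚ
  0<1 = positive⁻¹ 1ℚ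

  0≤½ : 0ℚ ≤ ½
  0≤½ = nonNegative⁻¹ ½

  ι-suc : ∀ n → ι (suc n) ≡ 1ℚ + ι n
  ι-suc n = trans (fromℚᵘ-cong {ℚᵘ.mkℚᵘ (+ suc n) 0} {ℚᵘ.mkℚᵘ (+ 1) 0 ℚᵘ.+ ℚᵘ.mkℚᵘ (+ n) 0}
                    (ℚᵘ.*≡* (cong (ℤ._* (+ 1)) (sym (cong₂ ℤ._+_ {x = + 1} refl (ℤP.*-identityʳ (+ n)))))))
                  (trans (toℚᵘ-injective (ℚᵘP.≃-trans (toℚᵘ-fromℚᵘ _)
                    (ℚᵘP.≃-sym (ℚᵘP.≃-trans (toℚᵘ-homo-+ 1ℚ (ι n))
                      (ℚᵘP.+-congʳ (ℚᵘ.mkℚᵘ (+ 1) 0) (toℚᵘ-fromℚᵘ (ℚᵘ.mkℚᵘ (+ n) 0))))))) refl)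

  *-nonNeg : ∀ {p q} → 0ℚ ≤ p → 0ℚ ≤ q → 0ℚ ≤ p * q
  *-nonNeg {p} {q} a b = subst (_≤ p * q) (*-zeroʳ p)
    (*-monoˡ-≤-nonNeg p {{nonNegative a}} b)

  *-pos : ∀ {p q} → 0ℚ < p → 0ℚ < q → 0ℚ < p * q
  *-pos {p} {q} a b = subst (_< p * q) (*-zeroʳ p)
    (*-monoʳ-<-pos p {{positive a}} b)

  *-mono : ∀ {p q r s} → 0ℚ ≤ r → 0ℚ ≤ q → p ≤ q → r ≤ s → p * r ≤ q * s
  *-mono {p} {q} {r} a b c d = ≤-trans (*-monoʳ-≤-nonNeg r {{nonNegative a}} c)
                                       (*-monoˡ-≤-nonNeg q {{nonNegative b}} d)

  ≤-diff : ∀ {p q} → 0ℚ ≤ q - p → p ≤ q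
  ≤-diff {p} {q} a = subst₂ _≤_ (+-identityˡ p)
    (solve 2 (λ p q → (q :- p) :+ p := q) refl p q) (+-monoˡ-≤ p a)

  diff-≤ : ∀ {p q} → p ≤ q → 0ℚ ≤ q - p
  diff-≤ {p} {q} a = subst (_≤ q - p) (+-inverseʳ p) (+-monoˡ-≤ (- p) a)

  0≤∣∣ : ∀ p → 0ℚ ≤ ∣ p ∣
  0≤∣∣ p = nonNegative⁻¹ ∣ p ∣ {{∣-∣-nonNeg p}}

  +-nonNeg : ∀ {p q} → 0ℚ ≤ p → 0ℚ ≤ q → 0ℚ ≤ p + q
  +-nonNeg {p} {q} a b = subst (_≤ p + q) (+-identityˡ 0ℚ) (+-mono-≤ a b)

  ∣∣-cong-≤ : ∀ {p q r} → p ≡ q → ∣ q ∣ ≤ r → ∣ p ∣ ≤ r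
  ∣∣-cong-≤ refl l = l

  triangle : ∀ {p q r s} → ∣ p ∣ ≤ r → ∣ q ∣ ≤ s → ∣ p + q ∣ ≤ r + s
  triangle {p} {q} a b = ≤-trans (∣p+q∣≤∣p∣+∣q∣ p q) (+-mono-≤ a b)

  ∣*∣-≤ : ∀ {p q r s} → ∣ p ∣ ≤ r → ∣ q ∣ ≤ s → ∣ p * q ∣ ≤ r * s
  ∣*∣-≤ {p} {q} {r} {s} a b = subst (_≤ r * s) (sym (∣p*q∣≡∣p∣*∣q∣ p q))
    (*-mono (0≤∣∣ q) (≤-trans (0≤∣∣ p) a) a b)

  half-sum : ∀ p → p * ½ + p * ½ ≡ p
  half-sum p = trans (sym (*-distribˡ-+ p ½ ½)) (*-identityʳ p)

  inv-pos : ∀ {q} → 0ℚ < q → (q * inv q ≡ 1ℚ) × (0ℚ ≤ inv q)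
  inv-pos {q} 0<q with q ≟ 0ℚ
  ... | yes refl = ⊥-elim (<-irrefl refl 0<q)
  ... | no q≢0 = *-inverseʳ q {{≢-nonZero q≢0}}
               , <⇒≤ (positive⁻¹ _ {{1/pos⇒pos q {{positive 0<q}}}})

  inv>0 : ∀ {q} → 0ℚ < q → 0ℚ < inv q
  inv>0 {q} 0<q with q ≟ 0ℚ
  ... | yes refl = ⊥-elim (<-irrefl refl 0<q)
  ... | no q≢0 = positive⁻¹ _ {{1/pos⇒pos q {{positive 0<q}}}}

  inv-anti : ∀ {c q} → 0ℚ < c → c ≤ q → inv q ≤ inv c
  inv-anti {c} {q} 0<c c≤q = subst₂ _≤_ e₁ e₂
      (*-mono (*-nonNeg 0≤iq 0≤ic) (≤-trans (<⇒≤ 0<c) c≤q) c≤q ≤-refl)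
    where
    0<q = <-≤-trans 0<c c≤q
    0≤iq = proj₂ (inv-pos 0<q)
    0≤ic = proj₂ (inv-pos 0<c)
    e₁ : c * (inv q * inv c) ≡ inv q
    e₁ = trans (solve 3 (λ c a b → c :* (a :* b) := a :* (c :* b)) refl c (inv q) (inv c))
           (trans (cong (inv q *_) (proj₁ (inv-pos 0<c))) (*-identityʳ _))
    e₂ : q * (inv q * inv c) ≡ inv c
    e₂ = trans (sym (*-assoc q _ _))
           (trans (cong (_* inv c) (proj₁ (inv-pos 0<q))) (*-identityˡ _))

  term-diff : ∀ {a b} h k → 0ℚ < a → 0ℚ < b →
              h * inv a - k * inv b ≡ (h * b - k * a) * (inv a * inv b)
  term-diff {a} {b} h k 0<a 0<b = begin
    h * inv a - k * inv b
      ≡⟨ sym (cong₂ _-_ (*-identityʳ (h * inv a)) (*-identityʳ (k * inv b))) ⟩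
    h * inv a * 1ℚ - k * inv b * 1ℚ
      ≡⟨ sym (cong₂ (λ s t → h * inv a * s - k * inv b * t)
                (proj₁ (inv-pos 0<b)) (proj₁ (inv-pos 0<a))) ⟩
    h * inv a * (b * inv b) - k * inv b * (a * inv a)
      ≡⟨ solve 6 (λ h k a b s t → h :* s :* (b :* t) :- k :* t :* (a :* s)
                    := (h :* b :- k :* a) :* (s :* t)) refl h k a b (inv a) (inv b) ⟩
    (h * b - k * a) * (inv a * inv b) ∎
    where open ≡-Reasoning

  term-bound : ∀ {a b c} h k → 0ℚ < c → c ≤ a → c ≤ b →
               ∣ h * inv a - k * inv b ∣ ≤ ∣ h * b - k * a ∣ * (inv c * inv c)
  term-bound {a} {b} {c} h k 0<c c≤a c≤b =
    ∣∣-cong-≤ (term-diff h k 0<a 0<b) (∣*∣-≤ {h * b - k * a} ≤-refl (∣*∣-≤ (bd 0<a c≤a) (bd 0<b c≤b)))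
    where
    0<a = <-≤-trans 0<c c≤a
    0<b = <-≤-trans 0<c c≤b
    bd : ∀ {t} → 0ℚ < t → c ≤ t → ∣ inv t ∣ ≤ inv c
    bd 0<t c≤t = subst (_≤ inv c) (sym (0≤p⇒∣p∣≡p (proj₂ (inv-pos 0<t)))) (inv-anti 0<c c≤t)

  0≤½^ : ∀ n → 0ℚ ≤ ½^ n
  0≤½^ zero    = 0≤1
  0≤½^ (suc n) = *-nonNeg 0≤½ (0≤½^ n)

  0≤ι : ∀ n → 0ℚ ≤ ι n
  0≤ι zero    = ≤-refl
  0≤ι (suc n) = subst (0ℚ ≤_) (sym (ι-suc n)) (+-nonNeg 0≤1 (0≤ι n))

  ι-+ : ∀ m n → ι (m ℕ.+ n) ≡ ι m + ι n
  ι-+ zero    n = sym (+-identityˡ _)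
  ι-+ (suc m) n = trans (ι-suc (m ℕ.+ n)) (trans (cong (λ z → 1ℚ + z) (ι-+ m n))
    (trans (sym (+-assoc 1ℚ (ι m) (ι n))) (cong (_+ ι n) (sym (ι-suc m)))))

  ι-mono : ∀ {m n} → m ℕ.≤ n → ι m ≤ ι n
  ι-mono {m} {n} m≤n = ≤-diff (subst (0ℚ ≤_) e (0≤ι (n ℕ.∸ m)))
    where
    e : ι (n ℕ.∸ m) ≡ ι n - ι m
    e = sym (trans (cong (λ t → ι t - ι m) (sym (ℕP.m+[n∸m]≡n m≤n)))
          (trans (cong (_- ι m) (ι-+ m (n ℕ.∸ m)))
            (solve 2 (λ a b → (a :+ b) :- a := b) refl (ι m) (ι (n ℕ.∸ m)))))

  ι2^*½^ : ∀ n → ι (2 ℕ.^ n) * ½^ n ≡ 1ℚ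
  ι2^*½^ zero    = refl
  ι2^*½^ (suc n) = trans (cong (_* ½^ (suc n)) (trans (ι-+ N (N ℕ.+ 0)) (cong (λ z → ι N + z) (cong ι (ℕP.+-identityʳ N)))))
    (trans (solve 3 (λ a h b → (a :+ a) :* (h :* b) := (a :* b) :* (h :+ h)) refl (ι N) ½ (½^ n))
      (trans (*-identityʳ _) (ι2^*½^ n)))
    where N = 2 ℕ.^ n

  ι½^≤1 : ∀ n {i} → i ℕ.≤ 2 ℕ.^ n → ι i * ½^ n ≤ 1ℚ
  ι½^≤1 n {i} i≤ = subst (ι i * ½^ n ≤_) (ι2^*½^ n) (*-monoʳ-≤-nonNeg (½^ n) {{nonNegative (0≤½^ n)}} (ι-mono i≤))

  node : ∀ n {c q i} → c ≤ 1ℚ → c ≤ q → i ℕ.≤ 2 ℕ.^ n → c ≤ 1ℚ + ι i * ((q - 1ℚ) * ½^ n)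
  node n {c} {q} {i} c≤1 c≤q i≤ = ≤-diff (subst (0ℚ ≤_) e
      (+-nonNeg (*-nonNeg (diff-≤ (ι½^≤1 n i≤)) (diff-≤ c≤1))
                (*-nonNeg (*-nonNeg (0≤ι i) (0≤½^ n)) (diff-≤ c≤q))))
    where
    e : (1ℚ - ι i * ½^ n) * (1ℚ - c) + ι i * ½^ n * (q - c) ≡ 1ℚ + ι i * ((q - 1ℚ) * ½^ n) - c
    e = solve 4 (λ a b c q → (con 1ℚ :- a :* b) :* (con 1ℚ :- c) :+ a :* b :* (q :- c)
          := con 1ℚ :+ a :* ((q :- con 1ℚ) :* b) :- c) refl (ι i) (½^ n) c q

  rectangles-lipschitz : ∀ {c} h k m → 0ℚ < c →
    (∀ i → i ℕ.≤ m → c ≤ 1ℚ + ι i * h) → (∀ i → i ℕ.≤ m → c ≤ 1ℚ + ι i * k) →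
    ∣ rectangles h m - rectangles k m ∣ ≤ ι m * (∣ h - k ∣ * (inv c * inv c))
  rectangles-lipschitz {c} h k zero _ _ _ = ≤-reflexive (sym (*-zeroˡ (∣ h - k ∣ * (inv c * inv c))))
  rectangles-lipschitz {c} h k (suc m) 0<c H K =
    ∣∣-cong-≤ e₁ (subst (∣ A - B + (s - t) ∣ ≤_) e₂ (triangle {A - B} {s - t}
      (rectangles-lipschitz h k m 0<c (λ i l → H i (ℕP.m≤n⇒m≤1+n l)) (λ i l → K i (ℕP.m≤n⇒m≤1+n l)))
      (subst (λ z → ∣ s - t ∣ ≤ ∣ z ∣ * (inv c * inv c)) e₃
        (term-bound h k 0<c (H (suc m) ℕP.≤-refl) (K (suc m) ℕP.≤-refl)))))
    where
    A = rectangles h m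
    B = rectangles k m
    s = h * inv (1ℚ + ι (suc m) * h)
    t = k * inv (1ℚ + ι (suc m) * k)
    L = ∣ h - k ∣ * (inv c * inv c)
    e₁ : (A + s) - (B + t) ≡ A - B + (s - t)
    e₁ = solve 4 (λ A B s t → (A :+ s) :- (B :+ t) := A :- B :+ (s :- t)) refl A B s t
    e₂ : ι m * L + L ≡ ι (suc m) * L
    e₂ = trans (solve 2 (λ a L → a :* L :+ L := (con 1ℚ :+ a) :* L) refl (ι m) L)
               (cong (_* L) (sym (ι-suc m)))
    e₃ : h * (1ℚ + ι (suc m) * k) - k * (1ℚ + ι (suc m) * h) ≡ h - k
    e₃ = solve 3 (λ h k a → h :* (con 1ℚ :+ a :* k) :- k :* (con 1ℚ :+ a :* h) := h :- k)
           refl h k (ι (suc m))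

  double : ℕ → ℕ
  double zero    = zero
  double (suc m) = suc (suc (double m))

  double≡ : ∀ m → double m ≡ 2 ℕ.* m
  double≡ zero    = refl
  double≡ (suc m) = trans (cong (λ z → suc (suc z)) (double≡ m)) (cong suc (sym (ℕP.+-suc m (m ℕ.+ 0))))

  ι-double : ∀ m → ι (double m) ≡ ι m + ι m
  ι-double m = trans (cong ι (trans (double≡ m) (cong (λ z → m ℕ.+ z) (ℕP.+-identityʳ m)))) (ι-+ m m)

  rectangles-refine : ∀ {c} h m → 0ℚ < c → (∀ i → i ℕ.≤ double m → c ≤ 1ℚ + ι i * h) →
    ∣ rectangles h (double m) - rectangles (h + h) m ∣ ≤ ι m * (∣ h * h ∣ * (inv c * inv c))
  rectangles-refine {c} h zero _ _ = ≤-reflexive (sym (*-zeroˡ (∣ h * h ∣ * (inv c * inv c))))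
  rectangles-refine {c} h (suc m) 0<c H =
    ∣∣-cong-≤ e₁ (subst (∣ A - B + (h * inv a - h * inv b) ∣ ≤_) e₂ (triangle {A - B} {h * inv a - h * inv b}
      (rectangles-refine h m 0<c (λ i l → H i (ℕP.m≤n⇒m≤1+n (ℕP.m≤n⇒m≤1+n l))))
      (subst (λ z → ∣ h * inv a - h * inv b ∣ ≤ ∣ z ∣ * (inv c * inv c)) e₃
        (term-bound h h 0<c (H _ (ℕP.n≤1+n _)) (H _ ℕP.≤-refl)))))
    where
    A = rectangles h (double m)
    B = rectangles (h + h) m
    a = 1ℚ + ι (suc (double m)) * h
    b = 1ℚ + ι (suc (suc (double m))) * h
    b' = 1ℚ + ι (suc m) * (h + h)
    L = ∣ h * h ∣ * (inv c * inv c)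
    bb : b' ≡ b
    bb = cong (λ z → 1ℚ + z) (trans
      (solve 2 (λ s h → s :* (h :+ h) := (s :+ s) :* h) refl (ι (suc m)) h)
      (cong (_* h) (sym (ι-double (suc m)))))
    e₁ : (A + h * inv a + h * inv b) - (B + (h + h) * inv b') ≡ A - B + (h * inv a - h * inv b)
    e₁ = trans (cong (λ z → (A + h * inv a + h * inv b) - (B + (h + h) * inv z)) bb)
      (solve 5 (λ A B h s t → (A :+ h :* s :+ h :* t) :- (B :+ (h :+ h) :* t)
        := A :- B :+ (h :* s :- h :* t)) refl A B h (inv a) (inv b))
    e₂ : ι m * L + L ≡ ι (suc m) * L
    e₂ = trans (solve 2 (λ a L → a :* L :+ L := (con 1ℚ :+ a) :* L) refl (ι m) L)
               (cong (_* L) (sym (ι-suc m)))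
    e₃ : h * b - h * a ≡ h * h
    e₃ = trans (cong (λ z → h * (1ℚ + z * h) - h * a) (ι-suc (suc (double m))))
      (solve 2 (λ h s → h :* (con 1ℚ :+ (con 1ℚ :+ s) :* h) :- h :* (con 1ℚ :+ s :* h) := h :* h)
        refl h (ι (suc (double m))))

  riemann-lipschitz : ∀ n {c q r} → 0ℚ < c → c ≤ 1ℚ → c ≤ q → c ≤ r →
    ∣ riemann n q - riemann n r ∣ ≤ ∣ q - r ∣ * (inv c * inv c)
  riemann-lipschitz n {c} {q} {r} 0<c c≤1 c≤q c≤r =
    subst (∣ riemann n q - riemann n r ∣ ≤_) e
      (rectangles-lipschitz _ _ (2 ℕ.^ n) 0<c (λ i → node n c≤1 c≤q) (λ i → node n c≤1 c≤r))
    where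
    C = inv c * inv c
    N = ι (2 ℕ.^ n)
    e : N * (∣ (q - 1ℚ) * ½^ n - (r - 1ℚ) * ½^ n ∣ * C) ≡ ∣ q - r ∣ * C
    e = trans (cong (λ z → N * (∣ z ∣ * C))
           (solve 3 (λ q r p → (q :- con 1ℚ) :* p :- (r :- con 1ℚ) :* p := (q :- r) :* p) refl q r (½^ n)))
        (trans (cong (λ z → N * (z * C)) (trans (∣p*q∣≡∣p∣*∣q∣ (q - r) (½^ n))
             (cong (∣ q - r ∣ *_) (0≤p⇒∣p∣≡p (0≤½^ n)))))
        (trans (solve 4 (λ N d p C → N :* (d :* p :* C) := (N :* p) :* (d :* C)) refl N ∣ q - r ∣ (½^ n) C)
        (trans (cong (_* (∣ q - r ∣ * C)) (ι2^*½^ n)) (*-identityˡ _))))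

  riemann-step : ∀ n {c q D} → 0ℚ < c → c ≤ 1ℚ → c ≤ q → ∣ q - 1ℚ ∣ ≤ D →
    ∣ riemann (suc n) q - riemann n q ∣ ≤ (D * D * (inv c * inv c)) * ½^ (suc n)
  riemann-step n {c} {q} {D} 0<c c≤1 c≤q ≤D = begin
    ∣ riemann (suc n) q - riemann n q ∣
      ≡⟨ cong₂ (λ s t → ∣ rectangles h s - rectangles t N ∣) (sym (double≡ N)) (sym hh) ⟩
    ∣ rectangles h (double N) - rectangles (h + h) N ∣
      ≤⟨ rectangles-refine h N 0<c (λ i l → node (suc n) c≤1 c≤q (subst (i ℕ.≤_) (double≡ N) l)) ⟩
    ι N * (∣ h * h ∣ * C)
      ≤⟨ *-monoˡ-≤-nonNeg (ι N) {{nonNegative (0≤ι N)}}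
          (*-monoʳ-≤-nonNeg C {{nonNegative 0≤C}} (∣*∣-≤ {h} {h} h≤ h≤)) ⟩
    ι N * ((D * p) * (D * p) * C)
      ≡⟨ solve 5 (λ N D x h C → N :* ((D :* (h :* x)) :* (D :* (h :* x)) :* C)
           := (D :* D :* C) :* (h :* x) :* ((N :* x) :* h)) refl (ι N) D (½^ n) ½ C ⟩
    (D * D * C) * p * ((ι N * ½^ n) * ½)
      ≡⟨ cong (λ z → (D * D * C) * p * (z * ½)) (ι2^*½^ n) ⟩
    (D * D * C) * p * ½
      ≤⟨ *-monoˡ-≤-nonNeg ((D * D * C) * p) {{nonNegative (*-nonNeg (*-nonNeg (*-nonNeg 0≤D 0≤D) 0≤C) (0≤½^ (suc n)))}} ½≤1 ⟩
    (D * D * C) * p * 1ℚ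
      ≡⟨ *-identityʳ _ ⟩
    (D * D * C) * p ∎
    where
    open ≤-Reasoning
    N = 2 ℕ.^ n
    p = ½^ (suc n)
    h = (q - 1ℚ) * p
    C = inv c * inv c
    0≤C = *-nonNeg (proj₂ (inv-pos 0<c)) (proj₂ (inv-pos 0<c))
    0≤D = ≤-trans (0≤∣∣ (q - 1ℚ)) ≤D
    ½≤1 : ½ ≤ 1ℚ
    ½≤1 = ≤-diff 0≤½
    h≤ : ∣ h ∣ ≤ D * p
    h≤ = ∣*∣-≤ {q - 1ℚ} {p} ≤D (≤-reflexive (0≤p⇒∣p∣≡p (0≤½^ (suc n))))
    hh : h + h ≡ (q - 1ℚ) * ½^ n
    hh = trans (solve 3 (λ d x y → d :* (y :* x) :+ d :* (y :* x) := d :* ((y :+ y) :* x)) refl (q - 1ℚ) (½^ n) ½)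
           (cong ((q - 1ℚ) *_) (*-identityˡ _))

  riemann-tail : ∀ m k {c q D} → 0ℚ < c → c ≤ 1ℚ → c ≤ q → ∣ q - 1ℚ ∣ ≤ D →
    ∣ riemann (k ℕ.+ m) q - riemann m q ∣ ≤ (D * D * (inv c * inv c)) * (½^ m - ½^ (k ℕ.+ m))
  riemann-tail m zero {c} {q} {D} _ _ _ _ = ≤-reflexive (trans (cong ∣_∣ (+-inverseʳ (riemann m q)))
    (sym (trans (cong ((D * D * (inv c * inv c)) *_) (+-inverseʳ (½^ m))) (*-zeroʳ (D * D * (inv c * inv c))))))
  riemann-tail m (suc k) {c} {q} {D} 0<c c≤1 c≤q ≤D =
    ∣∣-cong-≤ e₁ (subst (∣ (R₂ - R₁) + (R₁ - R₀) ∣ ≤_) e₂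
      (triangle {R₂ - R₁} {R₁ - R₀} (riemann-step (k ℕ.+ m) 0<c c≤1 c≤q ≤D) (riemann-tail m k 0<c c≤1 c≤q ≤D)))
    where
    R₂ = riemann (suc (k ℕ.+ m)) q
    R₁ = riemann (k ℕ.+ m) q
    R₀ = riemann m q
    K = D * D * (inv c * inv c)
    x = ½^ (k ℕ.+ m)
    e₁ : R₂ - R₀ ≡ (R₂ - R₁) + (R₁ - R₀)
    e₁ = solve 3 (λ a b c → a :- c := (a :- b) :+ (b :- c)) refl R₂ R₁ R₀
    e₂ : K * (½ * x) + K * (½^ m - x) ≡ K * (½^ m - ½ * x)
    e₂ = trans (cong (λ z → K * (½ * x) + K * (½^ m - z)) (sym (trans (sym (*-distribʳ-+ x ½ ½)) (*-identityˡ x))))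
      (solve 3 (λ K m y → K :* y :+ K :* (m :- (y :+ y)) := K :* (m :- y)) refl K (½^ m) (½ * x))

  archimedean : ∀ p → ∃[ n ] p ≤ ι n
  archimedean p@(mkℚ z d _) = ℤ.∣ z ∣ , toℚᵘ-cancel-≤
      (ℚᵘP.≤-trans (ℚᵘ.*≤* l) (ℚᵘP.≤-reflexive (ℚᵘP.≃-sym (toℚᵘ-fromℚᵘ (ℚᵘ.mkℚᵘ (+ ℤ.∣ z ∣) 0)))))
    where
    l : z ℤ.* + 1 ℤ.≤ + ℤ.∣ z ∣ ℤ.* + suc d
    l = ℤP.≤-trans (ℤP.≤-reflexive (ℤP.*-identityʳ z))
        (ℤP.≤-trans (i≤∣i∣ z) (subst (+ ℤ.∣ z ∣ ℤ.≤_) (ℤP.pos-* ℤ.∣ z ∣ (suc d)) (ℤ.+≤+ (ℕP.m≤m*n ℤ.∣ z ∣ (suc d)))))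
      where
      i≤∣i∣ : ∀ i → i ℤ.≤ + ℤ.∣ i ∣
      i≤∣i∣ (+ n) = ℤP.≤-refl
      i≤∣i∣ (ℤ.-[1+ n ]) = ℤ.-≤+

  ι*½^≤1 : ∀ n → ι n * ½^ n ≤ 1ℚ
  ι*½^≤1 n = ι½^≤1 n (n≤2^n n)
    where
    n≤2^n : ∀ n → n ℕ.≤ 2 ℕ.^ n
    n≤2^n zero    = ℕ.z≤n
    n≤2^n (suc n) = ℕP.+-mono-≤ (ℕP.m^n>0 2 n) (subst (n ℕ.≤_) (sym (ℕP.+-identityʳ (2 ℕ.^ n))) (n≤2^n n))

  ½^-small : ∀ K {ε} → 0ℚ < ε → ∃[ M ] (∀ n → M ℕ.≤ n → K * ½^ n ≤ ε)
  ½^-small K {ε} 0<ε with archimedean (K * inv ε)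
  ... | M , bd = M , λ n M≤n → begin
      K * ½^ n                   ≡⟨ sym (cong (_* ½^ n) (trans (cong (K *_) (proj₁ (inv-pos 0<ε))) (*-identityʳ K))) ⟩
      K * (ε * inv ε) * ½^ n     ≡⟨ solve 4 (λ K e i x → K :* (e :* i) :* x := e :* ((K :* i) :* x)) refl K ε (inv ε) (½^ n) ⟩
      ε * ((K * inv ε) * ½^ n)   ≤⟨ *-monoˡ-≤-nonNeg ε {{nonNegative (<⇒≤ 0<ε)}}
                                      (*-monoʳ-≤-nonNeg (½^ n) {{nonNegative (0≤½^ n)}} (≤-trans bd (ι-mono M≤n))) ⟩
      ε * (ι n * ½^ n)           ≤⟨ *-monoˡ-≤-nonNeg ε {{nonNegative (<⇒≤ 0<ε)}} (ι*½^≤1 n) ⟩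
      ε * 1ℚ                     ≡⟨ *-identityʳ ε ⟩
      ε ∎
    where open ≤-Reasoning

open RationalLemmas

------------------------------------------------------------------------
-- Real numbers, as Cauchy sequences of rationals up to _≃ℝ_

record ℝ : Set where
  field
    seq    : ℕ → ℚ
    cauchy : ∀ {ε} → 0ℚ < ε →
             ∃[ N ] (∀ m n → N ℕ.≤ m → N ℕ.≤ n → ∣ seq m - seq n ∣ ≤ ε)

open ℝ public

infix 4 _<ℝ_ _≤ℝ_ _≃ℝ_

_<ℝ_ : ℝ → ℝ → Set
x <ℝ y = ∃[ δ ] (0ℚ < δ × ∃[ N ] (∀ n → N ℕ.≤ n → seq x n + δ ≤ seq y n))

_≤ℝ_ : ℝ → ℝ → Set
x ≤ℝ y = ¬ (y <ℝ x)

_≃ℝ_ : ℝ → ℝ → Set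
x ≃ℝ y = x ≤ℝ y × y ≤ℝ x

fromℚ : ℚ → ℝ
fromℚ q = record
  { seq    = λ _ → q
  ; cauchy = λ 0<ε → 0 , λ _ _ _ _ → subst (λ z → ∣ z ∣ ≤ _) (sym (+-inverseʳ q)) (<⇒≤ 0<ε)
  }

fromℕ : ℕ → ℝ
fromℕ n = fromℚ (ι n)

0ℝ 1ℝ ½ℝ : ℝ
0ℝ = fromℚ 0ℚ
1ℝ = fromℚ 1ℚ
½ℝ = fromℚ ½

module CauchyLemmas where
  half-pos : ∀ {ε} → 0ℚ < ε → 0ℚ < ε * ½
  half-pos 0<ε = *-pos 0<ε (positive⁻¹ ½)

  bounded : ∀ x → ∃[ B ] (0ℚ < B × ∃[ N ] (∀ n → N ℕ.≤ n → ∣ seq x n ∣ ≤ B))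
  bounded x with cauchy x 0<1
  ... | N , close = 1ℚ + ∣ seq x N ∣
      , subst (_< 1ℚ + ∣ seq x N ∣) (+-identityˡ 0ℚ) (+-mono-<-≤ 0<1 (0≤∣∣ (seq x N)))
      , N , λ n N≤n → ∣∣-cong-≤ (solve 2 (λ a b → a := (a :- b) :+ b) refl (seq x n) (seq x N))
              (triangle {seq x n - seq x N} (close n N N≤n ℕP.≤-refl) ≤-refl)

  product-close : ∀ a b c d {A B δ} → ∣ a ∣ ≤ A → ∣ d ∣ ≤ B → ∣ a - c ∣ ≤ δ → ∣ b - d ∣ ≤ δ →
                  ∣ a * b - c * d ∣ ≤ A * δ + δ * B
  product-close a b c d a≤ d≤ dx dy = ∣∣-cong-≤
    (solve 4 (λ a b c d → a :* b :- c :* d := a :* (b :- d) :+ (a :- c) :* d) refl a b c d)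
    (triangle {a * (b - d)} {(a - c) * d} (∣*∣-≤ {a} {b - d} a≤ dy) (∣*∣-≤ {a - c} {d} dx d≤))

  split : ∀ {A B ε} → 0ℚ < A → 0ℚ < B → 0ℚ < ε → ∃[ δ ] (0ℚ < δ × A * δ + δ * B ≡ ε)
  split {A} {B} {ε} 0<A 0<B 0<ε = ε * inv (A + B) , *-pos 0<ε (inv>0 0<A+B) , e
    where
    0<A+B : 0ℚ < A + B
    0<A+B = subst (_< A + B) (+-identityˡ 0ℚ) (+-mono-< 0<A 0<B)
    e : A * (ε * inv (A + B)) + (ε * inv (A + B)) * B ≡ ε
    e = trans (solve 4 (λ A B e i → A :* (e :* i) :+ (e :* i) :* B := e :* ((A :+ B) :* i)) refl
                A B ε (inv (A + B)))
          (trans (cong (ε *_) (proj₁ (inv-pos 0<A+B))) (*-identityʳ ε))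

  Bounded : ℝ → Set
  Bounded x = ∃[ B ] (0ℚ < B × ∃[ N ] (∀ n → N ℕ.≤ n → ∣ seq x n ∣ ≤ B))

  Close : (ℕ → ℚ) → ℚ → Set
  Close s ε = ∃[ N ] (∀ m n → N ℕ.≤ m → N ℕ.≤ n → ∣ s m - s n ∣ ≤ ε)

  product-cauchy : ∀ x y {ε} → 0ℚ < ε → Bounded x → Bounded y → Close (λ n → seq x n * seq y n) ε
  product-cauchy x y {ε} 0<ε (A , 0<A , M₁ , X) (B , 0<B , M₂ , Y) = go (split 0<A 0<B 0<ε)
    where
    go : ∃[ δ ] (0ℚ < δ × A * δ + δ * B ≡ ε) → Close (λ n → seq x n * seq y n) ε
    go (δ , 0<δ , e) = go′ (cauchy x 0<δ) (cauchy y 0<δ)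
      where
      go′ : Close (seq x) δ → Close (seq y) δ → Close (λ n → seq x n * seq y n) ε
      go′ (N₁ , dx) (N₂ , dy) = (M₁ ℕ.⊔ M₂) ℕ.⊔ (N₁ ℕ.⊔ N₂) , λ m n k l →
        let k₁ = ℕP.m⊔n≤o⇒m≤o (M₁ ℕ.⊔ M₂) (N₁ ℕ.⊔ N₂) k
            l₁ = ℕP.m⊔n≤o⇒m≤o (M₁ ℕ.⊔ M₂) (N₁ ℕ.⊔ N₂) l
            k₂ = ℕP.m⊔n≤o⇒n≤o (M₁ ℕ.⊔ M₂) (N₁ ℕ.⊔ N₂) k
            l₂ = ℕP.m⊔n≤o⇒n≤o (M₁ ℕ.⊔ M₂) (N₁ ℕ.⊔ N₂) l
        in subst (∣ seq x m * seq y m - seq x n * seq y n ∣ ≤_) e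
             (product-close (seq x m) (seq y m) (seq x n) (seq y n)
               (X m (ℕP.m⊔n≤o⇒m≤o M₁ M₂ k₁)) (Y n (ℕP.m⊔n≤o⇒n≤o M₁ M₂ l₁))
               (dx m n (ℕP.m⊔n≤o⇒m≤o N₁ N₂ k₂) (ℕP.m⊔n≤o⇒m≤o N₁ N₂ l₂))
               (dy m n (ℕP.m⊔n≤o⇒n≤o N₁ N₂ k₂) (ℕP.m⊔n≤o⇒n≤o N₁ N₂ l₂)))

open CauchyLemmas

infixl 7 _*ℝ_
infixl 6 _+ℝ_ _-ℝ_
infix  8 -ℝ_

_+ℝ_ : ℝ → ℝ → ℝ
seq (x +ℝ y) n = seq x n + seq y n
cauchy (x +ℝ y) {ε} 0<ε with cauchy x (half-pos 0<ε) | cauchy y (half-pos 0<ε)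
... | M , X | N , Y = M ℕ.⊔ N , λ m n k l →
  ∣∣-cong-≤ (solve 4 (λ a b c d → (a :+ b) :- (c :+ d) := (a :- c) :+ (b :- d)) refl
               (seq x m) (seq y m) (seq x n) (seq y n))
    (subst (_ ≤_) (half-sum ε)
      (triangle {seq x m - seq x n} {seq y m - seq y n}
        (X m n (ℕP.m⊔n≤o⇒m≤o M N k) (ℕP.m⊔n≤o⇒m≤o M N l))
        (Y m n (ℕP.m⊔n≤o⇒n≤o M N k) (ℕP.m⊔n≤o⇒n≤o M N l))))

-ℝ_ : ℝ → ℝ
seq (-ℝ x) n = - seq x n
cauchy (-ℝ x) 0<ε with cauchy x 0<ε
... | N , X = N , λ m n k l →
  ∣∣-cong-≤ (solve 2 (λ a b → (:- a) :- (:- b) := b :- a) refl (seq x m) (seq x n)) (X n m l k)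

_-ℝ_ : ℝ → ℝ → ℝ
x -ℝ y = x +ℝ (-ℝ y)

_*ℝ_ : ℝ → ℝ → ℝ
seq (x *ℝ y) n = seq x n * seq y n
cauchy (x *ℝ y) 0<ε = product-cauchy x y 0<ε (bounded x) (bounded y)

module LogLemmas where
  riemann-close : ∀ m n q r {c D} → 0ℚ < c → c ≤ 1ℚ → c ≤ q → c ≤ r → ∣ r - 1ℚ ∣ ≤ D → m ℕ.≤ n →
    ∣ riemann n r - riemann m q ∣ ≤ (D * D * (inv c * inv c)) * ½^ m + ∣ r - q ∣ * (inv c * inv c)
  riemann-close m n q r {c} {D} 0<c c≤1 c≤q c≤r ≤D m≤n = ∣∣-cong-≤
      (solve 3 (λ a b c → a :- c := (a :- b) :+ (b :- c)) refl R₁ R₂ R₃)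
      (triangle {R₁ - R₂} {R₂ - R₃} tail (riemann-lipschitz m 0<c c≤1 c≤r c≤q))
    where
    R₁ = riemann n r
    R₂ = riemann m r
    R₃ = riemann m q
    C = inv c * inv c
    K = D * D * C
    d = n ℕ.∸ m
    0≤D = ≤-trans (0≤∣∣ (r - 1ℚ)) ≤D
    0≤K : 0ℚ ≤ K
    0≤K = *-nonNeg (*-nonNeg 0≤D 0≤D) (*-nonNeg (<⇒≤ (inv>0 0<c)) (<⇒≤ (inv>0 0<c)))
    drop : K * (½^ m - ½^ (d ℕ.+ m)) ≤ K * ½^ m
    drop = *-monoˡ-≤-nonNeg K {{nonNegative 0≤K}} (≤-diff (subst (0ℚ ≤_)
      (solve 2 (λ a b → b := a :- (a :- b)) refl (½^ m) (½^ (d ℕ.+ m))) (0≤½^ (d ℕ.+ m))))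
    tail : ∣ R₁ - R₂ ∣ ≤ K * ½^ m
    tail = subst (λ z → ∣ riemann z r - R₂ ∣ ≤ K * ½^ m) (ℕP.m∸n+n≡m m≤n)
      (≤-trans (riemann-tail m d 0<c c≤1 c≤r ≤D) drop)

  η-pos : ∀ {c ε} → 0ℚ < c → 0ℚ < ε → ∃[ η ] (0ℚ < η × η * (inv c * inv c) ≡ ε)
  η-pos {c} {ε} 0<c 0<ε = ε * (c * c) , *-pos 0<ε (*-pos 0<c 0<c) , e
    where
    e : ε * (c * c) * (inv c * inv c) ≡ ε
    e = trans (solve 3 (λ e c i → e :* (c :* c) :* (i :* i) := e :* ((c :* i) :* (c :* i))) refl ε c (inv c))
          (trans (cong (λ z → ε * (z * z)) (proj₁ (inv-pos 0<c))) (*-identityʳ ε))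

  ∣-∣-sym : ∀ p q {r} → ∣ p - q ∣ ≤ r → ∣ q - p ∣ ≤ r
  ∣-∣-sym p q {r} = subst (_≤ r) (trans (sym (∣-p∣≡∣p∣ (p - q)))
    (cong ∣_∣ (solve 2 (λ p q → :- (p :- q) := q :- p) refl p q)))

  0<⊓1 : ∀ {p} → 0ℚ < p → 0ℚ < p ⊓ 1ℚ
  0<⊓1 {p} 0<p with ⊓-sel p 1ℚ
  ... | inj₁ e = subst (0ℚ <_) (sym e) 0<p
  ... | inj₂ e = subst (0ℚ <_) (sym e) 0<1

  log-cauchy : ∀ x {ε} → 0ℝ <ℝ x → Bounded (x -ℝ 1ℝ) → 0ℚ < ε → Close (λ n → riemann n (seq x n)) ε
  log-cauchy x {ε} (δ , 0<δ , M₁ , pos) (D , _ , M₂ , bd) 0<ε = go (η-pos 0<c (half-pos 0<ε))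
    where
    c = δ ⊓ 1ℚ
    C = inv c * inv c
    K = D * D * C
    0<c : 0ℚ < c
    0<c = 0<⊓1 0<δ
    0≤C : 0ℚ ≤ C
    0≤C = *-nonNeg (<⇒≤ (inv>0 0<c)) (<⇒≤ (inv>0 0<c))
    c≤x : ∀ n → M₁ ℕ.≤ n → c ≤ seq x n
    c≤x n l = ≤-trans (p⊓q≤p δ 1ℚ) (subst (_≤ seq x n) (+-identityˡ δ) (pos n l))

    go : ∃[ η ] (0ℚ < η × η * C ≡ ε * ½) → Close (λ n → riemann n (seq x n)) ε
    go (η , 0<η , ηC) = go′ (cauchy x 0<η) (½^-small K (half-pos 0<ε))
      where
      go′ : Close (seq x) η → ∃[ M ] (∀ n → M ℕ.≤ n → K * ½^ n ≤ ε * ½) →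
            Close (λ n → riemann n (seq x n)) ε
      go′ (N₁ , dx) (N₂ , small) = M , λ m n k l → either m n k l (ℕP.≤-total m n)
        where
        M = (M₁ ℕ.⊔ M₂) ℕ.⊔ (N₁ ℕ.⊔ N₂)
        split-M : ∀ {n} → M ℕ.≤ n → (M₁ ℕ.≤ n × M₂ ℕ.≤ n) × (N₁ ℕ.≤ n × N₂ ℕ.≤ n)
        split-M {n} l = (ℕP.m⊔n≤o⇒m≤o M₁ M₂ a , ℕP.m⊔n≤o⇒n≤o M₁ M₂ a)
                      , (ℕP.m⊔n≤o⇒m≤o N₁ N₂ b , ℕP.m⊔n≤o⇒n≤o N₁ N₂ b)
          where
          a = ℕP.m⊔n≤o⇒m≤o (M₁ ℕ.⊔ M₂) (N₁ ℕ.⊔ N₂) l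
          b = ℕP.m⊔n≤o⇒n≤o (M₁ ℕ.⊔ M₂) (N₁ ℕ.⊔ N₂) l
        ordered : ∀ m n → M ℕ.≤ m → M ℕ.≤ n → m ℕ.≤ n →
                  ∣ riemann n (seq x n) - riemann m (seq x m) ∣ ≤ ε
        ordered m n k l m≤n with split-M k | split-M l
        ... | (a , b) , (k₁ , k₂) | (a′ , b′) , (l₁ , l₂) =
          ≤-trans (riemann-close m n (seq x m) (seq x n) 0<c (p⊓q≤q δ 1ℚ) (c≤x m a) (c≤x n a′) (bd n b′) m≤n)
            (subst (K * ½^ m + ∣ seq x n - seq x m ∣ * C ≤_) (half-sum ε) (+-mono-≤ (small m k₂)
              (subst (∣ seq x n - seq x m ∣ * C ≤_) ηC
                (*-monoʳ-≤-nonNeg C {{nonNegative 0≤C}} (dx n m l₁ k₁)))))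
        either : ∀ m n → M ℕ.≤ m → M ℕ.≤ n → m ℕ.≤ n ⊎ n ℕ.≤ m →
                 ∣ riemann m (seq x m) - riemann n (seq x n) ∣ ≤ ε
        either m n k l (inj₁ m≤n) = ∣-∣-sym (riemann n (seq x n)) (riemann m (seq x m)) (ordered m n k l m≤n)
        either m n k l (inj₂ n≤m) = ordered n m l k n≤m

open LogLemmas

-- log x = ∫₁ˣ dt/t: the n-th term is the Riemann sum with 2ⁿ pieces up to the
-- n-th approximation of x.  Finitely many of these may be ≤ 0, and the
-- convention inv 0 = 0 only matters there.
log : (x : ℝ) → 0ℝ <ℝ x → ℝ
seq (log x _) n = riemann n (seq x n)
cauchy (log x 0<x) 0<ε = log-cauchy x 0<x (bounded (x -ℝ 1ℝ)) 0<ε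

------------------------------------------------------------------------
-- Friable values of X² + 1

P⁺ : (n : ℕ) → .{{ℕ.NonZero n}} → ℕ
P⁺ n = foldr ℕ._⊔_ 1 (factors (factorise n))

F : ℕ → ℕ
F n = n ℕ.^ 2 ℕ.+ 1

F-nonZero : ∀ n → ℕ.NonZero (F n)
F-nonZero n = ℕ.>-nonZero (ℕP.m≤n+m 1 (n ℕ.^ 2))

-- Ψ_F(x,y) = N.  A relation rather than a function, because n ≤ x is not
-- decidable for real x.
IsΨF : ℝ → ℝ → ℕ → Set
IsΨF x y N = ∃[ ns ]
  ( Unique ns
  × (∀ n → n ∈ ns ⇔ (1 ℕ.≤ n × fromℕ n ≤ℝ x × fromℕ (P⁺ (F n) {{F-nonZero n}}) ≤ℝ y))
  × length ns ≡ N )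

{-# OPTIONS --safe #-}

-- If P⁺(n² + 1) > y then n² + 1 has a prime factor exceeding y ≥ x, which contributes
-- more than log y to Σ_{n ≤ x} log (n² + 1) = 2 x log x + O(x).  The primes p ≤ x already
-- account for x log x - O(x) of that sum: p divides n² + 1 for about (1 + χ(p)) x / p of
-- the n ≤ x, where χ is the non-principal character modulo 4, and
-- Σ_{p ≤ x} (1 + χ(p)) log p / p ≥ log x - O(1) follows from Stirling's formula,
-- Chebyshev's bound and L(1, χ) > 0.  Hence at most x log x / log y + O(x / log y), that
-- is (u + o(1)) x, of the n ≤ x are not counted by Ψ_F(x, y).
--
-- The logarithms of the primes may be replaced by rational approximations: every estimate
-- holds with absolute constants for any exactly additive ℓ : ℕ → ℚ that is monotone and
-- satisfies n (ℓ(n + 1) - ℓ(n)) ≤ 2 on a sufficiently long initial segment.  Such an ℓ is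
-- obtained by extending the n-th Riemann sums of log p, n large, additively.
module Submission where

open import Defs
open import Data.Nat.Base using (ℕ)
open import Data.Product.Base using (∃-syntax)

-- The sum of χ(p) log p / p is bounded below by evaluating A = Σ_{n ≤ x} χ(n) ℓ(n) / n twice.
-- Adding 2 L(x), where L(x) = Σ_{n ≤ x} χ(n) / n, makes the absolute values of the terms decrease,
-- so A ≥ -2 L(x); expanding ℓ over prime powers gives A ≤ L(x) Σ Λ(d) χ(d) / d + 8. As L(x) ≥ 1/2,
-- the last sum is at least -18. Exact additivity makes the expansion ℓ(m) = Σ_{d | m} Λ(d) an
-- identity, so rounding errors enter only through monotonicity and the step bound. A real x has no
-- computable floor, so x and y are trapped in windows [X, X + 2] and [Y, Y + 2] with natural
-- numbers X ≤ Y. Since `≤ℝ` is the negation of `<ℝ`, denying the conclusion yields an inequality of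
-- rationals, with a fixed margin, at every late index n. Each such index gives u log y + 1 ≤ log x
-- for the n-th approximations, against u log y = log x. No limit is taken: X and Y determine the
-- segment on which ℓ must behave, and only then is n required to be large.

-- Finite sums over ℚ and sums over multiples.

module Sums where
  open import Data.Nat.Base as ℕ using (ℕ; zero; suc; z≤n; s≤s)
  import Data.Nat.DivMod as ℕD
  import Data.Nat.Divisibility as ℕ∣
  import Data.Nat.Properties as ℕP
  open import Data.Rational.Base hiding (_÷_)
  open import Data.Rational.Properties
  open import Data.Rational.Solver using (module +-*-Solver)
  open import Relation.Binary.PropositionalEquality
  open import Relation.Nullary using (¬_; Dec; yes; no; contradiction)
  open RationalLemmas
  open +-*-Solver using (solve; _:+_; _:*_; _:=_; con)

  -- Polynomial inequalities are proved in this form: a visibly non-negative e is supplied, and the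
  -- ring solver identifies it with q - p.
  ≤-by : ∀ {p q e} → 0ℚ ≤ e → e ≡ q - p → p ≤ q
  ≤-by 0≤e e≡ = ≤-diff (subst (0ℚ ≤_) e≡ 0≤e)

  -- Sums run over 1 ≤ i ≤ n.
  ∑ : ℕ → (ℕ → ℚ) → ℚ
  ∑ zero    f = 0ℚ
  ∑ (suc n) f = ∑ n f + f (suc n)

  ∑-cong : ∀ n {f g} → (∀ i → 1 ℕ.≤ i → i ℕ.≤ n → f i ≡ g i) → ∑ n f ≡ ∑ n g
  ∑-cong zero    _ = refl
  ∑-cong (suc n) e = cong₂ _+_ (∑-cong n (λ i a b → e i a (ℕP.m≤n⇒m≤1+n b))) (e (suc n) (s≤s z≤n)
      ℕP.≤-refl)

  ∑-mono : ∀ n {f g} → (∀ i → 1 ℕ.≤ i → i ℕ.≤ n → f i ≤ g i) → ∑ n f ≤ ∑ n g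
  ∑-mono zero    _ = ≤-refl
  ∑-mono (suc n) e = +-mono-≤ (∑-mono n (λ i a b → e i a (ℕP.m≤n⇒m≤1+n b))) (e (suc n) (s≤s z≤n)
      ℕP.≤-refl)

  ∑-zero : ∀ n {f} → (∀ i → 1 ℕ.≤ i → i ℕ.≤ n → f i ≡ 0ℚ) → ∑ n f ≡ 0ℚ
  ∑-zero zero    _ = refl
  ∑-zero (suc n) e = cong₂ _+_ (∑-zero n (λ i a b → e i a (ℕP.m≤n⇒m≤1+n b))) (e (suc n) (s≤s z≤n)
      ℕP.≤-refl)

  ∑-nonNeg : ∀ n {f} → (∀ i → 1 ℕ.≤ i → i ℕ.≤ n → 0ℚ ≤ f i) → 0ℚ ≤ ∑ n f
  ∑-nonNeg n {f} e = subst (_≤ ∑ n f) (∑-zero n {λ _ → 0ℚ} (λ _ _ _ → refl)) (∑-mono n e)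

  ∑-+ : ∀ n f g → ∑ n (λ i → f i + g i) ≡ ∑ n f + ∑ n g
  ∑-+ zero    f g = refl
  ∑-+ (suc n) f g = trans (cong (_+ (f (suc n) + g (suc n))) (∑-+ n f g))
    (solve 4 (λ a b c d → (a :+ b) :+ (c :+ d) := (a :+ c) :+ (b :+ d)) refl (∑ n f) (∑ n g)
        (f (suc n)) (g (suc n)))

  ∑-* : ∀ n c f → ∑ n (λ i → c * f i) ≡ c * ∑ n f
  ∑-* zero    c f = sym (*-zeroʳ c)
  ∑-* (suc n) c f = trans (cong (_+ c * f (suc n)) (∑-* n c f)) (sym (*-distribˡ-+ c _ _))

  ∑-swap : ∀ m n (f : ℕ → ℕ → ℚ) → ∑ m (λ i → ∑ n (f i)) ≡ ∑ n (λ j → ∑ m (λ i → f i j))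
  ∑-swap zero    n f = sym (∑-zero n (λ _ _ _ → refl))
  ∑-swap (suc m) n f = trans (cong (_+ ∑ n (f (suc m))) (∑-swap m n f))
    (sym (∑-+ n (λ j → ∑ m (λ i → f i j)) (f (suc m))))

  ∑-split : ∀ m n f → ∑ (m ℕ.+ n) f ≡ ∑ m f + ∑ n (λ i → f (m ℕ.+ i))
  ∑-split m zero    f = trans (cong (λ z → ∑ z f) (ℕP.+-identityʳ m)) (sym (+-identityʳ _))
  ∑-split m (suc n) f = trans (cong (λ z → ∑ z f) (ℕP.+-suc m n))
    (trans (cong₂ _+_ (∑-split m n f) (cong f (sym (ℕP.+-suc m n))))
        (+-assoc (∑ m f) (∑ n (λ i → f (m ℕ.+ i))) (f (m ℕ.+ suc n))))

  ∑-const : ∀ n c → ∑ n (λ _ → c) ≡ ι n * c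
  ∑-const zero    c = sym (*-zeroˡ c)
  ∑-const (suc n) c = trans (cong (_+ c) (∑-const n c))
    (trans (solve 2 (λ a c → a :* c :+ c := (con 1ℚ :+ a) :* c) refl (ι n) c)
        (cong (_* c) (sym (ι-suc n))))

  ∑-monoˡ : ∀ {m n} f → m ℕ.≤ n → (∀ i → 1 ℕ.≤ i → i ℕ.≤ n → 0ℚ ≤ f i) → ∑ m f ≤ ∑ n f
  ∑-monoˡ {m} {n} f m≤n 0≤f = subst₂ _≤_ (+-identityʳ _)
    (trans (sym (∑-split m (n ℕ.∸ m) f)) (cong (λ z → ∑ z f) (ℕP.m+[n∸m]≡n m≤n)))
    (+-monoʳ-≤ (∑ m f) (∑-nonNeg (n ℕ.∸ m) (λ i 1≤i i≤ → 0≤f (m ℕ.+ i) (ℕP.≤-trans 1≤i (ℕP.m≤n+m i m))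
      (subst (m ℕ.+ i ℕ.≤_) (ℕP.m+[n∸m]≡n m≤n) (ℕP.+-monoʳ-≤ m i≤)))))

  ∑-single : ∀ n f {j} → 1 ℕ.≤ j → j ℕ.≤ n → (∀ i → 1 ℕ.≤ i → i ℕ.≤ n → i ≢ j → f i ≡ 0ℚ) → ∑ n f ≡ f j
  ∑-single zero    f 1≤j j≤n _ = contradiction (ℕP.≤-trans 1≤j j≤n) λ ()
  ∑-single (suc n) f {j} 1≤j j≤n e with suc n ℕP.≟ j
  ... | yes refl = trans (cong (_+ f (suc n)) (∑-zero n (λ i a b → e i a (ℕP.m≤n⇒m≤1+n b)
      (ℕP.<⇒≢ (s≤s b))))) (+-identityˡ _)
  ... | no  n≢j  = trans (cong₂ _+_
      (∑-single n f 1≤j (ℕP.≤-pred (ℕP.≤∧≢⇒< j≤n (λ z → n≢j (sym z))))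
          (λ i a b → e i a (ℕP.m≤n⇒m≤1+n b)))
      (e (suc n) (s≤s z≤n) ℕP.≤-refl n≢j)) (+-identityʳ _)

  ⟦_⟧ : {P : Set} → Dec P → ℚ
  ⟦ yes _ ⟧ = 1ℚ
  ⟦ no _ ⟧  = 0ℚ

  ⟦⟧-yes : ∀ {P : Set} (d : Dec P) → P → ⟦ d ⟧ ≡ 1ℚ
  ⟦⟧-yes (yes _) _ = refl
  ⟦⟧-yes (no ¬p) p = contradiction p ¬p

  ⟦⟧-no : ∀ {P : Set} (d : Dec P) → ¬ P → ⟦ d ⟧ ≡ 0ℚ
  ⟦⟧-no (yes p) ¬p = contradiction p ¬p
  ⟦⟧-no (no _)  _  = refl

  ⟦⟧-nonNeg : ∀ {P : Set} (d : Dec P) → 0ℚ ≤ ⟦ d ⟧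
  ⟦⟧-nonNeg (yes _) = 0≤1
  ⟦⟧-nonNeg (no _)  = ≤-refl

  ⟦⟧-mono : ∀ {P Q : Set} (d : Dec P) (e : Dec Q) → (P → Q) → ⟦ d ⟧ ≤ ⟦ e ⟧
  ⟦⟧-mono (yes p) (yes _) _ = ≤-refl
  ⟦⟧-mono (yes p) (no ¬q) f = contradiction (f p) ¬q
  ⟦⟧-mono (no _)  e       _ = ⟦⟧-nonNeg e

  ⟦⟧-cong : ∀ {P Q : Set} (d : Dec P) (e : Dec Q) → (P → Q) → (Q → P) → ⟦ d ⟧ ≡ ⟦ e ⟧
  ⟦⟧-cong d e f g = ≤-antisym (⟦⟧-mono d e f) (⟦⟧-mono e d g)

  infixl 7 _÷_

  -- Floor division made total, so that it can stand under sums whose index carries no `NonZero`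
  -- instance.
  _÷_ : ℕ → ℕ → ℕ
  n ÷ zero  = 0
  n ÷ suc d = n ℕ./ suc d

  -- The range is cut into blocks of length d. Only the last index of a block is a multiple of d,
  -- and the remainder, shorter than d, contains none.
  ∑-multiples : ∀ d x (h : ℕ → ℚ) → 1 ℕ.≤ d →
    ∑ x (λ n → ⟦ d ℕ∣.∣? n ⟧ * h n) ≡ ∑ (x ÷ d) (λ m → h (d ℕ.* m))
  ∑-multiples d@(suc d-1) x h _ = subst (λ z → ∑ z g ≡ ∑ (x ÷ d) (λ m → h (d ℕ.* m)))
      (trans (ℕP.+-comm (x ℕ./ d ℕ.* d) (x ℕ.% d)) (sym (ℕD.m≡m%n+[m/n]*n x d)))
      (trans (∑-split (x ℕ./ d ℕ.* d) (x ℕ.% d) g)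
        (trans (cong₂ _+_ (blocks (x ℕ./ d)) (short (x ℕ./ d) (x ℕ.% d) (ℕD.m%n<n x d)))
            (+-identityʳ _)))
    where
    g : ℕ → ℚ
    g n = ⟦ d ℕ∣.∣? n ⟧ * h n
    off : ∀ q i → 1 ℕ.≤ i → i ℕ.< d → g (q ℕ.* d ℕ.+ i) ≡ 0ℚ
    off q i@(suc _) _ i<d = trans (cong (_* h (q ℕ.* d ℕ.+ i)) (⟦⟧-no (d ℕ∣.∣? (q ℕ.* d ℕ.+ i))
        (λ d∣ → ℕP.<⇒≱ i<d (ℕ∣.∣⇒≤ (ℕ∣.∣m+n∣m⇒∣n d∣ (ℕ∣.n∣m*n q)))))) (*-zeroˡ (h (q ℕ.* d ℕ.+ i)))
    short : ∀ q r → r ℕ.< d → ∑ r (λ i → g (q ℕ.* d ℕ.+ i)) ≡ 0ℚ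
    short q r r<d = ∑-zero r (λ i 1≤i i≤r → off q i 1≤i (ℕP.≤-<-trans i≤r r<d))
    blocks : ∀ q → ∑ (q ℕ.* d) g ≡ ∑ q (λ m → h (d ℕ.* m))
    blocks zero    = refl
    blocks (suc q) = trans (cong (λ z → ∑ z g) (ℕP.+-comm d (q ℕ.* d)))
      (trans (∑-split (q ℕ.* d) d g) (cong₂ _+_ (blocks q)
        (trans (cong (_+ g (q ℕ.* d ℕ.+ d)) (short q d-1 ℕP.≤-refl)) (trans (+-identityˡ _) last))))
      where
      qd≡ : q ℕ.* d ℕ.+ d ≡ d ℕ.* suc q
      qd≡ = trans (ℕP.+-comm (q ℕ.* d) d) (ℕP.*-comm (suc q) d)
      last : g (q ℕ.* d ℕ.+ d) ≡ h (d ℕ.* suc q)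
      last = trans (cong g qd≡) (trans (cong (_* h (d ℕ.* suc q)) (⟦⟧-yes (d ℕ∣.∣? (d ℕ.* suc q))
          (ℕ∣.m∣m*n (suc q)))) (*-identityˡ _))

-- The non-principal character modulo 4 and the partial sums of L(1, χ).

module Character where
  open import Data.Nat.Base as ℕ using (ℕ; zero; suc; z≤n; s≤s)
  import Data.Nat.Properties as ℕP
  open import Data.Nat.Tactic.RingSolver using (solve-∀)
  open import Data.Product.Base using (_×_; _,_; proj₁; proj₂)
  open import Data.Sum.Base using (_⊎_; inj₁; inj₂)
  open import Data.Rational.Base hiding (_÷_)
  open import Data.Rational.Properties
  open import Data.Rational.Solver using (module +-*-Solver)
  open import Relation.Binary.PropositionalEquality
  open RationalLemmas
  open +-*-Solver using (solve; _:+_; _:*_; _:-_; :-_; _:=_; con)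
  open Sums

  0<ι : ∀ {n} → 1 ℕ.≤ n → 0ℚ < ι n
  0<ι {n} 1≤n = <-≤-trans 0<1 (ι-mono {1} {n} 1≤n)

  0≤inv-ι : ∀ n → 1 ℕ.≤ n → 0ℚ ≤ inv (ι n)
  0≤inv-ι n 1≤n = <⇒≤ (inv>0 (0<ι 1≤n))

  χ : ℕ → ℚ
  χ 0 = 0ℚ
  χ 1 = 1ℚ
  χ 2 = 0ℚ
  χ 3 = - 1ℚ
  χ (suc (suc (suc (suc n)))) = χ n

  χ-2* : ∀ b → χ (2 ℕ.* b) ≡ 0ℚ
  χ-2* 0 = refl
  χ-2* 1 = refl
  χ-2* (suc (suc b)) = trans (cong χ (e b)) (χ-2* b)
    where
    e : ∀ b → 2 ℕ.* suc (suc b) ≡ 4 ℕ.+ 2 ℕ.* b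
    e = solve-∀

  χ-period : ∀ k n → χ (k ℕ.* 4 ℕ.+ n) ≡ χ n
  χ-period zero    n = refl
  χ-period (suc k) n = χ-period k n

  χ-3* : ∀ b → χ (3 ℕ.* b) ≡ - 1ℚ * χ b
  χ-3* 0 = refl
  χ-3* 1 = refl
  χ-3* 2 = refl
  χ-3* 3 = refl
  χ-3* (suc (suc (suc (suc b)))) = trans (cong χ (e b)) (trans (χ-period 3 (3 ℕ.* b)) (χ-3* b))
    where
    e : ∀ b → 3 ℕ.* (4 ℕ.+ b) ≡ 12 ℕ.+ 3 ℕ.* b
    e = solve-∀

  χ-* : ∀ a b → χ (a ℕ.* b) ≡ χ a * χ b
  χ-* 0 b = sym (*-zeroˡ (χ b))
  χ-* 1 b = trans (cong χ (ℕP.*-identityˡ b)) (sym (*-identityˡ (χ b)))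
  χ-* 2 b = trans (χ-2* b) (sym (*-zeroˡ (χ b)))
  χ-* 3 b = χ-3* b
  χ-* (suc (suc (suc (suc a)))) b = trans (cong χ (e a b)) (trans (χ-period b (a ℕ.* b)) (χ-* a b))
    where
    e : ∀ a b → (4 ℕ.+ a) ℕ.* b ≡ b ℕ.* 4 ℕ.+ a ℕ.* b
    e = solve-∀

  -1≤0 : - 1ℚ ≤ 0ℚ
  -1≤0 = <⇒≤ (negative⁻¹ (- 1ℚ))

  -1≤χ≤1 : ∀ n → - 1ℚ ≤ χ n × χ n ≤ 1ℚ
  -1≤χ≤1 0 = -1≤0 , 0≤1
  -1≤χ≤1 1 = ≤-trans -1≤0 0≤1 , ≤-refl
  -1≤χ≤1 2 = -1≤0 , 0≤1
  -1≤χ≤1 3 = ≤-refl , ≤-trans -1≤0 0≤1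
  -1≤χ≤1 (suc (suc (suc (suc n)))) = -1≤χ≤1 n

  -- The partial sums of χ. That they stay in [0, 1] is what drives the partial summation in
  -- `∑χ-bounds`.
  σ : ℕ → ℚ
  σ 0 = 0ℚ
  σ 1 = 1ℚ
  σ 2 = 1ℚ
  σ 3 = 0ℚ
  σ (suc (suc (suc (suc n)))) = σ n

  χ≡Δσ : ∀ n → χ (suc n) ≡ σ (suc n) - σ n
  χ≡Δσ 0 = refl
  χ≡Δσ 1 = refl
  χ≡Δσ 2 = refl
  χ≡Δσ 3 = refl
  χ≡Δσ (suc (suc (suc (suc n)))) = χ≡Δσ n

  0≤σ≤1 : ∀ n → 0ℚ ≤ σ n × 0ℚ ≤ 1ℚ - σ n
  0≤σ≤1 0 = ≤-refl , 0≤1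
  0≤σ≤1 1 = 0≤1 , ≤-refl
  0≤σ≤1 2 = 0≤1 , ≤-refl
  0≤σ≤1 3 = ≤-refl , 0≤1
  0≤σ≤1 (suc (suc (suc (suc n)))) = 0≤σ≤1 n

  -- An alternating sum has the sign of its first non-zero term, which σ y records.
  ∑χ-bounds : ∀ y k (g : ℕ → ℚ) →
    (∀ n → 1 ℕ.≤ n → 0ℚ ≤ g n) →
    (∀ n → 1 ℕ.≤ n → n ℕ.≤ y ℕ.+ k → g (suc n) ≤ g n) →
    (- (σ y * g (suc y)) ≤ ∑ k (λ i → χ (y ℕ.+ i) * g (y ℕ.+ i))) ×
    (∑ k (λ i → χ (y ℕ.+ i) * g (y ℕ.+ i)) ≤ (1ℚ - σ y) * g (suc y))
  ∑χ-bounds y zero g 0≤g _ =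
      ≤-by (*-nonNeg (proj₁ (0≤σ≤1 y)) (0≤g (suc y) (s≤s z≤n))) (solve 1 (λ a → a := con 0ℚ :- (:- a))
          refl (σ y * g (suc y)))
    , *-nonNeg (proj₂ (0≤σ≤1 y)) (0≤g (suc y) (s≤s z≤n))
  ∑χ-bounds y (suc k) g 0≤g anti with ∑χ-bounds (suc y) k g 0≤g (λ n 1≤n n≤ → anti n 1≤n
      (subst (n ℕ.≤_) (sym (ℕP.+-suc y k)) n≤))
  ... | lo , hi = subst (λ z → (- (σ y * g (suc y)) ≤ z) × (z ≤ (1ℚ - σ y) * g (suc y))) (sym front)
      -- Peeling off the first term moves the bound from g (y + 2) to g (y + 1). The slack gained is
      -- g (y + 1) - g (y + 2), with weight σ (y + 1) below and 1 - σ (y + 1) above.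
      ( ≤-by (+-nonNeg (*-nonNeg (proj₁ (0≤σ≤1 (suc y))) dg) (diff-≤ lo))
          (solve 5 (λ s t g h A → t :* (g :- h) :+ (A :- (:- (t :* h))) := ((t :- s) :* g :+ A)
              :- (:- (s :* g))) refl (σ y) (σ (suc y)) (g (suc y)) (g (suc (suc y))) A)
      , ≤-by (+-nonNeg (*-nonNeg (proj₂ (0≤σ≤1 (suc y))) dg) (diff-≤ hi))
          (solve 5 (λ s t g h A → (con 1ℚ :- t) :* (g :- h) :+ ((con 1ℚ :- t) :* h :- A) :=
              (con 1ℚ :- s) :* g :- ((t :- s) :* g :+ A)) refl (σ y) (σ (suc y)) (g (suc y))
              (g (suc (suc y))) A) )
    where
    A = ∑ k (λ i → χ (suc y ℕ.+ i) * g (suc y ℕ.+ i))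
    dg : 0ℚ ≤ g (suc y) - g (suc (suc y))
    dg = diff-≤ (anti (suc y) (s≤s z≤n) (subst (suc y ℕ.≤_) (sym (ℕP.+-suc y k)) (s≤s (ℕP.m≤m+n y k))))
    t = λ i → χ (y ℕ.+ i) * g (y ℕ.+ i)
    y+1 : y ℕ.+ 1 ≡ suc y
    y+1 = ℕP.+-comm y 1
    front : ∑ (suc k) t ≡ (σ (suc y) - σ y) * g (suc y) + A
    front = trans (∑-split 1 k t) (cong₂ _+_
      (trans (+-identityˡ (t 1)) (trans (cong₂ _*_ (cong χ y+1) (cong g y+1)) (cong (_* g (suc y))
          (χ≡Δσ y))))
      (∑-cong k (λ i _ _ → cong₂ _*_ (cong χ (ℕP.+-suc y i)) (cong g (ℕP.+-suc y i)))))

  inv-ι-anti : ∀ m n → 1 ℕ.≤ m → m ℕ.≤ n → inv (ι n) ≤ inv (ι m)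
  inv-ι-anti m n 1≤m m≤n = inv-anti (0<ι 1≤m) (ι-mono m≤n)

  L : ℕ → ℚ
  L x = ∑ x (λ n → χ n * inv (ι n))

  L-tail : ∀ y k →
    (- (σ y * inv (ι (suc y))) ≤ L (y ℕ.+ k) - L y) ×
    (L (y ℕ.+ k) - L y ≤ (1ℚ - σ y) * inv (ι (suc y)))
  L-tail y k = subst (λ z → (- (σ y * inv (ι (suc y))) ≤ z) × (z ≤ (1ℚ - σ y) * inv (ι (suc y)))) e
    (∑χ-bounds y k (λ n → inv (ι n)) 0≤inv-ι (λ n 1≤n _ → inv-ι-anti n (suc n) 1≤n (ℕP.n≤1+n n)))
    where
    t = ∑ k (λ i → χ (y ℕ.+ i) * inv (ι (y ℕ.+ i)))
    e : t ≡ L (y ℕ.+ k) - L y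
    e = trans (solve 2 (λ a t → t := (a :+ t) :- a) refl (L y) t)
        (cong (_- L y) (sym (∑-split y k (λ n → χ n * inv (ι n)))))

  ∣∣-≤ : ∀ p {r} → p ≤ r → - p ≤ r → ∣ p ∣ ≤ r
  ∣∣-≤ p {r} p≤r -p≤r = case (∣p∣≡p∨∣p∣≡-p p)
    where
    case : ∣ p ∣ ≡ p ⊎ ∣ p ∣ ≡ - p → ∣ p ∣ ≤ r
    case (inj₁ e) = subst (_≤ r) (sym e) p≤r
    case (inj₂ e) = subst (_≤ r) (sym e) -p≤r

  p≤∣p∣ : ∀ p → p ≤ ∣ p ∣
  p≤∣p∣ p = go (∣p∣≡p∨∣p∣≡-p p) (≤-total 0ℚ p)
    where
    go : ∣ p ∣ ≡ p ⊎ ∣ p ∣ ≡ - p → 0ℚ ≤ p ⊎ p ≤ 0ℚ → p ≤ ∣ p ∣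
    go (inj₁ e) _          = ≤-reflexive (sym e)
    go (inj₂ _) (inj₁ 0≤p) = ≤-reflexive (sym (0≤p⇒∣p∣≡p 0≤p))
    go (inj₂ _) (inj₂ p≤0) = ≤-trans p≤0 (0≤∣∣ p)

  ∣ΔL∣≤ : ∀ y k → ∣ L y - L (y ℕ.+ k) ∣ ≤ inv (ι (suc y))
  ∣ΔL∣≤ y k = ∣∣-≤ (L y - L (y ℕ.+ k))
    (≤-by (+-nonNeg (*-nonNeg (proj₂ (0≤σ≤1 y)) (0≤inv-ι (suc y) (s≤s z≤n)))
        (diff-≤ (proj₁ (L-tail y k))))
      (solve 4 (λ s i a b → (con 1ℚ :- s) :* i :+ ((b :- a) :- (:- (s :* i))) := i :- (a :- b))
          refl (σ y) (inv (ι (suc y))) (L y) (L (y ℕ.+ k))))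
    (≤-by (+-nonNeg (*-nonNeg (proj₁ (0≤σ≤1 y)) (0≤inv-ι (suc y) (s≤s z≤n)))
        (diff-≤ (proj₂ (L-tail y k))))
      (solve 4 (λ s i a b → s :* i :+ ((con 1ℚ :- s) :* i :- (b :- a)) := i :- (:- (a :- b)))
          refl (σ y) (inv (ι (suc y))) (L y) (L (y ℕ.+ k))))

  -- This is the non-vanishing of L(1, χ): the first term is 1, and by alternation the terms after
  -- it sum to at least -1/2.
  ½≤L : ∀ x → 1 ℕ.≤ x → ½ ≤ L x
  ½≤L (suc x) _ = ≤-by (diff-≤ (proj₁ (L-tail 1 x))) (solve 1 (λ a → (a :- con 1ℚ) :- (:- con ½) := a
      :- con ½) refl (L (suc x)))

-- A square root of -1 modulo a prime p = 4m + 1.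

module SqrtMinusOne where
  open import Data.Empty using (⊥; ⊥-elim)
  open import Data.Integer.Base as ℤ using (ℤ; +_; ∣_∣; _⊖_)
  open import Data.Integer.Divisibility.Signed using (_∣_; ∣⇒∣ᵤ; ∣m∣n⇒∣m+n; ∣n⇒∣m*n; ∣-refl)
  import Data.Integer.Properties as ℤP
  open import Data.Integer.Tactic.RingSolver using (solve-∀)
  open import Data.List.Base using ([]; _∷_; _++_; length; applyUpTo)
  open import Data.List.Membership.Propositional using (_∈_)
  open import Data.List.Membership.Propositional.Properties using (∈-∃++; ∈-applyUpTo⁺; ∈-applyUpTo⁻)
  open import Data.List.Properties using (length-applyUpTo)
  open import Data.List.Relation.Binary.Permutation.Propositional using (_↭_; ↭-sym; ↭⇒↭ₛ)
  open import Data.List.Relation.Binary.Permutation.Propositional.Properties using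
      (shift; ∈-resp-↭; ↭-length)
  import Data.List.Relation.Binary.Permutation.Setoid.Properties as ↭ₛ
  import Data.List.Relation.Unary.All as All
  open import Data.List.Relation.Unary.AllPairs using (_∷_)
  open import Data.List.Relation.Unary.Any using (here; there)
  open import Data.List.Relation.Unary.Unique.Propositional using (Unique)
  open import Data.List.Relation.Unary.Unique.Propositional.Properties using (applyUpTo⁺₁)
  open import Data.Nat.Base as ℕ using (ℕ; zero; suc; z≤n; s≤s)
  import Data.Nat.Coprimality as Coprime
  import Data.Nat.DivMod as ℕD
  import Data.Nat.Divisibility as ℕ∣
  open import Data.Nat.GCD using (module Bézout)
  open import Data.Nat.Primality using (Prime)
  import Data.Nat.Properties as ℕP
  open import Data.Product.Base using (∃-syntax; _×_; _,_)
  open import Data.Sum.Base using (_⊎_; inj₁; inj₂)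
  open import Relation.Binary.PropositionalEquality
  open import Relation.Nullary using (¬_; yes; no)

  -- If no element were its own partner, the partners would pair off an odd set.
  odd-matching : ∀ {A : Set} {_~_ : A → A → Set} →
    (∀ {x y} → x ~ y → y ~ x) → (∀ {x y z} → x ~ y → x ~ z → y ≡ z) →
    ∀ n xs → length xs ≡ suc (n ℕ.+ n) → Unique xs →
    (∀ {x} → x ∈ xs → ∃[ y ] (y ∈ xs × x ~ y)) → ∃[ x ] (x ∈ xs × x ~ x)
  odd-matching ~-sym ~-fun zero (x ∷ []) _ _ total with total (here refl)
  ... | _ , here refl , x~x = x , here refl , x~x
  odd-matching {A} {_~_} ~-sym ~-fun (suc n) (x ∷ xs) len (x∉ ∷ uniq) total with total (here refl)
  ... | _ , here refl , x~x = x , here refl , x~x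
  ... | y , there y∈ , x~y with ∈-∃++ y∈
  ...   | as , bs , refl with odd-matching ~-sym ~-fun n (as ++ bs) len′ uniq-rest total′
    where
    perm : as ++ y ∷ bs ↭ y ∷ as ++ bs
    perm = shift y as bs
    len′ : length (as ++ bs) ≡ suc (n ℕ.+ n)
    len′ = ℕP.suc-injective (ℕP.suc-injective
      (trans (sym (cong suc (↭-length perm))) (trans len (cong (λ z → suc (suc z)) (ℕP.+-suc n n)))))
    uniq-y : Unique (y ∷ as ++ bs)
    uniq-y = ↭ₛ.Unique-resp-↭ (setoid A) (↭⇒↭ₛ perm) uniq
    tail-unique : ∀ {v vs} → Unique {A = A} (v ∷ vs) → Unique vs
    tail-unique (_ ∷ u) = u
    uniq-rest : Unique (as ++ bs)
    uniq-rest = tail-unique uniq-y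
    head∉ : ∀ {v vs} → Unique {A = A} (v ∷ vs) → ∀ {w} → w ∈ vs → v ≢ w
    head∉ (v∉ ∷ _) = All.lookup v∉
    -- Removing x and its partner y leaves a closed set: if z had partner x it would equal y, and if
    -- z had partner y it would equal x.
    total′ : ∀ {z} → z ∈ as ++ bs → ∃[ w ] (w ∈ as ++ bs × z ~ w)
    total′ {z} z∈ with total (there (∈-resp-↭ (↭-sym perm) (there z∈)))
    ... | _ , here refl , z~x = ⊥-elim (head∉ uniq-y z∈ (~-fun x~y (~-sym z~x)))
    ... | w , there w∈ , z~w with ∈-resp-↭ perm w∈
    ...   | here refl = ⊥-elim (All.lookup x∉ (∈-resp-↭ (↭-sym perm) (there z∈))
        (~-fun (~-sym x~y) (~-sym z~w)))
    ...   | there w∈′ = w , w∈′ , z~w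
  ... | z , z∈ , z~z = z , there (∈-resp-↭ (↭-sym (shift y as bs)) (there z∈)) , z~z

  ∣-lin : ∀ {d x y} c e → d ∣ x → d ∣ y → d ∣ c ℤ.* x ℤ.+ e ℤ.* y
  ∣-lin c e d∣x d∣y = ∣m∣n⇒∣m+n (∣n⇒∣m*n c d∣x) (∣n⇒∣m*n e d∣y)

  ∣-cong : ∀ {d x y} → x ≡ y → d ∣ x → d ∣ y
  ∣-cong refl d∣x = d∣x

  module _ (m : ℕ) (p-prime : Prime (suc (4 ℕ.* m))) where
    private
      p = suc (4 ℕ.* m)
      P = + p

      small : ∀ {a} → 1 ℕ.≤ a → a ℕ.< p → ¬ (p ℕ∣.∣ a)
      small {suc _} _ a<p p∣a = ℕP.<⇒≱ a<p (ℕ∣.∣⇒≤ p∣a)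

      cancel : ∀ {a} z → 1 ℕ.≤ a → a ℕ.< p → P ∣ + a ℤ.* z → p ℕ∣.∣ ∣ z ∣
      cancel {suc a} z 1≤a a<p p∣az = Coprime.coprime-divisor (Coprime.prime⇒coprime p-prime a<p)
        (subst (p ℕ∣.∣_) (ℤP.abs-* (+ suc a) z) (∣⇒∣ᵤ p∣az))

      1<p : 1 ℕ.≤ m → 1 ℕ.< p
      1<p 1≤m = s≤s (ℕP.≤-trans 1≤m (ℕP.m≤m+n m _))

      -- Inversion modulo p up to sign; allowing both signs makes the partner unique within 1, ...,
      -- 2m.
      _~_ : ℕ → ℕ → Set
      a ~ b = (P ∣ + a ℤ.* + b ℤ.- + 1) ⊎ (P ∣ + a ℤ.* + b ℤ.+ + 1)

      ~-sym : ∀ {a b} → a ~ b → b ~ a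
      ~-sym {a} {b} (inj₁ d) = inj₁ (∣-cong (cong (ℤ._- + 1) (ℤP.*-comm (+ a) (+ b))) d)
      ~-sym {a} {b} (inj₂ d) = inj₂ (∣-cong (cong (ℤ._+ + 1) (ℤP.*-comm (+ a) (+ b))) d)

      2m+2m<p : ∀ {b c} → b ℕ.≤ 2 ℕ.* m → c ℕ.≤ 2 ℕ.* m → b ℕ.+ c ℕ.< p
      2m+2m<p b≤ c≤ = s≤s (ℕP.≤-trans (ℕP.+-mono-≤ b≤ c≤) (ℕP.≤-reflexive
        (trans (sym (ℕP.*-distribʳ-+ m 2 2)) refl)))

      -- Adding the two congruences gives p | a (b + c), hence p | b + c, which is impossible for 0
      -- < b + c ≤ 4m. `parallel` is the same argument with b - c.
      opposite : ∀ {a b c} → 1 ℕ.≤ a → a ℕ.< p → 1 ℕ.≤ b → b ℕ.≤ 2 ℕ.* m → c ℕ.≤ 2 ℕ.* m →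
        P ∣ + a ℤ.* + b ℤ.- + 1 → P ∣ + a ℤ.* + c ℤ.+ + 1 → ⊥
      opposite {a} {b} {c} 1≤a a<p 1≤b b≤ c≤ d e = small (ℕP.≤-trans 1≤b (ℕP.m≤m+n b c)) (2m+2m<p b≤ c≤)
        (cancel (+ b ℤ.+ + c) 1≤a a<p (∣-cong (lem (+ a) (+ b) (+ c)) (∣-lin (+ 1) (+ 1) d e)))
        where
        lem : ∀ a b c → + 1 ℤ.* (a ℤ.* b ℤ.- + 1) ℤ.+ + 1 ℤ.* (a ℤ.* c ℤ.+ + 1) ≡ a ℤ.* (b ℤ.+ c)
        lem = solve-∀

      parallel : ∀ {a b c} z → 1 ℕ.≤ a → a ℕ.< p → b ℕ.≤ 2 ℕ.* m → c ℕ.≤ 2 ℕ.* m →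
        P ∣ + a ℤ.* + b ℤ.- z → P ∣ + a ℤ.* + c ℤ.- z → b ≡ c
      parallel {a} {b} {c} z 1≤a a<p b≤ c≤ d e = ℤP.+-injective (ℤP.i-j≡0⇒i≡j (+ b) (+ c)
          (ℤP.∣i∣≡0⇒i≡0 (zeroed ∣ + b ℤ.- + c ∣ bound p∣)))
        where
        lem : ∀ a b c z → + 1 ℤ.* (a ℤ.* b ℤ.- z) ℤ.+ ℤ.- (+ 1) ℤ.* (a ℤ.* c ℤ.- z) ≡ a ℤ.* (b ℤ.- c)
        lem = solve-∀
        p∣ : p ℕ∣.∣ ∣ + b ℤ.- + c ∣
        p∣ = cancel (+ b ℤ.- + c) 1≤a a<p (∣-cong (lem (+ a) (+ b) (+ c) z) (∣-lin (+ 1) (ℤ.- (+ 1)) d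
            e))
        bound : ∣ + b ℤ.- + c ∣ ℕ.< p
        bound = ℕP.≤-<-trans (ℤP.∣i-j∣≤∣i∣+∣j∣ (+ b) (+ c)) (2m+2m<p b≤ c≤)
        zeroed : ∀ k → k ℕ.< p → p ℕ∣.∣ k → k ≡ 0
        zeroed zero    _   _  = refl
        zeroed (suc k) k<p p∣k = ⊥-elim (small (s≤s z≤n) k<p p∣k)

      -- Bézout gives an inverse whose sign depends on the form of the identity. It is reduced
      -- modulo p, and a residue r > 2m is replaced by p - r, which flips the sign.
      partner : ∀ {a} → 1 ℕ.≤ a → a ℕ.< p → ∃[ b ] (1 ℕ.≤ b × b ℕ.≤ 2 ℕ.* m × a ~ b)
      partner {suc a′} 1≤a a<p = fold-range (reduce raw)
        where
        a = suc a′
        raw : ∃[ y ] (a ~ y)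
        raw with Coprime.coprime-Bézout (Coprime.prime⇒coprime p-prime a<p)
        ... | Bézout.+- x y eq = y , inj₂ (∣-cong e (∣n⇒∣m*n (+ x) ∣-refl))
          where
          e : + x ℤ.* P ≡ + a ℤ.* + y ℤ.+ + 1
          e = trans (sym (ℤP.pos-* x p)) (trans
              (cong +_ (trans (sym eq) (trans (ℕP.+-comm 1 _) (cong (ℕ._+ 1) (ℕP.*-comm y a)))))
                (cong (ℤ._+ + 1) (ℤP.pos-* a y)))
        ... | Bézout.-+ x y eq = y , inj₁ (∣-cong e (∣n⇒∣m*n (+ x) ∣-refl))
          where
          lem : ∀ z → z ≡ (+ 1 ℤ.+ z) ℤ.- + 1
          lem = solve-∀
          e : + x ℤ.* P ≡ + a ℤ.* + y ℤ.- + 1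
          e = trans (lem (+ x ℤ.* P)) (cong (ℤ._- + 1)
              (trans (cong (λ z → + 1 ℤ.+ z) (sym (ℤP.pos-* x p)))
                (trans (cong +_ (trans eq (ℕP.*-comm y a))) (ℤP.pos-* a y))))
        reduce : ∃[ y ] (a ~ y) → ∃[ r ] (r ℕ.< p × a ~ r)
        reduce (y , a~y) = r , ℕD.m%n<n y p , go a~y
          where
          r = y ℕ.% p
          q = y ℕ./ p
          y≡ : + y ≡ + r ℤ.+ + q ℤ.* P
          y≡ = trans (cong +_ (ℕD.m≡m%n+[m/n]*n y p)) (cong (λ z → + r ℤ.+ z) (ℤP.pos-* q p))
          lem : ∀ a y r q P z → y ≡ r ℤ.+ q ℤ.* P → + 1 ℤ.* (a ℤ.* y ℤ.+ z) ℤ.+ ℤ.- (a ℤ.* q) ℤ.* P ≡ a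
              ℤ.* r ℤ.+ z
          lem a .(r ℤ.+ q ℤ.* P) r q P z refl = ring a r q P z
            where
            ring : ∀ a r q P z → + 1 ℤ.* (a ℤ.* (r ℤ.+ q ℤ.* P) ℤ.+ z) ℤ.+ ℤ.- (a ℤ.* q) ℤ.* P ≡ a ℤ.*
                r ℤ.+ z
            ring = solve-∀
          go : a ~ y → a ~ r
          go (inj₁ d) = inj₁ (∣-cong (lem (+ a) (+ y) (+ r) (+ q) P (ℤ.- (+ 1)) y≡)
              (∣-lin (+ 1) (ℤ.- (+ a ℤ.* + q)) d ∣-refl))
          go (inj₂ d) = inj₂ (∣-cong (lem (+ a) (+ y) (+ r) (+ q) P (+ 1) y≡)
              (∣-lin (+ 1) (ℤ.- (+ a ℤ.* + q)) d ∣-refl))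
        1≤m : 1 ℕ.≤ m
        1≤m = pos m a<p
          where
          pos : ∀ m → a ℕ.< suc (4 ℕ.* m) → 1 ℕ.≤ m
          pos zero    (s≤s ())
          pos (suc _) _ = s≤s z≤n
        positive : ∀ r → a ~ r → 1 ℕ.≤ r
        positive zero (inj₁ d) = ⊥-elim (small (s≤s z≤n) (1<p 1≤m)
            (∣⇒∣ᵤ (∣-cong (cong (ℤ._- + 1) (ℤP.*-zeroʳ (+ a))) d)))
        positive zero (inj₂ d) = ⊥-elim (small (s≤s z≤n) (1<p 1≤m)
            (∣⇒∣ᵤ (∣-cong (cong (ℤ._+ + 1) (ℤP.*-zeroʳ (+ a))) d)))
        positive (suc _) _ = s≤s z≤n
        fold-range : ∃[ r ] (r ℕ.< p × a ~ r) → ∃[ b ] (1 ℕ.≤ b × b ℕ.≤ 2 ℕ.* m × a ~ b)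
        fold-range (r , r<p , a~r) with r ℕP.≤? 2 ℕ.* m
        ... | yes r≤ = r , positive r a~r , r≤ , a~r
        ... | no r≰ = p ℕ.∸ r , ℕP.m<n⇒0<n∸m r<p , p∸r≤ , flip a~r
          where
          p∸r≤ : p ℕ.∸ r ℕ.≤ 2 ℕ.* m
          p∸r≤ = ℕP.≤-trans (ℕP.∸-monoʳ-≤ p (ℕP.≰⇒> r≰)) (ℕP.≤-reflexive
            (trans (cong (ℕ._∸ 2 ℕ.* m) (ℕP.*-distribʳ-+ m 2 2)) (ℕP.m+n∸n≡m (2 ℕ.* m) (2 ℕ.* m))))
          neg : + (p ℕ.∸ r) ≡ P ℤ.- + r
          neg = trans (sym (ℤP.⊖-≥ (ℕP.<⇒≤ r<p))) (sym (ℤP.m-n≡m⊖n p r))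
          lem : ∀ a b r P z → b ≡ P ℤ.- r → a ℤ.* P ℤ.+ ℤ.- (+ 1) ℤ.* (a ℤ.* r ℤ.+ z) ≡ a ℤ.* b ℤ.+ ℤ.-
              z
          lem a .(P ℤ.- r) r P z refl = ring a r P z
            where
            ring : ∀ a r P z → a ℤ.* P ℤ.+ ℤ.- (+ 1) ℤ.* (a ℤ.* r ℤ.+ z) ≡ a ℤ.* (P ℤ.- r) ℤ.+ ℤ.- z
            ring = solve-∀
          flip : a ~ r → a ~ (p ℕ.∸ r)
          flip (inj₁ d) = inj₂ (∣-cong (lem (+ a) (+ (p ℕ.∸ r)) (+ r) P (ℤ.- (+ 1)) neg)
              (∣-lin (+ a) (ℤ.- (+ 1)) ∣-refl d))
          flip (inj₂ d) = inj₁ (∣-cong (lem (+ a) (+ (p ℕ.∸ r)) (+ r) P (+ 1) neg)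
              (∣-lin (+ a) (ℤ.- (+ 1)) ∣-refl d))

    -- Inversion up to sign is an involution of the 2m - 1 classes 2, …, 2m.  A fixed
    -- point i satisfies i² ≡ ± 1, and i² ≡ 1 would force i ≡ ± 1.
    sqrt-1 : 1 ℕ.≤ m → ∃[ i ] (1 ℕ.≤ i × i ℕ.≤ 2 ℕ.* m × p ℕ∣.∣ i ℕ.* i ℕ.+ 1)
    sqrt-1 1≤m = finish (matched m 1≤m refl)
      where
      Small : ℕ → Set
      Small a = 2 ℕ.≤ a × a ℕ.≤ 2 ℕ.* m
      2m<p : 2 ℕ.* m ℕ.< p
      2m<p = s≤s (ℕP.*-monoˡ-≤ m {2} {4} (s≤s (s≤s z≤n)))
      self : ∀ {a} → Small a → ¬ (P ∣ + a ℤ.* + a ℤ.- + 1)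
      self {suc a} (s≤s 1≤a , a≤) d = small {suc a ℕ.+ 1} (s≤s z≤n)
          (2m+2m<p a≤ (ℕP.≤-trans 1≤m (ℕP.m≤m+n m _)))
          (cancel {a} (+ (suc a ℕ.+ 1)) 1≤a (ℕP.<-≤-trans (ℕP.n<1+n a) (ℕP.≤-trans a≤ (ℕP.<⇒≤ 2m<p)))
            (∣-cong (trans (lem (+ a)) (cong (λ z → + a ℤ.* z) (cong (λ z → + suc z) (ℕP.+-comm 1 a))))
                d′))
        where
        d′ : P ∣ (+ 1 ℤ.+ + a) ℤ.* (+ 1 ℤ.+ + a) ℤ.- + 1
        d′ = d
        lem : ∀ a → (+ 1 ℤ.+ a) ℤ.* (+ 1 ℤ.+ a) ℤ.- + 1 ≡ a ℤ.* (+ 2 ℤ.+ a)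
        lem = solve-∀
      finish : ∃[ i ] (Small i × i ~ i) → ∃[ i ] (1 ℕ.≤ i × i ℕ.≤ 2 ℕ.* m × p ℕ∣.∣ i ℕ.* i ℕ.+ 1)
      finish (i , i-small , inj₁ d) = ⊥-elim (self i-small d)
      finish (i , (2≤i , i≤) , inj₂ d) = i , ℕP.<⇒≤ 2≤i , i≤ , ∣⇒∣ᵤ
          (∣-cong (cong (ℤ._+ + 1) (sym (ℤP.pos-* i i))) d)
      matched : ∀ m′ → 1 ℕ.≤ m′ → m′ ≡ m → ∃[ i ] (Small i × i ~ i)
      matched (suc n) _ refl = convert (odd-matching {_~_ = λ a b → (Small a × Small b) × a ~ b}
          (λ { {x} {y} ((s , t) , r) → (t , s) , ~-sym {x} {y} r })
          (λ { ((s , t) , r) ((_ , t′) , r′) → unique s t t′ r r′ })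
          n xs (trans (length-applyUpTo (2 ℕ.+_) (suc (n ℕ.+ n))) refl)
          (applyUpTo⁺₁ (2 ℕ.+_) (suc (n ℕ.+ n)) (λ i<j _ e → ℕP.<⇒≢ i<j (ℕP.+-cancelˡ-≡ 2 _ _ e)))
          total)
        where
        xs = applyUpTo (2 ℕ.+_) (suc (n ℕ.+ n))
        2m≡ : 2 ℕ.* suc n ≡ 2 ℕ.+ (n ℕ.+ n)
        2m≡ = trans (cong (λ z → suc n ℕ.+ z) (ℕP.+-identityʳ (suc n))) (cong suc (ℕP.+-suc n n))
        to-small : ∀ {a} → a ∈ xs → Small a
        to-small a∈ with ∈-applyUpTo⁻ (2 ℕ.+_) a∈
        ... | i , i< , refl = s≤s (s≤s z≤n) , subst (2 ℕ.+ i ℕ.≤_) (sym 2m≡)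
            (ℕP.+-monoʳ-≤ 2 (ℕP.≤-pred i<))
        from-small : ∀ {a} → Small a → a ∈ xs
        from-small {suc (suc a)} (s≤s (s≤s z≤n) , a≤) = ∈-applyUpTo⁺ (2 ℕ.+_)
          (s≤s (ℕP.+-cancelˡ-≤ 2 a (n ℕ.+ n) (subst (2 ℕ.+ a ℕ.≤_) 2m≡ a≤)))
        unique : ∀ {a b c} → Small a → Small b → Small c → a ~ b → a ~ c → b ≡ c
        unique (2≤a , a≤) (2≤b , b≤) (2≤c , c≤) (inj₁ d) (inj₁ e) = parallel (+ 1) (ℕP.<⇒≤ 2≤a)
            (ℕP.≤-<-trans a≤ 2m<p) b≤ c≤ d e
        unique (2≤a , a≤) (2≤b , b≤) (2≤c , c≤) (inj₂ d) (inj₂ e) = parallel (ℤ.- (+ 1)) (ℕP.<⇒≤ 2≤a)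
            (ℕP.≤-<-trans a≤ 2m<p) b≤ c≤ d e
        unique (2≤a , a≤) (2≤b , b≤) (2≤c , c≤) (inj₁ d) (inj₂ e) = ⊥-elim (opposite (ℕP.<⇒≤ 2≤a)
            (ℕP.≤-<-trans a≤ 2m<p) (ℕP.<⇒≤ 2≤b) b≤ c≤ d e)
        unique (2≤a , a≤) (2≤b , b≤) (2≤c , c≤) (inj₂ d) (inj₁ e) = ⊥-elim (opposite (ℕP.<⇒≤ 2≤a)
            (ℕP.≤-<-trans a≤ 2m<p) (ℕP.<⇒≤ 2≤c) c≤ b≤ e d)
        -- Keeps partners within 2, ..., 2m: a partner 1 would mean p | a - 1 or p | a + 1.
        not-1 : ∀ {a} → Small a → ¬ (a ~ 1)
        not-1 {suc a} (s≤s 1≤a , a≤) (inj₁ d) = small 1≤a (ℕP.<-≤-trans (ℕP.n<1+n a)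
            (ℕP.≤-trans a≤ (ℕP.<⇒≤ 2m<p)))
          (∣⇒∣ᵤ (∣-cong (lem (+ a)) d))
          where
          lem : ∀ a → (+ 1 ℤ.+ a) ℤ.* + 1 ℤ.- + 1 ≡ a
          lem = solve-∀
        not-1 {a} (2≤a , a≤) (inj₂ d) = small (ℕP.≤-trans (ℕP.<⇒≤ 2≤a) (ℕP.m≤m+n a 1))
            (2m+2m<p a≤ (s≤s z≤n))
          (∣⇒∣ᵤ (∣-cong (cong (ℤ._+ + 1) (ℤP.*-identityʳ (+ a))) d))
        total : ∀ {a} → a ∈ xs → ∃[ b ] (b ∈ xs × ((Small a × Small b) × a ~ b))
        total {a} a∈ with to-small a∈
        ... | a-small@(2≤a , a≤) with partner (ℕP.<⇒≤ 2≤a) (ℕP.≤-<-trans a≤ 2m<p)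
        ...   | suc zero , _ , _ , r = ⊥-elim (not-1 a-small r)
        ...   | suc (suc b) , _ , b≤ , r = suc (suc b) , from-small (s≤s (s≤s z≤n) , b≤) ,
            ((a-small , (s≤s (s≤s z≤n) , b≤)) , r)
        convert : ∃[ i ] (i ∈ xs × ((Small i × Small i) × i ~ i)) → ∃[ i ] (Small i × i ~ i)
        convert (i , _ , ((s , _) , r)) = i , s , r

-- Counting the n ≤ X with p | n² + 1.

module RootCount where
  open import Data.Nat.Base as ℕ using (ℕ; zero; suc; z≤n; s≤s)
  import Data.Nat.DivMod as ℕD
  import Data.Nat.Divisibility as ℕ∣
  open import Data.Nat.Primality using (Prime; prime⇒nonZero; prime⇒irreducible; ¬prime[1])
  import Data.Nat.Properties as ℕP
  open import Data.Nat.Tactic.RingSolver using (solve-∀)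
  open import Data.Product.Base using (_,_)
  open import Data.Rational.Base hiding (_÷_)
  open import Data.Rational.Properties
  open import Data.Rational.Solver using (module +-*-Solver)
  open import Data.Sum.Base using (inj₂)
  open import Relation.Binary.PropositionalEquality
  open import Relation.Nullary using (¬_; Dec; yes; no; contradiction)
  open RationalLemmas
  open +-*-Solver using (solve; _:+_; _:*_; _:-_; :-_; _:=_; con)
  open Sums
  open Character
  open SqrtMinusOne

  ÷-superadditive : ∀ m n d → m ÷ d ℕ.+ n ÷ d ℕ.≤ (m ℕ.+ n) ÷ d
  ÷-superadditive m n zero      = z≤n
  ÷-superadditive m n d@(suc _) = ℕP.≤-trans (ℕP.≤-reflexive (sym (ℕD.m*n/n≡m (m ℕ./ d ℕ.+ n ℕ./ d) d)))
    (ℕD./-monoˡ-≤ d (ℕP.≤-trans (ℕP.≤-reflexive (ℕP.*-distribʳ-+ d (m ℕ./ d) (n ℕ./ d)))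
      (ℕP.+-mono-≤ (ℕD.m/n*n≤m m d) (ℕD.m/n*n≤m n d))))

  ∑-divisible : ∀ d x → 1 ℕ.≤ d → ∑ x (λ n → ⟦ d ℕ∣.∣? n ⟧) ≡ ι (x ÷ d)
  ∑-divisible d x 1≤d = trans (∑-cong x (λ n _ _ → sym (*-identityʳ ⟦ d ℕ∣.∣? n ⟧)))
    (trans (∑-multiples d x (λ _ → 1ℚ) 1≤d) (trans (∑-const (x ÷ d) 1ℚ) (*-identityʳ (ι (x ÷ d)))))

  -- The count equals ⌊(a + x)/d⌋ - ⌊a/d⌋, and the floor is superadditive.
  ÷≤∑-class : ∀ a d x → 1 ℕ.≤ d → ι (x ÷ d) ≤ ∑ x (λ n → ⟦ d ℕ∣.∣? (a ℕ.+ n) ⟧)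
  ÷≤∑-class a d x 1≤d = ≤-by (diff-≤ (ι-mono (÷-superadditive a x d)))
    (trans (cong₂ _-_ (sym (trans (sym (∑-split a x (λ n → ⟦ d ℕ∣.∣? n ⟧))) (∑-divisible d (a ℕ.+ x)
        1≤d)))
                      (ι-+ (a ÷ d) (x ÷ d)))
      (trans (cong (λ z → z + S - (ι (a ÷ d) + ι (x ÷ d))) (∑-divisible d a 1≤d))
        (solve 3 (λ u v S → (u :+ S) :- (u :+ v) := S :- v) refl (ι (a ÷ d)) (ι (x ÷ d)) S)))
    where
    S = ∑ x (λ n → ⟦ d ℕ∣.∣? (a ℕ.+ n) ⟧)

  -- From n (i + n) + (i² + 1) = i (i + n) + (n² + 1). Describing the class as n ≡ -i avoids
  -- subtraction in ℕ.
  root-class : ∀ {p i} n → p ℕ∣.∣ i ℕ.* i ℕ.+ 1 → p ℕ∣.∣ i ℕ.+ n → p ℕ∣.∣ F n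
  root-class {p} {i} n p∣i²+1 p∣i+n = ℕ∣.∣m+n∣m⇒∣n
    (subst (p ℕ∣.∣_) (trans (e i n) (cong (λ z → i ℕ.* (i ℕ.+ n) ℕ.+ (z ℕ.+ 1))
        (sym (cong (n ℕ.*_) (ℕP.*-identityʳ n)))))
      (ℕ∣.∣m∣n⇒∣m+n (ℕ∣.∣n⇒∣m*n n p∣i+n) p∣i²+1))
    (ℕ∣.∣n⇒∣m*n i p∣i+n)
    where
    e : ∀ i n → n ℕ.* (i ℕ.+ n) ℕ.+ (i ℕ.* i ℕ.+ 1) ≡ i ℕ.* (i ℕ.+ n) ℕ.+ (n ℕ.* n ℕ.+ 1)
    e = solve-∀

  module _ (X p : ℕ) (p-prime : Prime p) where
    private
      1≤p : 1 ℕ.≤ p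
      1≤p = ℕ.>-nonZero⁻¹ p {{prime⇒nonZero p-prime}}
      count = ∑ X (λ n → ⟦ p ℕ∣.∣? F n ⟧)
      0≤count : 0ℚ ≤ count
      0≤count = ∑-nonNeg X (λ n _ _ → ⟦⟧-nonNeg (p ℕ∣.∣? F n))

      bound : ∀ {c} → χ p ≡ c → (1ℚ + c) * ι (X ÷ p) ≤ count → (1ℚ + χ p) * ι (X ÷ p) ≤ count
      bound refl b = b

      even : 2 ℕ∣.∣ p → p ≡ 2
      even 2∣p with prime⇒irreducible p-prime 2∣p
      ... | inj₂ e = sym e

      at-2 : p ≡ 2 → (1ℚ + χ p) * ι (X ÷ p) ≤ count
      at-2 e = bound (cong χ e) (subst (_≤ count) (sym (*-identityˡ (ι (X ÷ p))))
        (≤-trans (÷≤∑-class 1 p X 1≤p) (∑-mono X (λ n _ _ → ⟦⟧-mono (p ℕ∣.∣? (1 ℕ.+ n)) (p ℕ∣.∣? F n)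
          (root-class {i = 1} n (subst (ℕ∣._∣ 2) (sym e) ℕ∣.∣-refl))))))

      -- The roots i and p - i give two classes, each met at least ⌊X/p⌋ times; being disjoint, they
      -- may be counted separately.
      at-1 : ∀ m → 1 ℕ.≤ m → p ≡ suc (4 ℕ.* m) → (1ℚ + 1ℚ) * ι (X ÷ p) ≤ count
      at-1 m 1≤m refl = go (sqrt-1 m p-prime 1≤m)
        where
        go : _ → (1ℚ + 1ℚ) * ι (X ÷ p) ≤ count
        go (i , 1≤i , i≤2m , p∣) = subst (_≤ count) (solve 1 (λ a → a :+ a := (con 1ℚ :+ con 1ℚ) :* a)
            refl (ι (X ÷ p)))
          (≤-trans (+-mono-≤ (÷≤∑-class i p X 1≤p) (÷≤∑-class j p X 1≤p))
            (≤-trans (≤-reflexive (sym (∑-+ X (λ n → ⟦ p ℕ∣.∣? (i ℕ.+ n) ⟧) (λ n → ⟦ p ℕ∣.∣? (j ℕ.+ n)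
                ⟧))))
              (∑-mono X (λ n _ _ → disjoint n (p ℕ∣.∣? (i ℕ.+ n)) (p ℕ∣.∣? (j ℕ.+ n)) (p ℕ∣.∣? F n)))))
          where
          j = p ℕ.∸ i
          i<p : i ℕ.< p
          i<p = s≤s (ℕP.≤-trans i≤2m (ℕP.*-monoˡ-≤ m {2} {4} (s≤s (s≤s z≤n))))
          i+j : i ℕ.+ j ≡ p
          i+j = ℕP.m+[n∸m]≡n (ℕP.<⇒≤ i<p)
          e : ∀ i j → (i ℕ.+ j) ℕ.* j ℕ.+ (i ℕ.* i ℕ.+ 1) ≡ i ℕ.* (i ℕ.+ j) ℕ.+ (j ℕ.* j ℕ.+ 1)
          e = solve-∀
          p∣j : p ℕ∣.∣ j ℕ.* j ℕ.+ 1
          p∣j = ℕ∣.∣m+n∣m⇒∣n (subst (p ℕ∣.∣_) (e i j)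
            (ℕ∣.∣m∣n⇒∣m+n (ℕ∣.∣m⇒∣m*n j (ℕ∣.∣-reflexive (sym i+j))) p∣))
                (ℕ∣.∣n⇒∣m*n i (ℕ∣.∣-reflexive (sym i+j)))
          -- the two classes could only meet if p ∣ 2i < p
          apart : ∀ {n} → p ℕ∣.∣ i ℕ.+ n → ¬ (p ℕ∣.∣ j ℕ.+ n)
          apart {n} a b = ℕP.<⇒≱ 2i<p (ℕ∣.∣⇒≤ {{ℕ.>-nonZero (ℕP.≤-trans 1≤i (ℕP.m≤m+n i i))}} p∣2i)
            where
            2i<p : i ℕ.+ i ℕ.< p
            2i<p = s≤s (ℕP.≤-trans (ℕP.+-mono-≤ i≤2m i≤2m)
                (ℕP.≤-reflexive (sym (ℕP.*-distribʳ-+ m 2 2))))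
            e′ : ∀ i n → i ℕ.+ n ℕ.+ (i ℕ.+ n) ≡ n ℕ.+ n ℕ.+ (i ℕ.+ i)
            e′ = solve-∀
            e″ : ∀ i j n → i ℕ.+ n ℕ.+ (j ℕ.+ n) ≡ i ℕ.+ j ℕ.+ (n ℕ.+ n)
            e″ = solve-∀
            p∣2n : p ℕ∣.∣ n ℕ.+ n
            p∣2n = ℕ∣.∣m+n∣m⇒∣n (subst (p ℕ∣.∣_) (e″ i j n) (ℕ∣.∣m∣n⇒∣m+n a b))
                (ℕ∣.∣-reflexive (sym i+j))
            p∣2i : p ℕ∣.∣ i ℕ.+ i
            p∣2i = ℕ∣.∣m+n∣m⇒∣n (subst (p ℕ∣.∣_) (e′ i n) (ℕ∣.∣m∣n⇒∣m+n a a)) p∣2n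
          disjoint : ∀ n (a : Dec (p ℕ∣.∣ i ℕ.+ n)) (b : Dec (p ℕ∣.∣ j ℕ.+ n)) (c : Dec (p ℕ∣.∣ F n)) →
                     ⟦ a ⟧ + ⟦ b ⟧ ≤ ⟦ c ⟧
          disjoint n (yes a) (yes b) c = contradiction b (apart a)
          disjoint n (yes a) (no _)  c = ≤-reflexive (sym (⟦⟧-yes c (root-class n p∣ a)))
          disjoint n (no _)  (yes b) c = ≤-reflexive (sym (⟦⟧-yes c (root-class n p∣j b)))
          disjoint n (no _)  (no _)  c = ⟦⟧-nonNeg c

      -- Even residues leave only p = 2, with root 1. Residue 1 has two root classes, and for
      -- residue 3 the weight 1 + χ p vanishes.
      cases : ∀ r k → r ℕ.< 4 → p ≡ r ℕ.+ k ℕ.* 4 → (1ℚ + χ p) * ι (X ÷ p) ≤ count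
      cases 0 k _ e = at-2 (even (subst (2 ℕ∣.∣_) (sym e) (ℕ∣.∣n⇒∣m*n k (ℕ∣.divides 2 refl))))
      cases 1 zero _ e = contradiction (subst Prime e p-prime) ¬prime[1]
      cases 1 k@(suc _) _ e = bound (trans (cong χ (trans e (ℕP.+-comm 1 (k ℕ.* 4)))) (χ-period k 1))
        (at-1 k (s≤s z≤n) (trans e (cong suc (ℕP.*-comm k 4))))
      cases 2 k _ e = at-2 (even (subst (2 ℕ∣.∣_) (sym e)
          (ℕ∣.∣m∣n⇒∣m+n ℕ∣.∣-refl (ℕ∣.∣n⇒∣m*n k (ℕ∣.divides 2 refl)))))
      cases 3 k _ e = bound (trans (cong χ (trans e (ℕP.+-comm 3 (k ℕ.* 4)))) (χ-period k 3))
        (subst (_≤ count) (sym (*-zeroˡ (ι (X ÷ p)))) 0≤count)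
      cases (suc (suc (suc (suc _)))) k (s≤s (s≤s (s≤s (s≤s ())))) e

    roots-count : (1ℚ + χ p) * ι (X ÷ p) ≤ ∑ X (λ n → ⟦ p ℕ∣.∣? F n ⟧)
    roots-count = cases (p ℕ.% 4) (p ℕ./ 4) (ℕD.m%n<n p 4) (ℕD.m≡m%n+[m/n]*n p 4)

-- The von Mangoldt expansion of a log-like function.

module Mangoldt where
  open import Data.List.Base using ([]; _∷_)
  open import Data.List.Relation.Unary.All using (All; []; _∷_)
  open import Data.Nat.Base as ℕ using (ℕ; zero; suc; z≤n; s≤s)
  import Data.Nat.Divisibility as ℕ∣
  open import Data.Nat.ListAction using (product)
  open import Data.Nat.Primality using (Prime; prime?; prime⇒nonZero; prime⇒nonTrivial;
      prime⇒irreducible; euclidsLemma; productOfPrimes≥1; ¬prime[1])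
  open import Data.Nat.Primality.Factorisation using (factorise; module PrimeFactorisation)
  import Data.Nat.Properties as ℕP
  open import Data.Product.Base using (_,_)
  open import Data.Rational.Base hiding (_÷_)
  open import Data.Rational.Properties
  open import Data.Rational.Solver using (module +-*-Solver)
  open import Data.Sum.Base using (inj₁; inj₂)
  open import Relation.Binary.PropositionalEquality
  open import Relation.Nullary using (¬_; Dec; yes; no; contradiction)
  open RationalLemmas
  open +-*-Solver using (solve; _:+_; _:*_; _:-_; :-_; _:=_; con)
  open Sums

  -- For log itself the bound in ℓ-step is 1; the slack absorbs approximation errors.
  record LogLike (B : ℕ) (ℓ : ℕ → ℚ) : Set where
    field
      ℓ-*      : ∀ a b → 1 ℕ.≤ a → 1 ℕ.≤ b → ℓ (a ℕ.* b) ≡ ℓ a + ℓ b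
      ℓ-nonNeg : ∀ n → 0ℚ ≤ ℓ n
      ℓ-suc    : ∀ n → 1 ℕ.≤ n → n ℕ.< B → ℓ n ≤ ℓ (suc n)
      ℓ-step   : ∀ n → 1 ℕ.≤ n → n ℕ.< B → ι n * (ℓ (suc n) - ℓ n) ≤ ι 2

    ℓ-1 : ℓ 1 ≡ 0ℚ
    ℓ-1 = trans (solve 1 (λ a → a := (a :+ a) :- a) refl (ℓ 1))
        (trans (cong (_- ℓ 1) (sym (ℓ-* 1 1 ℕP.≤-refl ℕP.≤-refl))) (+-inverseʳ (ℓ 1)))

    ℓ-mono : ∀ {m n} → 1 ℕ.≤ m → m ℕ.≤ n → n ℕ.≤ B → ℓ m ≤ ℓ n
    ℓ-mono {m} 1≤m m≤n n≤B = go (ℕP.≤⇒≤′ m≤n) n≤B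
      where
      go : ∀ {n} → m ℕ.≤′ n → n ℕ.≤ B → ℓ m ≤ ℓ n
      go ℕ.≤′-refl _ = ≤-refl
      go (ℕ.≤′-step m≤′n) n<B = ≤-trans (go m≤′n (ℕP.<⇒≤ n<B)) (ℓ-suc _ (ℕP.≤-trans 1≤m (ℕP.≤′⇒≤ m≤′n))
          n<B)

  q≤q^ : ∀ q k → 1 ℕ.≤ k → 2 ℕ.≤ q → q ℕ.≤ q ℕ.^ k
  q≤q^ q (suc k) _ 2≤q = ℕP.m≤m*n q (q ℕ.^ k)
      {{ℕ.>-nonZero (ℕP.m^n>0 q {{ℕ.>-nonZero (ℕP.<⇒≤ 2≤q)}} k)}}

  n<q^n : ∀ q n → 2 ℕ.≤ q → n ℕ.< q ℕ.^ n
  n<q^n q zero    _ = s≤s z≤n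
  n<q^n q (suc n) 2≤q = ℕP.≤-trans (s≤s (n<q^n q n 2≤q)) (ℕP.≤-trans
      (ℕP.≤-trans (ℕP.+-monoˡ-≤ (q ℕ.^ n) 1≤) (ℕP.≤-reflexive (cong (λ z → q ℕ.^ n ℕ.+ z)
          (sym (ℕP.+-identityʳ (q ℕ.^ n))))))
      (ℕP.*-monoˡ-≤ (q ℕ.^ n) 2≤q))
    where
    1≤ : 1 ℕ.≤ q ℕ.^ n
    1≤ = ℕP.m^n>0 q {{ℕ.>-nonZero (ℕP.<⇒≤ 2≤q)}} n

  prime≥2 : ∀ {q} → Prime q → 2 ℕ.≤ q
  prime≥2 {q} pr = ℕ.nonTrivial⇒n>1 q {{prime⇒nonTrivial pr}}

  prime-power-∣ : ∀ {p q} k m → Prime p → Prime q → q ≢ p → q ℕ.^ k ℕ∣.∣ p ℕ.* m → q ℕ.^ k ℕ∣.∣ m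
  prime-power-∣ zero    m _ _ _ _ = ℕ∣.1∣ m
  prime-power-∣ {p} {q} (suc k) m pp qp q≢p d with euclidsLemma p m qp (ℕ∣.∣-trans (ℕ∣.m∣m*n (q ℕ.^ k))
      d)
  ... | inj₁ q∣p with prime⇒irreducible pp q∣p
  ...   | inj₁ refl = contradiction qp ¬prime[1]
  ...   | inj₂ e    = contradiction e q≢p
  prime-power-∣ {p} {q} (suc k) m pp qp q≢p d | inj₂ (ℕ∣.divides n refl) =
    subst (ℕ∣._∣ n ℕ.* q) (ℕP.*-comm (q ℕ.^ k) q) (ℕ∣.*-monoˡ-∣ q (prime-power-∣ k n pp qp q≢p
      (ℕ∣.*-cancelˡ-∣ q {{prime⇒nonZero qp}} (subst (q ℕ.* q ℕ.^ k ℕ∣.∣_)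
        (trans (sym (ℕP.*-assoc p n q)) (ℕP.*-comm (p ℕ.* n) q)) d))))

  module Weights {B ℓ} (log-like : LogLike B ℓ) where
    open LogLike log-like

    w : ℕ → ℚ
    w q = ⟦ prime? q ⟧ * ℓ q

    0≤w : ∀ q → 0ℚ ≤ w q
    0≤w q = *-nonNeg (⟦⟧-nonNeg (prime? q)) (ℓ-nonNeg q)

    w≤ℓ : ∀ q → w q ≤ ℓ q
    w≤ℓ q = subst (w q ≤_) (*-identityˡ (ℓ q)) (*-monoʳ-≤-nonNeg (ℓ q) {{nonNegative (ℓ-nonNeg q)}}
        (1≥ (prime? q)))
      where
      1≥ : (d : Dec (Prime q)) → ⟦ d ⟧ ≤ 1ℚ
      1≥ (yes _) = ≤-refl
      1≥ (no _)  = 0≤1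

    w-prime : ∀ {q} → Prime q → w q ≡ ℓ q
    w-prime {q} pr = trans (cong (_* ℓ q) (⟦⟧-yes (prime? q) pr)) (*-identityˡ (ℓ q))

    -- Non-primes have weight 0, so a comparison under `w` may assume that q is prime.
    w-mono : ∀ q {a b} → (Prime q → a ≤ b) → w q * a ≤ w q * b
    w-mono q {a} {b} a≤b = go (prime? q)
      where
      go : Dec (Prime q) → w q * a ≤ w q * b
      go (yes pr) = *-monoˡ-≤-nonNeg (w q) {{nonNegative (0≤w q)}} (a≤b pr)
      go (no ¬pr) = subst (λ z → z * a ≤ z * b) (sym (trans (cong (_* ℓ q) (⟦⟧-no (prime? q) ¬pr))
          (*-zeroˡ (ℓ q))))
        (≤-reflexive (trans (*-zeroˡ a) (sym (*-zeroˡ b))))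

    w-cong : ∀ q {a b} → (Prime q → a ≡ b) → w q * a ≡ w q * b
    w-cong q a≡b = ≤-antisym (w-mono q (λ pr → ≤-reflexive (a≡b pr)))
        (w-mono q (λ pr → ≤-reflexive (sym (a≡b pr))))

    -- Σ Λ(d) H(d), with d = q ^ k running over the prime powers with q, k ≤ Z.
    ∑Λ : ℕ → (ℕ → ℚ) → ℚ
    ∑Λ Z H = ∑ Z (λ q → w q * ∑ Z (λ k → H (q ℕ.^ k)))

    ∑Λ-mono : ∀ Z {H K} → (∀ d → 2 ℕ.≤ d → H d ≤ K d) → ∑Λ Z H ≤ ∑Λ Z K
    ∑Λ-mono Z H≤K = ∑-mono Z (λ q _ _ → w-mono q (λ pr → ∑-mono Z (λ k 1≤k _ →
      H≤K (q ℕ.^ k) (ℕP.≤-trans (prime≥2 pr) (q≤q^ q k 1≤k (prime≥2 pr))))))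

    ∑Λ-cong : ∀ Z {H K} → (∀ d → 2 ℕ.≤ d → H d ≡ K d) → ∑Λ Z H ≡ ∑Λ Z K
    ∑Λ-cong Z H≡K = ≤-antisym (∑Λ-mono Z (λ d 2≤d → ≤-reflexive (H≡K d 2≤d)))
        (∑Λ-mono Z (λ d 2≤d → ≤-reflexive (sym (H≡K d 2≤d))))

    ∑Λ-+ : ∀ Z H K → ∑Λ Z (λ d → H d + K d) ≡ ∑Λ Z H + ∑Λ Z K
    ∑Λ-+ Z H K = trans (∑-cong Z (λ q _ _ → trans (cong (w q *_) (∑-+ Z (λ k → H (q ℕ.^ k))
        (λ k → K (q ℕ.^ k))))
        (*-distribˡ-+ (w q) (∑ Z (λ k → H (q ℕ.^ k))) (∑ Z (λ k → K (q ℕ.^ k))))))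
      (∑-+ Z (λ q → w q * ∑ Z (λ k → H (q ℕ.^ k))) (λ q → w q * ∑ Z (λ k → K (q ℕ.^ k))))

    ∑Λ-* : ∀ Z c H → ∑Λ Z (λ d → c * H d) ≡ c * ∑Λ Z H
    ∑Λ-* Z c H = trans (∑-cong Z (λ q _ _ → trans (cong (w q *_) (∑-* Z c (λ k → H (q ℕ.^ k))))
        (solve 3 (λ w c s → w :* (c :* s) := c :* (w :* s)) refl (w q) c (∑ Z (λ k → H (q ℕ.^ k))))))
      (∑-* Z c (λ q → w q * ∑ Z (λ k → H (q ℕ.^ k))))

    ∑-∑Λ-swap : ∀ x Z (G : ℕ → ℕ → ℚ) → ∑ x (λ n → ∑Λ Z (G n)) ≡ ∑Λ Z (λ d → ∑ x (λ n → G n d))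
    ∑-∑Λ-swap zero    Z G = sym (∑-zero Z (λ q _ _ → trans (cong (w q *_) (∑-zero Z (λ _ _ _ → refl)))
        (*-zeroʳ (w q))))
    ∑-∑Λ-swap (suc x) Z G = trans (cong (_+ ∑Λ Z (G (suc x))) (∑-∑Λ-swap x Z G))
      (sym (∑Λ-+ Z (λ d → ∑ x (λ n → G n d)) (G (suc x))))

    private
      -- Passing from m to p m raises the number of powers of p that divide it by exactly one and
      -- changes nothing at the other primes.
      ∑Λ-∣-prime* : ∀ Z {p} m → Prime p → 1 ℕ.≤ m → p ℕ.* m ℕ.≤ Z →
        ∑Λ Z (λ d → ⟦ d ℕ∣.∣? (p ℕ.* m) ⟧) ≡ ℓ p + ∑Λ Z (λ d → ⟦ d ℕ∣.∣? m ⟧)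
      ∑Λ-∣-prime* Z {p} m pp 1≤m pm≤Z = trans (∑-cong Z (λ q 1≤q q≤Z → local q (q ℕP.≟ p)))
        (trans (∑-+ Z (λ q → ⟦ q ℕP.≟ p ⟧ * ℓ p) (λ q → w q * ∑ Z (λ k → ⟦ q ℕ.^ k ℕ∣.∣? m ⟧)))
          (cong (_+ ∑Λ Z (λ d → ⟦ d ℕ∣.∣? m ⟧)) (trans
            (∑-single Z (λ q → ⟦ q ℕP.≟ p ⟧ * ℓ p) 1≤p p≤Z (λ q _ _ q≢p →
              trans (cong (_* ℓ p) (⟦⟧-no (q ℕP.≟ p) q≢p)) (*-zeroˡ (ℓ p))))
            (trans (cong (_* ℓ p) (⟦⟧-yes (p ℕP.≟ p) refl)) (*-identityˡ (ℓ p))))))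
        where
        2≤p = prime≥2 pp
        1≤p = ℕP.<⇒≤ 2≤p
        p≤pm : p ℕ.≤ p ℕ.* m
        p≤pm = ℕP.m≤m*n p m {{ℕ.>-nonZero 1≤m}}
        p≤Z = ℕP.≤-trans p≤pm pm≤Z
        m≤Z : m ℕ.≤ Z
        m≤Z = ℕP.≤-trans (ℕP.m≤n*m m p {{ℕ.>-nonZero 1≤p}}) pm≤Z
        S : ℕ → ℕ → ℚ
        S q n = ∑ Z (λ k → ⟦ q ℕ.^ k ℕ∣.∣? n ⟧)
        -- p ^ (k + 1) | p m is equivalent to p ^ k | m, so the exponents shift by one. The extra
        -- exponent Z + 1 contributes nothing because p ^ Z > Z ≥ m.
        shift : S p (p ℕ.* m) ≡ 1ℚ + S p m
        shift = trans (trans (sym (+-identityʳ (S p (p ℕ.* m)))) (cong (λ z → S p (p ℕ.* m) + z)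
            (sym (⟦⟧-no (p ℕ.^ suc Z ℕ∣.∣? (p ℕ.* m)) big))))
          (trans (∑-split 1 Z (λ k → ⟦ p ℕ.^ k ℕ∣.∣? (p ℕ.* m) ⟧)) (cong₂ _+_
            (trans (+-identityˡ ⟦ p ℕ.^ 1 ℕ∣.∣? (p ℕ.* m) ⟧) (⟦⟧-yes (p ℕ.^ 1 ℕ∣.∣? (p ℕ.* m))
                (subst (ℕ∣._∣ p ℕ.* m) (sym (ℕP.*-identityʳ p)) (ℕ∣.m∣m*n m))))
            (∑-cong Z (λ k _ _ → ⟦⟧-cong (p ℕ.^ suc k ℕ∣.∣? (p ℕ.* m)) (p ℕ.^ k ℕ∣.∣? m)
              (ℕ∣.*-cancelˡ-∣ p {{ℕ.>-nonZero 1≤p}}) (ℕ∣.*-monoʳ-∣ p)))))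
          where
          big : ¬ (p ℕ.^ suc Z ℕ∣.∣ p ℕ.* m)
          big d = ℕP.<⇒≱ (n<q^n p Z 2≤p) (ℕP.≤-trans (ℕ∣.∣⇒≤ {{ℕ.>-nonZero 1≤m}}
              (ℕ∣.*-cancelˡ-∣ p {{ℕ.>-nonZero 1≤p}} d)) m≤Z)
        local : ∀ q → (d : Dec (q ≡ p)) → w q * S q (p ℕ.* m) ≡ ⟦ q ℕP.≟ p ⟧ * ℓ p + w q * S q m
        local q (yes refl) = trans (cong (w p *_) shift)
            (trans (solve 2 (λ w s → w :* (con 1ℚ :+ s) := w :+ w :* s) refl (w p) (S p m))
          (cong (_+ w p * S p m) (trans (w-prime pp) (trans (sym (*-identityˡ (ℓ p)))
              (cong (_* ℓ p) (sym (⟦⟧-yes (p ℕP.≟ p) refl)))))))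
        local q (no q≢p) = trans (w-cong q (λ qp → ∑-cong Z (λ k _ _ →
            ⟦⟧-cong (q ℕ.^ k ℕ∣.∣? (p ℕ.* m)) (q ℕ.^ k ℕ∣.∣? m) (prime-power-∣ k m pp qp q≢p)
                (ℕ∣.∣n⇒∣m*n p))))
          (trans (sym (+-identityˡ (w q * S q m))) (cong (_+ w q * S q m)
            (sym (trans (cong (_* ℓ p) (⟦⟧-no (q ℕP.≟ p) q≢p)) (*-zeroˡ (ℓ p))))))

      ℓ-product : ∀ Z ps → All Prime ps → product ps ℕ.≤ Z → ℓ (product ps) ≡ ∑Λ Z
          (λ d → ⟦ d ℕ∣.∣? product ps ⟧)
      ℓ-product Z [] [] 1≤Z = trans ℓ-1
          (sym (∑-zero Z (λ q _ _ → trans (w-cong q (λ pr → ∑-zero Z (λ k 1≤k _ →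
        ⟦⟧-no (q ℕ.^ k ℕ∣.∣? 1) (λ d → ℕP.<⇒≱ (ℕP.≤-trans (prime≥2 pr) (q≤q^ q k 1≤k (prime≥2 pr)))
            (ℕP.≤-reflexive (ℕ∣.∣1⇒≡1 d))))))
        (*-zeroʳ (w q)))))
      ℓ-product Z (p ∷ ps) (pp ∷ prs) pm≤Z = trans (ℓ-* p m (ℕP.<⇒≤ (prime≥2 pp)) 1≤m)
        (trans (cong (λ z → ℓ p + z) (ℓ-product Z ps prs
            (ℕP.≤-trans (ℕP.m≤n*m m p {{prime⇒nonZero pp}}) pm≤Z)))
          (sym (∑Λ-∣-prime* Z m pp 1≤m pm≤Z)))
        where
        m = product ps
        1≤m : 1 ℕ.≤ m
        1≤m = productOfPrimes≥1 prs

    -- The classical identity log m = Σ_{d | m} Λ(d). Any Z ≥ m will do, since q ^ k | m bounds both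
    -- q and k by m; one Z can then serve all terms of a sum.
    ℓ≡∑Λ : ∀ Z m → 1 ℕ.≤ m → m ℕ.≤ Z → ℓ m ≡ ∑Λ Z (λ d → ⟦ d ℕ∣.∣? m ⟧)
    ℓ≡∑Λ Z m@(suc _) _ m≤Z = subst (λ z → ℓ z ≡ ∑Λ Z (λ d → ⟦ d ℕ∣.∣? z ⟧)) (sym isFactorisation)
        (ℓ-product Z factors factorsPrime (subst (ℕ._≤ Z) isFactorisation m≤Z))
      where open PrimeFactorisation (factorise m)

    -- Used with h = 1 for the Stirling and Chebyshev estimates, and with h n = χ n / n for the
    -- character sum.
    ∑-ℓ≡∑Λ : ∀ Z x (h : ℕ → ℚ) → x ℕ.≤ Z →
      ∑ x (λ n → h n * ℓ n) ≡ ∑Λ Z (λ d → ∑ (x ÷ d) (λ m → h (d ℕ.* m)))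
    ∑-ℓ≡∑Λ Z x h x≤Z = trans (∑-cong x (λ n 1≤n n≤x → trans
        (cong (h n *_) (ℓ≡∑Λ Z n 1≤n (ℕP.≤-trans n≤x x≤Z)))
        (sym (∑Λ-* Z (h n) (λ d → ⟦ d ℕ∣.∣? n ⟧)))))
      (trans (∑-∑Λ-swap x Z (λ n d → h n * ⟦ d ℕ∣.∣? n ⟧))
        (∑Λ-cong Z (λ d 2≤d → trans (∑-cong x (λ n _ _ → *-comm (h n) ⟦ d ℕ∣.∣? n ⟧))
            (∑-multiples d x h (ℕP.<⇒≤ 2≤d)))))

-- Stirling's formula, Chebyshev's bound and the sum of Λ(d) / d.

module Mertens where
  open import Data.Nat.Base as ℕ using (ℕ; zero; suc; z≤n; s≤s)
  import Data.Nat.DivMod as ℕD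
  import Data.Nat.Properties as ℕP
  open import Data.Product.Base using (_×_; _,_; proj₁; ∃-syntax)
  open import Data.Rational.Base hiding (_÷_)
  open import Data.Rational.Properties
  open import Data.Rational.Solver using (module +-*-Solver)
  open import Relation.Binary.PropositionalEquality
  open import Relation.Nullary using (Dec; yes; no; contradiction)
  open RationalLemmas
  open +-*-Solver using (solve; _:+_; _:*_; _:-_; :-_; _:=_; con)
  open Sums
  open Character
  open RootCount
  open Mangoldt

  ι-* : ∀ m n → ι (m ℕ.* n) ≡ ι m * ι n
  ι-* zero    n = sym (*-zeroˡ (ι n))
  ι-* (suc m) n = trans (ι-+ n (m ℕ.* n)) (trans (cong (λ z → ι n + z) (ι-* m n))
    (trans (solve 2 (λ a b → b :+ a :* b := (con 1ℚ :+ a) :* b) refl (ι m) (ι n))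
        (cong (_* ι n) (sym (ι-suc m)))))

  ι*inv : ∀ n → 1 ℕ.≤ n → ι n * inv (ι n) ≡ 1ℚ
  ι*inv n 1≤n = proj₁ (inv-pos (0<ι 1≤n))

  inv-ι-* : ∀ m n → 1 ℕ.≤ m → 1 ℕ.≤ n → inv (ι (m ℕ.* n)) ≡ inv (ι m) * inv (ι n)
  inv-ι-* m n 1≤m 1≤n = begin
    k                                   ≡⟨ sym (trans (*-identityʳ (k * 1ℚ)) (*-identityʳ k)) ⟩
    k * 1ℚ * 1ℚ                         ≡⟨ sym (cong₂ (λ s t → k * s * t) (ι*inv m 1≤m) (ι*inv n 1≤n)) ⟩
    k * (ι m * i) * (ι n * j)           ≡⟨ (solve 5 (λ k m n i j → k :* (m :* i) :* (n :* j) :=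
        ((m :* n) :* k) :* (i :* j)) refl k (ι m) (ι n) i j) ⟩
    ((ι m * ι n) * k) * (i * j)         ≡⟨ cong (λ z → (z * k) * (i * j)) (sym (ι-* m n)) ⟩
    (ι (m ℕ.* n) * k) * (i * j)         ≡⟨ cong (_* (i * j)) (ι*inv (m ℕ.* n) (ℕP.*-mono-≤ 1≤m 1≤n)) ⟩
    1ℚ * (i * j)                        ≡⟨ *-identityˡ (i * j) ⟩
    i * j                               ∎
    where
    open ≡-Reasoning
    i = inv (ι m)
    j = inv (ι n)
    k = inv (ι (m ℕ.* n))

  *≤⇒≤*inv : ∀ {a b} n → 1 ℕ.≤ n → a * ι n ≤ b → a ≤ b * inv (ι n)
  *≤⇒≤*inv {a} {b} n 1≤n an≤b = ≤-trans (≤-reflexive e) (*-monoʳ-≤-nonNeg (inv (ι n))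
      {{nonNegative (0≤inv-ι n 1≤n)}} an≤b)
    where
    e : a ≡ a * ι n * inv (ι n)
    e = sym (trans (*-assoc a (ι n) (inv (ι n))) (trans (cong (a *_) (ι*inv n 1≤n)) (*-identityʳ a)))

  *-cancel-ι : ∀ {a b} n → 1 ℕ.≤ n → ι n * a ≤ ι n * b → a ≤ b
  *-cancel-ι n 1≤n = *-cancelˡ-≤-pos (ι n) {{positive (0<ι 1≤n)}}

  ÷*≤ : ∀ x d → 1 ℕ.≤ d → x ÷ d ℕ.* d ℕ.≤ x
  ÷*≤ x d@(suc _) _ = ℕD.m/n*n≤m x d

  ≤*suc÷ : ∀ x d → 1 ℕ.≤ d → x ℕ.≤ d ℕ.* suc (x ÷ d)
  ≤*suc÷ x d@(suc _) _ = ℕP.≤-trans (ℕP.≤-reflexive (ℕD.m≡m%n+[m/n]*n x d))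
    (ℕP.≤-trans (ℕP.+-monoˡ-≤ (x ℕ./ d ℕ.* d) (ℕP.<⇒≤ (ℕD.m%n<n x d)))
        (ℕP.≤-reflexive (ℕP.*-comm (suc (x ℕ./ d)) d)))

  <⇒÷≡0 : ∀ x d → x ℕ.< d → x ÷ d ≡ 0
  <⇒÷≡0 x d@(suc _) x<d = ℕD.m<n⇒m/n≡0 x<d

  ι÷≤ : ∀ x d → 1 ℕ.≤ d → ι (x ÷ d) ≤ ι x * inv (ι d)
  ι÷≤ x d 1≤d = *≤⇒≤*inv d 1≤d (≤-trans (≤-reflexive (sym (ι-* (x ÷ d) d))) (ι-mono (÷*≤ x d 1≤d)))

  ≤1+ι÷ : ∀ x d → 1 ℕ.≤ d → ι x * inv (ι d) ≤ 1ℚ + ι (x ÷ d)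
  ≤1+ι÷ x d 1≤d = *-cancel-ι d 1≤d (≤-trans (≤-reflexive e) (≤-trans (ι-mono (≤*suc÷ x d 1≤d))
      (≤-reflexive (trans (ι-* d (suc (x ÷ d))) (cong (ι d *_) (ι-suc (x ÷ d)))))))
    where
    e : ι d * (ι x * inv (ι d)) ≡ ι x
    e = trans (solve 3 (λ d x i → d :* (x :* i) := x :* (d :* i)) refl (ι d) (ι x) (inv (ι d)))
        (trans (cong (ι x *_) (ι*inv d 1≤d)) (*-identityʳ (ι x)))

  ≤⟦≤?⟧ : ∀ x d {a b} → (d ℕ.≤ x → a ≤ b) → (x ℕ.< d → a ≤ 0ℚ) → a ≤ ⟦ d ℕP.≤? x ⟧ * b
  ≤⟦≤?⟧ x d {a} {b} f g = go (d ℕP.≤? x)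
    where
    go : (e : Dec (d ℕ.≤ x)) → a ≤ ⟦ e ⟧ * b
    go (yes d≤x) = subst (a ≤_) (sym (*-identityˡ b)) (f d≤x)
    go (no d≰x)  = subst (a ≤_) (sym (*-zeroˡ b)) (g (ℕP.≰⇒> d≰x))

  -- The witness is ⌈x/2⌉. The last component is what closes the induction for Chebyshev's bound, 8
  -- n + 4 n ≤ 8 x.
  half : ∀ x → 2 ℕ.≤ x → ∃[ n ] (n ℕ.< x × x ℕ.≤ double n × double n ℕ.≤ suc x × ι 12 * ι n ≤ ι 8 * ι x)
  half 0 ()
  half 1 (s≤s ())
  half 2 _ = 1 , ℕP.≤-refl , ℕP.≤-refl , ℕP.n≤1+n 2 , ≤-by (0≤ι 4) refl
  half 3 _ = 2 , ℕP.≤-refl , ℕP.n≤1+n 3 , ℕP.≤-refl , ≤-by (0≤ι 0) refl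
  half (suc (suc x@(suc (suc _)))) _ with half x (s≤s (s≤s z≤n))
  ... | n , n<x , x≤2n , 2n≤ , b = suc n , s≤s (ℕP.m≤n⇒m≤1+n n<x) , s≤s (s≤s x≤2n) , s≤s (s≤s 2n≤)
    , ≤-by (+-nonNeg (diff-≤ b) (0≤ι 4))
        (trans (solve 2 (λ n x → (con (ι 8) :* x :- con (ι 12) :* n) :+ con (ι 4) := con (ι 8)
        :* (con 1ℚ :+ (con 1ℚ :+ x)) :- con (ι 12) :* (con 1ℚ :+ n)) refl (ι n) (ι x))
        (sym (cong₂ (λ s t → ι 8 * s - ι 12 * t) (trans (ι-suc (suc x)) (cong (λ z → 1ℚ + z)
            (ι-suc x))) (ι-suc n))))

  module Estimates {B ℓ} (log-like : LogLike B ℓ) where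
    open LogLike log-like
    open Weights log-like

    step-slack : ∀ n → 1 ℕ.≤ n → n ℕ.< B → 0ℚ ≤ ι 2 - ι n * (ℓ (suc n) - ℓ n)
    step-slack n 1≤n n<B = diff-≤ (ℓ-step n 1≤n n<B)

    -- By induction: passing from x to x + 1 leaves exactly the slack 2 - x (ℓ (x + 1) - ℓ x) of the
    -- step bound, whence the constant 2.
    stirling : ∀ x → x ℕ.≤ B → ι x * ℓ x - ι 2 * ι x ≤ ∑ x ℓ
    stirling zero _ = ≤-reflexive (solve 1 (λ a → con 0ℚ :* a :- con (ι 2) :* con 0ℚ := con 0ℚ)
        refl (ℓ 0))
    stirling (suc zero) _ = ≤-by (0≤ι 2) (solve 1 (λ a → con (ι 2) := (con 0ℚ :+ a)
        :- (con 1ℚ :* a :- con (ι 2) :* con 1ℚ)) refl (ℓ 1))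
    stirling (suc x@(suc _)) x<B = ≤-by (+-nonNeg (diff-≤ (stirling x (ℕP.<⇒≤ x<B)))
        (step-slack x (s≤s z≤n) x<B))
      (trans (solve 4 (λ S x l m → (S :- (x :* l :- con (ι 2) :* x)) :+ (con (ι 2) :- x :* (m :- l)) :=
          (S :+ m) :- ((con 1ℚ :+ x) :* m :- con (ι 2) :* (con 1ℚ :+ x))) refl (∑ x ℓ) (ι x) (ℓ x)
          (ℓ (suc x)))
        (cong (λ z → (∑ x ℓ + ℓ (suc x)) - (z * ℓ (suc x) - ι 2 * z)) (sym (ι-suc x))))

    -- For the logarithm this bounds the central binomial coefficient by 4ⁿ. Each step replaces ℓ
    -- (2n + 1) by the larger ℓ (2n + 2) = ℓ 2 + ℓ (n + 1).
    ∑ℓ-double : ∀ n → double n ℕ.≤ B → ∑ (double n) ℓ - ι 2 * ∑ n ℓ ≤ ι n * (ι 2 * ℓ 2)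
    ∑ℓ-double zero _ = ≤-reflexive (solve 1 (λ a → con 0ℚ :- con (ι 2) :* con 0ℚ := con 0ℚ
        :* (con (ι 2) :* a)) refl (ℓ 2))
    ∑ℓ-double (suc n) 2n≤B = ≤-by
      (+-nonNeg (diff-≤ (∑ℓ-double n (ℕP.≤-trans (ℕP.m≤n+m (double n) 2) 2n≤B)))
          (diff-≤ (ℓ-suc (suc (double n)) (s≤s z≤n) 2n≤B)))
      (trans (solve 6 (λ S T n t a b → (n :* (con (ι 2) :* t) :- (S :- con (ι 2) :* T)) :+ (b :- a) :=
          (con (ι 2) :* b :+ (n :* (con (ι 2) :* t) :- (S :+ a :+ b) :+ con (ι 2) :* T)))
          refl (∑ (double n) ℓ) (∑ n ℓ) (ι n) (ℓ 2) (ℓ (suc (double n))) (ℓ (suc (suc (double n)))))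
        (trans (cong (λ z → ι 2 * z + (ι n * (ι 2 * ℓ 2) - (∑ (double n) ℓ + ℓ (suc (double n)) + ℓ
            (suc (suc (double n)))) + ι 2 * ∑ n ℓ)) ℓ2n)
          (trans (solve 7 (λ S T n t a b c → (con (ι 2) :* (t :+ c) :+ (n :* (con (ι 2) :* t)
              :- (S :+ a :+ b) :+ con (ι 2) :* T)) := (con 1ℚ :+ n) :* (con (ι 2) :* t)
              :- ((S :+ a :+ b) :- con (ι 2) :* (T :+ c))) refl (∑ (double n) ℓ) (∑ n ℓ) (ι n) (ℓ 2)
              (ℓ (suc (double n))) (ℓ (suc (suc (double n)))) (ℓ (suc n)))
            (cong (λ z → z * (ι 2 * ℓ 2) - ((∑ (double n) ℓ + ℓ (suc (double n)) + ℓ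
                (suc (suc (double n)))) - ι 2 * (∑ n ℓ + ℓ (suc n)))) (sym (ι-suc n))))))
      where
      ℓ2n : ℓ (suc (suc (double n))) ≡ ℓ 2 + ℓ (suc n)
      ℓ2n = trans (cong ℓ (double≡ (suc n))) (ℓ-* 2 (suc n) (s≤s z≤n) (s≤s z≤n))

    module Range (x : ℕ) (1≤x : 1 ℕ.≤ x) (x<B : x ℕ.< B) where
      -- One more than x, because halving an odd y ≤ x rounds up and doubling then reaches y + 1.
      Z = suc x

      E : ℕ → ℕ → ℚ
      E y d = ⟦ d ℕP.≤? y ⟧

      ψ : ℕ → ℚ
      ψ y = ∑Λ Z (E y)

      -- The sums of Λ(d) / d and Λ(d) χ(d) / d over prime powers d ≤ x; the cut-off is `E x`, as
      -- `∑Λ` alone runs over all q, k ≤ Z.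
      T S : ℚ
      T = ∑Λ Z (λ d → E x d * inv (ι d))
      S = ∑Λ Z (λ d → E x d * (χ d * inv (ι d)))

      ∑ℓ≡∑Λ : ∀ y → y ℕ.≤ Z → ∑ y ℓ ≡ ∑Λ Z (λ d → ι (y ÷ d))
      ∑ℓ≡∑Λ y y≤Z = trans (∑-cong y (λ n _ _ → sym (*-identityˡ (ℓ n))))
          (trans (∑-ℓ≡∑Λ Z y (λ _ → 1ℚ) y≤Z)
        (∑Λ-cong Z (λ d _ → trans (∑-const (y ÷ d) 1ℚ) (*-identityʳ (ι (y ÷ d))))))

      -- The sum of ℓ equals Σ Λ(d) ⌊x/d⌋, which is at most x T; `stirling` bounds it below, and x
      -- is cancelled.
      ℓ-2≤T : ℓ x - ι 2 ≤ T
      ℓ-2≤T = *-cancel-ι x 1≤x (≤-trans (≤-reflexive (solve 2 (λ x l → x :* (l :- con (ι 2)) := x :* l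
          :- con (ι 2) :* x) refl (ι x) (ℓ x)))
        (≤-trans (stirling x (ℕP.<⇒≤ x<B)) (≤-trans (≤-reflexive (∑ℓ≡∑Λ x (ℕP.n≤1+n x)))
          (≤-trans (∑Λ-mono Z {λ d → ι (x ÷ d)} {λ d → ι x * (E x d * inv (ι d))} local)
              (≤-reflexive (∑Λ-* Z (ι x) (λ d → E x d * inv (ι d))))))))
        where
        local : ∀ d → 2 ℕ.≤ d → ι (x ÷ d) ≤ ι x * (E x d * inv (ι d))
        local d 2≤d = ≤-trans (≤⟦≤?⟧ x d {ι (x ÷ d)} {ι x * inv (ι d)} (λ _ → ι÷≤ x d (ℕP.<⇒≤ 2≤d))
            (λ x<d → ≤-reflexive (cong ι (<⇒÷≡0 x d x<d))))
          (≤-reflexive (solve 3 (λ e x i → e :* (x :* i) := x :* (e :* i)) refl (E x d) (ι x)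
              (inv (ι d))))

      -- Chebyshev's argument: ⌊2n/d⌋ - 2 ⌊n/d⌋ is never negative and is at least 1 for n < d ≤ 2n.
      -- Summed against Λ it gives the binomial quantity of `∑ℓ-double`, and ℓ 2 ≤ 2.
      ψ-double : ∀ n → double n ℕ.≤ Z → ψ (double n) ≤ ψ n + ι 4 * ι n
      ψ-double n 2n≤Z = ≤-trans (∑Λ-mono Z {K = λ d → E n d + (ι (double n ÷ d) + (- ι 2) * ι (n ÷ d))}
          local)
        (≤-trans (≤-reflexive (trans (∑Λ-+ Z (E n) (λ d → ι (double n ÷ d) + (- ι 2) * ι (n ÷ d)))
            (cong (λ z → ψ n + z)
            (trans (∑Λ-+ Z (λ d → ι (double n ÷ d)) (λ d → (- ι 2) * ι (n ÷ d)))
                (cong₂ _+_ (sym (∑ℓ≡∑Λ (double n) 2n≤Z))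
              (trans (∑Λ-* Z (- ι 2) (λ d → ι (n ÷ d))) (cong ((- ι 2) *_) (sym (∑ℓ≡∑Λ n n≤Z)))))))))
          (≤-by (+-nonNeg (diff-≤ (∑ℓ-double n (ℕP.≤-trans 2n≤Z x<B)))
              (*-nonNeg (*-nonNeg (0≤ι n) (0≤ι 2)) (diff-≤ ℓ2≤2)))
            (solve 5 (λ D C n t p → (n :* (con (ι 2) :* t) :- (D :- con (ι 2) :* C)) :+ n :* con (ι 2)
                :* (con (ι 2) :- t) := (p :+ con (ι 4) :* n) :- (p :+ (D :+ (:- con (ι 2)) :* C)))
                refl (∑ (double n) ℓ) (∑ n ℓ) (ι n) (ℓ 2) (ψ n))))
        where
        n≤2n : ∀ n → n ℕ.≤ double n
        n≤2n zero    = z≤n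
        n≤2n (suc n) = s≤s (ℕP.m≤n⇒m≤1+n (n≤2n n))
        n≤Z = ℕP.≤-trans (n≤2n n) 2n≤Z
        1<B : 1 ℕ.< B
        1<B = ℕP.≤-trans (s≤s 1≤x) x<B
        ℓ2≤2 : ℓ 2 ≤ ι 2
        ℓ2≤2 = ≤-by (step-slack 1 ℕP.≤-refl 1<B) (trans (cong (λ z → ι 2 - ι 1 * (ℓ 2 - z)) ℓ-1)
            (solve 1 (λ t → con (ι 2) :- con 1ℚ :* (t :- con 0ℚ) := con (ι 2) :- t) refl (ℓ 2)))
        slack : ∀ d → 0ℚ ≤ ι (double n ÷ d) - (ι (n ÷ d) + ι (n ÷ d))
        slack d = diff-≤ (≤-trans (≤-reflexive (sym (ι-+ (n ÷ d) (n ÷ d))))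
          (ι-mono (ℕP.≤-trans (÷-superadditive n n d)
              (ℕP.≤-reflexive (cong (_÷ d) (sym
              (trans (double≡ n) (cong (λ z → n ℕ.+ z) (ℕP.+-identityʳ n)))))))))
        local : ∀ d → 2 ℕ.≤ d → E (double n) d ≤ E n d + (ι (double n ÷ d) + (- ι 2) * ι (n ÷ d))
        local d 2≤d = go (d ℕP.≤? double n) (d ℕP.≤? n)
          where
          a = ι (n ÷ d)
          b = ι (double n ÷ d)
          drop : ∀ {e} → 0ℚ ≤ e → 0ℚ ≤ e + (b + (- ι 2) * a)
          drop {e} 0≤e = ≤-trans (+-nonNeg 0≤e (slack d))
              (≤-reflexive (solve 3 (λ a b e → e :+ (b :- (a :+ a)) := e :+ (b :+ (:- con (ι 2)) :* a))
              refl a b e))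
          go : (u : Dec (d ℕ.≤ double n)) (v : Dec (d ℕ.≤ n)) → ⟦ u ⟧ ≤ ⟦ v ⟧ + (b + (- ι 2) * a)
          go (yes _) (yes _) = ≤-by (slack d)
              (solve 2 (λ a b → b :- (a :+ a) := (con 1ℚ :+ (b :+ (:- con (ι 2)) :* a)) :- con 1ℚ)
              refl a b)
          go (yes d≤) (no d≰) = ≤-trans (ι-mono {1} 1≤b)
              (≤-reflexive (trans (solve 1 (λ b → b := con 0ℚ :+ (b :+ (:- con (ι 2)) :* con 0ℚ))
              refl b)
              (cong (λ z → 0ℚ + (b + (- ι 2) * z)) (cong ι (sym (<⇒÷≡0 n d (ℕP.≰⇒> d≰)))))))
            where
            1≤b : 1 ℕ.≤ double n ÷ d
            1≤b = ÷-pos (double n) d (ℕP.<⇒≤ 2≤d) d≤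
              where
              ÷-pos : ∀ y d → 1 ℕ.≤ d → d ℕ.≤ y → 1 ℕ.≤ y ÷ d
              ÷-pos y d@(suc _) _ d≤y = ℕD.m≥n⇒m/n>0 d≤y
          go (no _) v = drop (⟦⟧-nonNeg v)

      -- Strong induction, by fuel, from ⌈y/2⌉ to y.
      ψ≤8 : ∀ y → y ℕ.≤ x → ψ y ≤ ι 8 * ι y
      ψ≤8 y = go y y ℕP.≤-refl
        where
        go : ∀ fuel y → y ℕ.≤ fuel → y ℕ.≤ x → ψ y ≤ ι 8 * ι y
        go fuel y y≤f y≤x with 2 ℕP.≤? y
        go fuel y y≤f y≤x | no y<2 = ≤-trans (≤-reflexive none) (*-nonNeg (0≤ι 8) (0≤ι y))
          where
          none : ψ y ≡ 0ℚ
          none = trans (∑Λ-cong Z {K = λ _ → 0ℚ * 0ℚ} (λ d 2≤d → ⟦⟧-no (d ℕP.≤? y)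
              (λ d≤y → y<2 (ℕP.≤-trans 2≤d d≤y))))
            (trans (∑Λ-* Z 0ℚ (λ _ → 0ℚ)) (*-zeroˡ (∑Λ Z (λ _ → 0ℚ))))
        go zero y y≤f y≤x | yes 2≤y = contradiction (ℕP.≤-trans 2≤y y≤f) λ ()
        go (suc fuel) y y≤f y≤x | yes 2≤y with half y 2≤y
        ... | n , n<y , y≤2n , 2n≤ , b = ≤-trans
            (∑Λ-mono Z (λ d _ → ⟦⟧-mono (d ℕP.≤? y) (d ℕP.≤? double n) (λ d≤y → ℕP.≤-trans d≤y y≤2n)))
          (≤-trans (ψ-double n (ℕP.≤-trans 2n≤ (s≤s y≤x)))
            (≤-by (+-nonNeg (diff-≤ (go fuel n (ℕP.≤-pred (ℕP.≤-trans n<y y≤f))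
                (ℕP.≤-trans (ℕP.<⇒≤ n<y) y≤x))) (diff-≤ b))
              (solve 3 (λ p n y → (con (ι 8) :* n :- p) :+ (con (ι 8) :* y :- con (ι 12) :* n) :=
                  con (ι 8) :* y :- (p :+ con (ι 4) :* n)) refl (ψ n) (ι n) (ι y))))

-- The sum of (1 + χ(p)) log p / p.

module CharMertens where
  open import Data.Nat.Base as ℕ using (ℕ; zero; suc; z≤n; s≤s)
  import Data.Nat.Properties as ℕP
  open import Data.Product.Base using (_,_; proj₁; proj₂)
  open import Data.Rational.Base hiding (_÷_)
  open import Data.Rational.Properties
  open import Data.Rational.Solver using (module +-*-Solver)
  open import Data.Sum.Base using (_⊎_; inj₁; inj₂)
  open import Relation.Binary.PropositionalEquality
  open import Relation.Nullary using (Dec; yes; no)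
  open RationalLemmas
  open +-*-Solver using (solve; _:+_; _:*_; _:-_; :-_; _:=_; con)
  open Sums
  open Character
  open Mangoldt
  open Mertens

  0≤1+χ : ∀ n → 0ℚ ≤ 1ℚ + χ n
  0≤1+χ n = ≤-by (diff-≤ (proj₁ (-1≤χ≤1 n))) (solve 1 (λ c → c :- (:- con 1ℚ) := (con 1ℚ :+ c)
      :- con 0ℚ) refl (χ n))

  ∣χ∣≤1 : ∀ n → ∣ χ n ∣ ≤ 1ℚ
  ∣χ∣≤1 n = ∣∣-≤ (χ n) (proj₂ (-1≤χ≤1 n))
      (≤-by (0≤1+χ n) (solve 1 (λ c → con 1ℚ :+ c := con 1ℚ :- (:- c)) refl (χ n)))

  -- The invariant is Σ_{k=2}^{K} q⁻ᵏ + 2 q⁻⁽ᴷ⁺¹⁾ ≤ 2 q⁻², doubled.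
  geometric : ∀ q (H : ℕ → ℚ) K → 2 ℕ.≤ q → (∀ d → 1 ℕ.≤ d → H d ≤ ι 2 * inv (ι d)) → 1 ℕ.≤ K →
    ∑ K (λ k → H (q ℕ.^ k)) + ι 4 * inv (ι (q ℕ.^ suc K)) ≤ H q + ι 4 * (inv (ι q) * inv (ι q))
  geometric q H (suc zero) 2≤q H≤ _ = ≤-reflexive (cong₂ _+_
    (trans (+-identityˡ (H (q ℕ.^ 1))) (cong H (ℕP.*-identityʳ q)))
    (cong (ι 4 *_) (trans (cong (λ z → inv (ι (q ℕ.* z))) (ℕP.*-identityʳ q)) (inv-ι-* q q (ℕP.<⇒≤ 2≤q)
        (ℕP.<⇒≤ 2≤q)))))
  geometric q H (suc K@(suc _)) 2≤q H≤ _ = ≤-trans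
    (≤-by (+-nonNeg (diff-≤ (H≤ (q ℕ.^ suc K) 1≤qᴷ)) (diff-≤ tail))
      (solve 4 (λ S h a b → (con (ι 2) :* a :- h) :+ (con (ι 2) :* a :- con (ι 4) :* b) :=
          (S :+ con (ι 4) :* a) :- (S :+ h :+ con (ι 4) :* b)) refl (∑ K (λ k → H (q ℕ.^ k)))
          (H (q ℕ.^ suc K)) (inv (ι (q ℕ.^ suc K))) (inv (ι (q ℕ.^ suc (suc K))))))
    (geometric q H K 2≤q H≤ (s≤s z≤n))
    where
    1≤q = ℕP.<⇒≤ 2≤q
    1≤qᴷ : 1 ℕ.≤ q ℕ.^ suc K
    1≤qᴷ = ℕP.m^n>0 q {{ℕ.>-nonZero 1≤q}} (suc K)
    a = inv (ι (q ℕ.^ suc K))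
    2inv≤1 : ι 2 * inv (ι q) ≤ 1ℚ
    2inv≤1 = ≤-trans (*-monoˡ-≤-nonNeg (ι 2) (inv-ι-anti 2 q (s≤s z≤n) 2≤q)) (≤-reflexive refl)
    tail : ι 4 * inv (ι (q ℕ.^ suc (suc K))) ≤ ι 2 * a
    tail = ≤-trans (≤-reflexive (cong (ι 4 *_) (inv-ι-* q (q ℕ.^ suc K) 1≤q 1≤qᴷ)))
      (≤-by (*-nonNeg (*-nonNeg (0≤ι 2) (0≤inv-ι (q ℕ.^ suc K) 1≤qᴷ)) (diff-≤ 2inv≤1))
        (solve 2 (λ a i → con (ι 2) :* a :* (con 1ℚ :- con (ι 2) :* i) := con (ι 2) :* a :- con (ι 4)
            :* (i :* a)) refl a (inv (ι q))))

  module CharEstimates {B ℓ} (log-like : LogLike B ℓ) where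
    open LogLike log-like
    open Weights log-like
    open Estimates log-like

    -- Discrete form of the antiderivative -(log t + 1)/t of log t / t²: the quantity (ℓ n + 4)/n
    -- starts at 4 and falls by at least ℓ (n + 1)/(n + 1)² at each step.
    ∑ℓ/q²≤4 : ∀ n → 1 ℕ.≤ n → n ℕ.≤ B →
      ∑ n (λ q → ℓ q * (inv (ι q) * inv (ι q))) + (ℓ n + ι 4) * inv (ι n) ≤ ι 4
    ∑ℓ/q²≤4 (suc zero) _ _ = ≤-reflexive (trans (cong (λ z → 0ℚ + z * (1ℚ * 1ℚ) + (z + ι 4) * 1ℚ) ℓ-1)
        refl)
    ∑ℓ/q²≤4 (suc n@(suc _)) _ n<B = ≤-trans
      (≤-by (*-nonNeg 0≤D (*-nonNeg (0≤inv-ι n (s≤s z≤n)) (*-nonNeg 0≤j 0≤j))) (begin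
        D * (i * (j * j))
          ≡⟨ (solve 5 (λ l m a i j → (l :+ (a :+ con (ι 2)) :* (con (ι 2) :- a :* (m :- l))
              :+ con (ι 2) :* a) :* (i :* (j :* j)) := (l :+ con (ι 4)) :* i :* (((con 1ℚ :+ a) :* j)
              :* ((con 1ℚ :+ a) :* j)) :- (m :* (j :* j) :* (a :* i) :+ (m :+ con (ι 4)) :* j
              :* (a :* i) :* ((con 1ℚ :+ a) :* j))) refl (ℓ n) (ℓ (suc n)) (ι n) i j) ⟩
        (ℓ n + ι 4) * i * (((1ℚ + ι n) * j) * ((1ℚ + ι n) * j)) - (ℓ (suc n) * (j * j) * (ι n * i) +
            (ℓ (suc n) + ι 4) * j * (ι n * i) * ((1ℚ + ι n) * j))
          ≡⟨ cong₂ (λ s t → (ℓ n + ι 4) * i * (t * t) - (ℓ (suc n) * (j * j) * s + (ℓ (suc n) + ι 4) *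
              j * s * t)) (ι*inv n (s≤s z≤n))
               (trans (cong (_* j) (sym (ι-suc n))) (ι*inv (suc n) (s≤s z≤n))) ⟩
        (ℓ n + ι 4) * i * (1ℚ * 1ℚ) - (ℓ (suc n) * (j * j) * 1ℚ + (ℓ (suc n) + ι 4) * j * 1ℚ * 1ℚ)
          ≡⟨ (solve 5 (λ S l m i j → (l :+ con (ι 4)) :* i :* (con 1ℚ :* con 1ℚ)
              :- (m :* (j :* j) :* con 1ℚ :+ (m :+ con (ι 4)) :* j :* con 1ℚ :* con 1ℚ) :=
              (S :+ (l :+ con (ι 4)) :* i) :- (S :+ m :* (j :* j) :+ (m :+ con (ι 4)) :* j))
              refl (∑ n (λ q → ℓ q * (inv (ι q) * inv (ι q)))) (ℓ n) (ℓ (suc n)) i j) ⟩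
        _ ∎))
      (∑ℓ/q²≤4 n (s≤s z≤n) (ℕP.<⇒≤ n<B))
      where
      open ≡-Reasoning
      i = inv (ι n)
      j = inv (ι (suc n))
      0≤j = 0≤inv-ι (suc n) (s≤s z≤n)
      D = ℓ n + (ι n + ι 2) * (ι 2 - ι n * (ℓ (suc n) - ℓ n)) + ι 2 * ι n
      0≤D : 0ℚ ≤ D
      0≤D = +-nonNeg (+-nonNeg (ℓ-nonNeg n) (*-nonNeg (+-nonNeg (0≤ι n) (0≤ι 2))
          (step-slack n (s≤s z≤n) n<B))) (*-nonNeg (0≤ι 2) (0≤ι n))

    module CharRange (x : ℕ) (1≤x : 1 ℕ.≤ x) (x<B : x ℕ.< B) where
      open Range x 1≤x x<B

      A : ℚ
      A = ∑ x (λ n → χ n * inv (ι n) * ℓ n)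

      -- (ℓ n + 2) / n is decreasing, so its alternating sum is non-negative.
      0≤A+2L : 0ℚ ≤ A + ι 2 * L x
      0≤A+2L = ≤-trans (≤-trans (≤-reflexive (solve 1 (λ g → con 0ℚ := :- (con 0ℚ :* g)) refl (g 1)))
          (proj₁ (∑χ-bounds 0 x g 0≤g anti)))
        (≤-reflexive (trans (∑-cong x (λ n _ _ → (solve 3 (λ c l i → c :* ((l :+ con (ι 2)) :* i) := c
            :* i :* l :+ con (ι 2) :* (c :* i)) refl (χ n) (ℓ n) (inv (ι n)))))
          (trans (∑-+ x (λ n → χ n * inv (ι n) * ℓ n) (λ n → ι 2 * (χ n * inv (ι n))))
              (cong (λ z → A + z) (∑-* x (ι 2) (λ n → χ n * inv (ι n)))))))
        where
        g : ℕ → ℚ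
        g n = (ℓ n + ι 2) * inv (ι n)
        0≤g : ∀ n → 1 ℕ.≤ n → 0ℚ ≤ g n
        0≤g n 1≤n = *-nonNeg (+-nonNeg (ℓ-nonNeg n) (0≤ι 2)) (0≤inv-ι n 1≤n)
        anti : ∀ n → 1 ℕ.≤ n → n ℕ.≤ x → g (suc n) ≤ g n
        anti n 1≤n n≤x = ≤-by (*-nonNeg (+-nonNeg (ℓ-nonNeg n)
            (step-slack n 1≤n (ℕP.≤-<-trans n≤x x<B))) (*-nonNeg (0≤inv-ι n 1≤n)
            (0≤inv-ι (suc n) (s≤s z≤n))))
          (trans (solve 5 (λ l m a i j → (l :+ (con (ι 2) :- a :* (m :- l))) :* (i :* j) :=
              (l :+ con (ι 2)) :* i :* ((con 1ℚ :+ a) :* j) :- (m :+ con (ι 2)) :* j :* (a :* i))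
              refl (ℓ n) (ℓ (suc n)) (ι n) (inv (ι n)) (inv (ι (suc n))))
            (trans (cong₂ (λ s t → (ℓ n + ι 2) * inv (ι n) * t - (ℓ (suc n) + ι 2) * inv (ι (suc n)) *
                s) (ι*inv n 1≤n)
               (trans (cong (_* inv (ι (suc n))) (sym (ι-suc n))) (ι*inv (suc n) (s≤s z≤n))))
              (cong₂ _-_ (*-identityʳ (g n)) (*-identityʳ (g (suc n))))))

      -- Multiplicativity of χ turns A into Σ Λ(d) (χ(d)/d) L(⌊x/d⌋). Replacing L(⌊x/d⌋) by L x
      -- costs at most 1/(d (⌊x/d⌋ + 1)) ≤ 1/x per term, in total ψ(x)/x ≤ 8.
      A≤LS+8 : A ≤ L x * S + ι 8
      A≤LS+8 = ≤-trans (≤-reflexive (∑-ℓ≡∑Λ Z x (λ n → χ n * inv (ι n)) (ℕP.n≤1+n x)))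
        (≤-trans (∑Λ-mono Z {K = λ d → L x * (E x d * (χ d * inv (ι d))) + inv (ι x) * E x d} local)
          (≤-trans (≤-reflexive (trans (∑Λ-+ Z (λ d → L x * (E x d * (χ d * inv (ι d))))
              (λ d → inv (ι x) * E x d))
              (cong₂ _+_ (∑Λ-* Z (L x) (λ d → E x d * (χ d * inv (ι d)))) (∑Λ-* Z (inv (ι x)) (E x)))))
            (+-monoʳ-≤ (L x * S) (≤-trans (*-monoˡ-≤-nonNeg (inv (ι x)) {{nonNegative (0≤inv-ι x 1≤x)}}
                (ψ≤8 x ℕP.≤-refl))
              (≤-reflexive (trans (solve 2 (λ i x → i :* (con (ι 8) :* x) := con (ι 8) :* (x :* i))
                  refl (inv (ι x)) (ι x)) (trans (cong (ι 8 *_) (ι*inv x 1≤x))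
                  (*-identityʳ (ι 8)))))))))
        where
        local : ∀ d → 2 ℕ.≤ d → ∑ (x ÷ d) (λ m → χ (d ℕ.* m) * inv (ι (d ℕ.* m))) ≤ L x *
            (E x d * (χ d * inv (ι d))) + inv (ι x) * E x d
        local d 2≤d = ≤-trans (≤-reflexive factor) (≤-trans (≤⟦≤?⟧ x d {c * L y} {L x * c + inv (ι x)}
            near far)
            (≤-reflexive (solve 4 (λ e l c i → e :* (l :* c :+ i) := l :* (e :* c) :+ i :* e)
                refl (E x d) (L x) c (inv (ι x)))))
          where
          1≤d = ℕP.<⇒≤ 2≤d
          y = x ÷ d
          c = χ d * inv (ι d)
          factor : ∑ y (λ m → χ (d ℕ.* m) * inv (ι (d ℕ.* m))) ≡ c * L y
          factor = trans (∑-cong y (λ m 1≤m _ → trans (cong₂ _*_ (χ-* d m) (inv-ι-* d m 1≤d 1≤m))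
              (solve 4 (λ a b i j → a :* b :* (i :* j) := a :* i :* (b :* j)) refl (χ d) (χ m)
                  (inv (ι d)) (inv (ι m)))))
            (∑-* y c (λ m → χ m * inv (ι m)))
          y≤x : y ℕ.≤ x
          y≤x = ℕP.≤-trans (ℕP.m≤m*n y d {{ℕ.>-nonZero 1≤d}}) (÷*≤ x d 1≤d)
          far : x ℕ.< d → c * L y ≤ 0ℚ
          far x<d = ≤-reflexive (trans (cong (λ z → c * L z) (<⇒÷≡0 x d x<d)) (*-zeroʳ c))
          ∣c∣≤ : ∣ c ∣ ≤ 1ℚ * inv (ι d)
          ∣c∣≤ = ∣*∣-≤ {χ d} {inv (ι d)} (∣χ∣≤1 d) (≤-reflexive (0≤p⇒∣p∣≡p (0≤inv-ι d 1≤d)))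
          ΔL : ∣ L y - L x ∣ ≤ inv (ι (suc y))
          ΔL = subst (λ z → ∣ L y - L z ∣ ≤ inv (ι (suc y))) (ℕP.m+[n∸m]≡n y≤x) (∣ΔL∣≤ y (x ℕ.∸ y))
          near : d ℕ.≤ x → c * L y ≤ L x * c + inv (ι x)
          near _ = ≤-by (diff-≤ (≤-trans (p≤∣p∣ (c * (L y - L x)))
              (≤-trans (∣*∣-≤ {c} {L y - L x} ∣c∣≤ ΔL)
              (≤-trans (≤-reflexive (trans (cong (_* inv (ι (suc y))) (*-identityˡ (inv (ι d))))
                  (sym (inv-ι-* d (suc y) 1≤d (s≤s z≤n)))))
                (inv-ι-anti x (d ℕ.* suc y) 1≤x (≤*suc÷ x d 1≤d))))))
            (solve 4 (λ i c l m → i :- c :* (m :- l) := (l :* c :+ i) :- c :* m) refl (inv (ι x)) c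
                (L x) (L y))

      -- The two estimates of A give L x (S + 2) + 8 ≥ 0. If S + 2 is negative, L x ≥ 1/2 turns this
      -- into S + 2 ≥ -16.
      -18≤S : 0ℚ ≤ S + ι 18
      -18≤S = go (≤-total 0ℚ (S + ι 2))
        where
        lower : 0ℚ ≤ L x * (S + ι 2) + ι 8
        lower = ≤-by (+-nonNeg 0≤A+2L (diff-≤ A≤LS+8)) (solve 3 (λ A l s → (A :+ con (ι 2) :* l)
            :+ ((l :* s :+ con (ι 8)) :- A) := (l :* (s :+ con (ι 2)) :+ con (ι 8)) :- con 0ℚ) refl A
            (L x) S)
        go : 0ℚ ≤ S + ι 2 ⊎ S + ι 2 ≤ 0ℚ → 0ℚ ≤ S + ι 18
        go (inj₁ 0≤S+2) = ≤-by (+-nonNeg 0≤S+2 (0≤ι 16)) (solve 1 (λ s → (s :+ con (ι 2)) :+ con (ι 16)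
            := (s :+ con (ι 18)) :- con 0ℚ) refl S)
        go (inj₂ S+2≤0) = ≤-by (*-nonNeg (0≤ι 2) (+-nonNeg lower (*-nonNeg (diff-≤ (½≤L x 1≤x))
            (diff-≤ S+2≤0))))
          (solve 2 (λ s l → con (ι 2) :* ((l :* (s :+ con (ι 2)) :+ con (ι 8)) :+ (l :- con ½)
              :* (con 0ℚ :- (s :+ con (ι 2)))) := (s :+ con (ι 18)) :- con 0ℚ) refl S (L x))

      H : ℕ → ℚ
      H d = E x d * ((1ℚ + χ d) * inv (ι d))

      ℓ-20≤∑ΛH : ℓ x - ι 20 ≤ ∑Λ Z H
      ℓ-20≤∑ΛH = ≤-trans (≤-by (+-nonNeg (diff-≤ ℓ-2≤T) -18≤S)
          (solve 3 (λ l t s → (t :- (l :- con (ι 2))) :+ (s :+ con (ι 18)) := (t :+ s)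
          :- (l :- con (ι 20))) refl (ℓ x) T S))
        (≤-reflexive (trans (sym (∑Λ-+ Z (λ d → E x d * inv (ι d)) (λ d → E x d * (χ d * inv (ι d)))))
          (∑Λ-cong Z (λ d _ → (solve 3 (λ e i c → e :* i :+ e :* (c :* i) := e :* ((con 1ℚ :+ c) :* i))
              refl (E x d) (inv (ι d)) (χ d))))))

      H≤2/d : ∀ d → 1 ℕ.≤ d → H d ≤ ι 2 * inv (ι d)
      H≤2/d d 1≤d = go (d ℕP.≤? x)
        where
        0≤i = 0≤inv-ι d 1≤d
        go : (e : Dec (d ℕ.≤ x)) → ⟦ e ⟧ * ((1ℚ + χ d) * inv (ι d)) ≤ ι 2 * inv (ι d)
        go (yes _) = ≤-by (*-nonNeg (diff-≤ (proj₂ (-1≤χ≤1 d))) 0≤i)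
            (solve 2 (λ c i → (con 1ℚ :- c) :* i := con (ι 2) :* i :- con 1ℚ :* ((con 1ℚ :+ c) :* i))
            refl (χ d) (inv (ι d)))
        go (no _)  = ≤-by (*-nonNeg (0≤ι 2) 0≤i) (solve 2 (λ c i → con (ι 2) :* i := con (ι 2) :* i
            :- con 0ℚ :* ((con 1ℚ :+ c) :* i)) refl (χ d) (inv (ι d)))

      -- Proper prime powers contribute at most 4 Σ ℓ(q)/q² ≤ 16 to `∑Λ Z H`; 36 = 20 + 16.
      mertens-split : ℓ x - ι 36 ≤ ∑ Z (λ q → w q * H q)
      mertens-split = ≤-by (+-nonNeg (+-nonNeg (diff-≤ ℓ-20≤∑ΛH) (diff-≤ upper))
          (*-nonNeg (0≤ι 4) (diff-≤ R≤4)))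
        (solve 4 (λ l s p r → (s :- (l :- con (ι 20))) :+ ((p :+ con (ι 4) :* r) :- s) :+ con (ι 4)
            :* (con (ι 4) :- r) := p :- (l :- con (ι 36))) refl (ℓ x) (∑Λ Z H) (∑ Z (λ q → w q * H q))
            R)
        where
        R = ∑ Z (λ q → ℓ q * (inv (ι q) * inv (ι q)))
        R≤4 : R ≤ ι 4
        R≤4 = ≤-by (+-nonNeg (diff-≤ (∑ℓ/q²≤4 Z (s≤s z≤n) x<B))
            (*-nonNeg (+-nonNeg (ℓ-nonNeg Z) (0≤ι 4)) (0≤inv-ι Z (s≤s z≤n))))
          (solve 2 (λ r a → (con (ι 4) :- (r :+ a)) :+ a := con (ι 4) :- r) refl R
              ((ℓ Z + ι 4) * inv (ι Z)))
        upper : ∑Λ Z H ≤ ∑ Z (λ q → w q * H q) + ι 4 * R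
        upper = ≤-trans (∑-mono Z local)
            (≤-reflexive (trans (∑-+ Z (λ q → w q * H q) (λ q → ι 4 * (ℓ q * (inv (ι q) * inv (ι q)))))
            (cong (λ z → ∑ Z (λ q → w q * H q) + z)
                (∑-* Z (ι 4) (λ q → ℓ q * (inv (ι q) * inv (ι q)))))))
          where
          local : ∀ q → 1 ℕ.≤ q → q ℕ.≤ Z → w q * ∑ Z (λ k → H (q ℕ.^ k)) ≤ w q * H q + ι 4 *
              (ℓ q * (inv (ι q) * inv (ι q)))
          local q 1≤q _ = ≤-trans (w-mono q {b = H q + ι 4 * (i * i)} (λ pr → ≤-by
              (+-nonNeg (diff-≤ (geometric q H Z (prime≥2 pr) H≤2/d (s≤s z≤n)))
                  (*-nonNeg (0≤ι 4) (0≤inv-ι (q ℕ.^ suc Z) (ℕP.m^n>0 q {{ℕ.>-nonZero 1≤q}} (suc Z)))))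
              (solve 3 (λ s t h → (h :- (s :+ con (ι 4) :* t)) :+ con (ι 4) :* t := h :- s)
                  refl (∑ Z (λ k → H (q ℕ.^ k))) (inv (ι (q ℕ.^ suc Z))) (H q + ι 4 * (i * i)))))
            (≤-by (*-nonNeg (*-nonNeg (0≤ι 4) (*-nonNeg 0≤i 0≤i)) (diff-≤ (w≤ℓ q)))
              (solve 4 (λ w l h i → con (ι 4) :* (i :* i) :* (l :- w) := (w :* h :+ con (ι 4)
                  :* (l :* (i :* i))) :- w :* (h :+ con (ι 4) :* (i :* i))) refl (w q) (ℓ q) (H q) i))
            where
            i = inv (ι q)
            0≤i = 0≤inv-ι q 1≤q

-- Prime factors of n² + 1 and the bound for non-friable values.

module Friable where
  open import Data.List.Base using ([]; _∷_; foldr)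
  open import Data.List.Membership.Propositional using (_∈_)
  import Data.List.Relation.Unary.All as All
  open import Data.List.Relation.Unary.Any using (here; there)
  open import Data.Nat.Base as ℕ using (ℕ; zero; suc; z≤n; s≤s)
  import Data.Nat.Divisibility as ℕ∣
  open import Data.Nat.ListAction.Properties using (∈⇒∣product)
  open import Data.Nat.Primality using (Prime)
  open import Data.Nat.Primality.Factorisation using (factorise; module PrimeFactorisation)
  import Data.Nat.Properties as ℕP
  open import Data.Product.Base using (_×_; _,_; proj₁; proj₂)
  open import Data.Rational.Base hiding (_÷_)
  open import Data.Rational.Properties
  open import Data.Rational.Solver using (module +-*-Solver)
  open import Data.Sum.Base using (_⊎_; inj₁; inj₂)
  open import Relation.Binary.PropositionalEquality
  open import Relation.Nullary using (Dec; yes; no; contradiction)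
  open RationalLemmas
  open +-*-Solver using (solve; _:+_; _:*_; _:-_; :-_; _:=_; con)
  open Sums
  open Character
  open RootCount
  open Mangoldt
  open Mertens
  open CharMertens

  foldr-⊔-∈ : ∀ xs → foldr ℕ._⊔_ 1 xs ≡ 1 ⊎ foldr ℕ._⊔_ 1 xs ∈ xs
  foldr-⊔-∈ [] = inj₁ refl
  foldr-⊔-∈ (x ∷ xs) with ℕP.⊔-sel x (foldr ℕ._⊔_ 1 xs) | foldr-⊔-∈ xs
  ... | inj₁ e | _      = inj₂ (here e)
  ... | inj₂ e | inj₁ f = inj₁ (trans e f)
  ... | inj₂ e | inj₂ m = inj₂ (there (subst (_∈ xs) (sym e) m))

  P⁺-prime-∣ : ∀ n .{{_ : ℕ.NonZero n}} → 1 ℕ.< P⁺ n → Prime (P⁺ n) × P⁺ n ℕ∣.∣ n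
  P⁺-prime-∣ n 1<P = go (foldr-⊔-∈ factors)
    where
    open PrimeFactorisation (factorise n)
    go : P⁺ n ≡ 1 ⊎ P⁺ n ∈ factors → Prime (P⁺ n) × P⁺ n ℕ∣.∣ n
    go (inj₁ e) = contradiction (sym e) (ℕP.<⇒≢ 1<P)
    go (inj₂ m) = All.lookup factorsPrime m , subst (P⁺ n ℕ∣.∣_) (sym isFactorisation) (∈⇒∣product m)

  P⁺F : ℕ → ℕ
  P⁺F n = P⁺ (F n) {{F-nonZero n}}

  1≤F : ∀ n → 1 ℕ.≤ F n
  1≤F n = ℕP.m≤n+m 1 (n ℕ.^ 2)

  F-mono : ∀ {m n} → m ℕ.≤ n → F m ℕ.≤ F n
  F-mono m≤n = ℕP.+-monoˡ-≤ 1 (ℕP.^-monoˡ-≤ 2 m≤n)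

  unfriable : ℕ → ℕ → ℚ
  unfriable X Y = ∑ X (λ n → ⟦ Y ℕP.<? P⁺F n ⟧)

  module FriableBound {B ℓ} (log-like : LogLike B ℓ) (X Y : ℕ)
    (1≤X : 1 ℕ.≤ X) (X≤Y : X ℕ.≤ Y) (FX≤B : F X ℕ.≤ B) (Y+2≤B : 2 ℕ.+ Y ℕ.≤ B) where
    open LogLike log-like
    open Weights log-like
    open CharEstimates log-like

    private
      X<B : X ℕ.< B
      X<B = ℕP.≤-trans (s≤s (ℕP.m≤n⇒m≤1+n X≤Y)) Y+2≤B

    open Estimates.Range log-like X 1≤X X<B
    open CharRange X 1≤X X<B

    small : ℕ → ℚ
    small n = ∑ X (λ q → w q * ⟦ q ℕ∣.∣? F n ⟧)

    private
      H-out : w (suc X) * H (suc X) ≡ 0ℚ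
      H-out = trans (cong (λ z → w (suc X) * (z * ((1ℚ + χ (suc X)) * inv (ι (suc X)))))
          (⟦⟧-no (suc X ℕP.≤? X) (ℕP.<⇒≱ ℕP.≤-refl)))
        (solve 2 (λ w a → w :* (con 0ℚ :* a) := con 0ℚ) refl (w (suc X)) ((1ℚ + χ (suc X)) * inv
            (ι (suc X))))

      ∑w≤8X : ∑ X w ≤ ι 8 * ι X
      ∑w≤8X = ≤-trans (∑-mono X {g = λ q → w q * ∑ Z (λ k → E X (q ℕ.^ k))} local)
          (≤-trans (∑-monoˡ (λ q → w q * ∑ Z (λ k → E X (q ℕ.^ k))) (ℕP.n≤1+n X)
              (λ q _ _ → *-nonNeg (0≤w q) (inner q))) (ψ≤8 X ℕP.≤-refl))
        where
        inner : ∀ q → 0ℚ ≤ ∑ Z (λ k → E X (q ℕ.^ k))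
        inner q = ∑-nonNeg Z (λ k _ _ → ⟦⟧-nonNeg (q ℕ.^ k ℕP.≤? X))
        local : ∀ q → 1 ℕ.≤ q → q ℕ.≤ X → w q ≤ w q * ∑ Z (λ k → E X (q ℕ.^ k))
        local q _ q≤X = ≤-trans (≤-reflexive (sym (*-identityʳ (w q)))) (*-monoˡ-≤-nonNeg (w q)
            {{nonNegative (0≤w q)}}
          (≤-trans (≤-reflexive (sym (trans (+-identityˡ (E X (q ℕ.^ 1))) (⟦⟧-yes (q ℕ.^ 1 ℕP.≤? X)
              (subst (ℕ._≤ X) (sym (ℕP.*-identityʳ q)) q≤X)))))
            (∑-monoˡ {1} {Z} (λ k → E X (q ℕ.^ k)) (s≤s z≤n) (λ k _ _ → ⟦⟧-nonNeg (q ℕ.^ k ℕP.≤? X)))))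

    -- Replacing X/q by the floor in `roots-count` loses at most 1 + χ q ≤ 2 for each prime, in
    -- total 2 Σ w ≤ 16 X by Chebyshev's bound; 52 = 36 + 16.
    small-lower : ι X * ℓ X - ι 52 * ι X ≤ ∑ X small
    small-lower = ≤-trans
      (≤-by (+-nonNeg (*-nonNeg (0≤ι X) (diff-≤ mertens-split)) (*-nonNeg (0≤ι 2) (diff-≤ ∑w≤8X)))
        (solve 4 (λ x l p v → x :* (p :- (l :- con (ι 36))) :+ con (ι 2) :* (con (ι 8) :* x :- v) :=
            (x :* p :+ (:- con (ι 2)) :* v) :- (x :* l :- con (ι 52) :* x)) refl (ι X) (ℓ X)
            (∑ Z (λ q → w q * H q)) (∑ X w)))
      (≤-trans (≤-reflexive collect) (≤-trans (∑-mono X local)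
        (≤-reflexive (trans (∑-cong X (λ q _ _ → sym (∑-* X (w q) (λ n → ⟦ q ℕ∣.∣? F n ⟧))))
            (∑-swap X X (λ q n → w q * ⟦ q ℕ∣.∣? F n ⟧))))))
      where
      collect : ι X * ∑ Z (λ q → w q * H q) + (- ι 2) * ∑ X w ≡ ∑ X (λ q → ι X * (w q * H q) + (- ι 2)
          * w q)
      collect = trans (cong (λ z → ι X * z + (- ι 2) * ∑ X w)
          (trans (cong (λ z → ∑ X (λ q → w q * H q) + z) H-out) (+-identityʳ (∑ X (λ q → w q * H q)))))
        (sym (trans (∑-+ X (λ q → ι X * (w q * H q)) (λ q → (- ι 2) * w q))
          (cong₂ _+_ (∑-* X (ι X) (λ q → w q * H q)) (∑-* X (- ι 2) w))))
      local : ∀ q → 1 ℕ.≤ q → q ℕ.≤ X → ι X * (w q * H q) + (- ι 2) * w q ≤ w q * ∑ X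
          (λ n → ⟦ q ℕ∣.∣? F n ⟧)
      local q 1≤q q≤X = ≤-trans (≤-reflexive
          (trans (cong (λ z → ι X * (w q * (z * ((1ℚ + χ q) * inv (ι q)))) + (- ι 2) * w q)
          (⟦⟧-yes (q ℕP.≤? X) q≤X))
          (solve 4 (λ x w c i → x :* (w :* (con 1ℚ :* ((con 1ℚ :+ c) :* i))) :+ (:- con (ι 2)) :* w :=
              w :* ((con 1ℚ :+ c) :* (x :* i) :- con (ι 2))) refl (ι X) (w q) (χ q) (inv (ι q)))))
        (w-mono q (λ pr → ≤-trans (≤-by (+-nonNeg (*-nonNeg (0≤1+χ q) (diff-≤ (≤1+ι÷ X q 1≤q)))
            (diff-≤ (proj₂ (-1≤χ≤1 q))))
            (solve 3 (λ c y k → (con 1ℚ :+ c) :* ((con 1ℚ :+ k) :- y) :+ (con 1ℚ :- c) := (con 1ℚ :+ c)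
                :* k :- ((con 1ℚ :+ c) :* y :- con (ι 2))) refl (χ q) (ι X * inv (ι q)) (ι (X ÷ q))))
          (roots-count X q pr)))

    -- A largest prime factor above Y ≥ X is not among the primes of `small n`, so it adds its own
    -- weight, at least ℓ (Y + 1).
    large : ∀ n → 1 ℕ.≤ n → n ℕ.≤ X → small n + ⟦ Y ℕP.<? P⁺F n ⟧ * ℓ (suc Y) ≤ ℓ (F n)
    large n _ n≤X = ≤-trans (go (Y ℕP.<? P⁺F n))
        (≤-trans first (≤-reflexive (sym (ℓ≡∑Λ M (F n) (1≤F n) (ℕP.m≤m+n (F n) X)))))
      where
      -- Large enough both for the expansion of ℓ (F n) and for the range q ≤ X of `small`.
      M = F n ℕ.+ X
      f : ℕ → ℚ
      f q = w q * ⟦ q ℕ∣.∣? F n ⟧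
      0≤f : ∀ q → 0ℚ ≤ f q
      0≤f q = *-nonNeg (0≤w q) (⟦⟧-nonNeg (q ℕ∣.∣? F n))
      first : ∑ M f ≤ ∑Λ M (λ d → ⟦ d ℕ∣.∣? F n ⟧)
      first = ∑-mono M (λ q _ _ → w-mono q (λ _ → ≤-trans
        (≤-reflexive (trans (cong (λ z → ⟦ z ℕ∣.∣? F n ⟧) (sym (ℕP.*-identityʳ q)))
            (sym (+-identityˡ ⟦ q ℕ.^ 1 ℕ∣.∣? F n ⟧))))
        (∑-monoˡ {1} {M} (λ k → ⟦ q ℕ.^ k ℕ∣.∣? F n ⟧) (ℕP.≤-trans (1≤F n) (ℕP.m≤m+n (F n) X))
            (λ k _ _ → ⟦⟧-nonNeg (q ℕ.^ k ℕ∣.∣? F n)))))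
      go : (d : Dec (Y ℕ.< P⁺F n)) → small n + ⟦ d ⟧ * ℓ (suc Y) ≤ ∑ M f
      go (no _) = ≤-trans (≤-reflexive (solve 2 (λ s l → s :+ con 0ℚ :* l := s) refl (small n)
          (ℓ (suc Y))))
        (∑-monoˡ f (ℕP.m≤n+m X (F n)) (λ q _ _ → 0≤f q))
      go (yes Y<P) = ≤-trans (+-monoʳ-≤ (small n) (≤-trans (≤-reflexive (*-identityˡ (ℓ (suc Y))))
          ℓY≤fp))
          (≤-trans (+-monoˡ-≤ (f p) (∑-monoˡ f X≤p-1 (λ q _ _ → 0≤f q))) (∑-upto p refl))
        where
        p = P⁺F n
        facts : Prime p × p ℕ∣.∣ F n
        facts = P⁺-prime-∣ (F n) {{F-nonZero n}} (ℕP.≤-trans (s≤s (ℕP.≤-trans 1≤X X≤Y)) Y<P)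
        p≤F : p ℕ.≤ F n
        p≤F = ℕ∣.∣⇒≤ {{F-nonZero n}} (proj₂ facts)
        X≤p-1 : X ℕ.≤ ℕ.pred p
        X≤p-1 = ℕP.≤-trans X≤Y (ℕP.pred-mono-≤ Y<P)
        ℓY≤fp : ℓ (suc Y) ≤ f p
        ℓY≤fp = ≤-trans (ℓ-mono (s≤s z≤n) Y<P (ℕP.≤-trans p≤F (ℕP.≤-trans (F-mono n≤X) FX≤B)))
          (≤-reflexive (sym (trans (cong (w p *_) (⟦⟧-yes (p ℕ∣.∣? F n) (proj₂ facts)))
              (trans (*-identityʳ (w p)) (w-prime (proj₁ facts))))))
        -- Generalising p to r allows matching on a successor, so that `∑` unfolds and its last term
        -- is split off.
        ∑-upto : ∀ r → r ≡ p → ∑ (ℕ.pred r) f + f r ≤ ∑ M f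
        ∑-upto zero e = contradiction (subst (Y ℕ.<_) (sym e) Y<P) λ ()
        ∑-upto (suc r) e = ∑-monoˡ {suc r} {M} f (ℕP.≤-trans (subst (ℕ._≤ F n) (sym e) p≤F)
            (ℕP.m≤m+n (F n) X)) (λ q _ _ → 0≤f q)

    ℓF≤ : ∀ n → 1 ℕ.≤ n → n ℕ.≤ X → ℓ (F n) ≤ ι 2 * ℓ X + ι 2
    ℓF≤ n _ n≤X = ≤-trans (ℓ-mono (1≤F n) (F-mono n≤X) FX≤B) (≤-by
        (+-nonNeg (diff-≤ (ℓ-step X² 1≤X² X²<B)) (*-nonNeg (diff-≤ (ι-mono {1} 1≤X²))
            (diff-≤ (ℓ-suc X² 1≤X² X²<B))))
        (trans (solve 3 (λ a f s → (con (ι 2) :- a :* (f :- s)) :+ (a :- con 1ℚ) :* (f :- s) := s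
            :+ con (ι 2) :- f) refl (ι X²) (ℓ (suc X²)) (ℓ X²))
          (cong₂ (λ s t → s + ι 2 - ℓ t) ℓX² (ℕP.+-comm 1 X²))))
      where
      X² = X ℕ.^ 2
      1≤X² : 1 ℕ.≤ X²
      1≤X² = ℕP.m^n>0 X {{ℕ.>-nonZero 1≤X}} 2
      X²<B : X² ℕ.< B
      X²<B = ℕP.≤-trans (ℕP.≤-reflexive (ℕP.+-comm 1 X²)) FX≤B
      ℓX² : ℓ X² ≡ ι 2 * ℓ X
      ℓX² = trans (cong (λ z → ℓ (X ℕ.* z)) (ℕP.*-identityʳ X)) (trans (ℓ-* X X 1≤X 1≤X)
          (solve 1 (λ l → l :+ l := con (ι 2) :* l) refl (ℓ X)))

    -- The sum of `large` over n ≤ X against `small-lower`. 56 = 52 + 2 + 2: one 2 comes from ℓ (X²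
    -- + 1) ≤ 2 ℓ X + 2, the other from moving to Y + 2, the upper end of the window that will
    -- contain y.
    unfriable-bound : unfriable X Y * ℓ (2 ℕ.+ Y) ≤ ι X * (ℓ X + ι 56)
    unfriable-bound = ≤-by (+-nonNeg (+-nonNeg (+-nonNeg (diff-≤ total) (diff-≤ small-lower))
        (*-nonNeg 0≤c (diff-≤ ℓY+2))) (*-nonNeg (0≤ι 2) (diff-≤ c≤X)))
      (solve 6 (λ c x l k m s → ((x :* (con (ι 2) :* l :+ con (ι 2)) :- (s :+ c :* k))
          :+ (s :- (x :* l :- con (ι 52) :* x))) :+ c :* ((k :+ con (ι 2)) :- m) :+ con (ι 2)
          :* (x :- c) := x :* (l :+ con (ι 56)) :- c :* m) refl c (ι X) (ℓ X) (ℓ (suc Y)) (ℓ (2 ℕ.+ Y))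
          (∑ X small))
      where
      c = unfriable X Y
      0≤c : 0ℚ ≤ c
      0≤c = ∑-nonNeg X (λ n _ _ → ⟦⟧-nonNeg (Y ℕP.<? P⁺F n))
      c≤X : c ≤ ι X
      c≤X = ≤-trans (∑-mono X {g = λ _ → 1ℚ} (λ n _ _ → ≤1 (Y ℕP.<? P⁺F n)))
          (≤-reflexive (trans (∑-const X 1ℚ) (*-identityʳ (ι X))))
        where
        ≤1 : ∀ {P : Set} (d : Dec P) → ⟦ d ⟧ ≤ 1ℚ
        ≤1 (yes _) = ≤-refl
        ≤1 (no _)  = 0≤1
      total : ∑ X small + c * ℓ (suc Y) ≤ ι X * (ι 2 * ℓ X + ι 2)
      total = ≤-trans (≤-reflexive (sym (trans (∑-+ X small (λ n → ⟦ Y ℕP.<? P⁺F n ⟧ * ℓ (suc Y)))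
          (cong (λ z → ∑ X small + z) (trans (∑-cong X (λ n _ _ → *-comm ⟦ Y ℕP.<? P⁺F n ⟧
              (ℓ (suc Y)))) (trans (∑-* X (ℓ (suc Y)) (λ n → ⟦ Y ℕP.<? P⁺F n ⟧))
              (*-comm (ℓ (suc Y)) c)))))))
        (≤-trans (∑-mono X large) (≤-trans (∑-mono X ℓF≤) (≤-reflexive (∑-const X (ι 2 * ℓ X + ι 2)))))
      ℓY+2 : ℓ (2 ℕ.+ Y) ≤ ℓ (suc Y) + ι 2
      ℓY+2 = ≤-by (+-nonNeg (diff-≤ (ℓ-step (suc Y) (s≤s z≤n) Y+2≤B))
          (*-nonNeg (diff-≤ (ι-mono {1} {suc Y} (s≤s z≤n))) (diff-≤ (ℓ-suc (suc Y) (s≤s z≤n) Y+2≤B))))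
        (solve 3 (λ a f s → (con (ι 2) :- a :* (f :- s)) :+ (a :- con 1ℚ) :* (f :- s) := s :+ con (ι 2)
            :- f) refl (ι (suc Y)) (ℓ (2 ℕ.+ Y)) (ℓ (suc Y)))

-- Riemann sums of dt/t: increments and approximate additivity.

module Riemann where
  open import Data.Nat.Base as ℕ using (ℕ; zero; suc)
  open import Data.Product.Base using (_,_; proj₁)
  open import Data.Rational.Base hiding (_÷_)
  open import Data.Rational.Properties
  open import Data.Rational.Solver using (module +-*-Solver)
  open import Relation.Binary.PropositionalEquality
  open RationalLemmas
  open +-*-Solver using (solve; _:+_; _:*_; _:-_; :-_; _:=_; con)
  open Sums
  open Character

  private
    q*inv : ∀ {q} → 0ℚ < q → q * inv q ≡ 1ℚ
    q*inv 0<q = proj₁ (inv-pos 0<q)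

    0<1+ : ∀ {q} → 0ℚ ≤ q → 0ℚ < 1ℚ + q
    0<1+ {q} 0≤q = <-≤-trans 0<1 (≤-by 0≤q (solve 1 (λ q → q := (con 1ℚ :+ q) :- con 1ℚ) refl q))

    0<≥1 : ∀ {q} → 1ℚ ≤ q → 0ℚ < q
    0<≥1 = <-≤-trans 0<1

  rectangles-nonNeg : ∀ {h} m → 0ℚ ≤ h → 0ℚ ≤ rectangles h m
  rectangles-nonNeg zero    0≤h = ≤-refl
  rectangles-nonNeg {h} (suc m) 0≤h = +-nonNeg (rectangles-nonNeg m 0≤h)
    (*-nonNeg 0≤h (<⇒≤ (inv>0 (0<1+ {ι (suc m) * h} (*-nonNeg (0≤ι (suc m)) 0≤h)))))

  module _ {h k : ℚ} (0≤h : 0ℚ ≤ h) (h≤k : h ≤ k) where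
    private
      0≤k = ≤-trans 0≤h h≤k
      0<node : ∀ {g} m → 0ℚ ≤ g → 0ℚ < 1ℚ + ι m * g
      0<node {g} m 0≤g = 0<1+ {ι m * g} (*-nonNeg (0≤ι m) 0≤g)

      next : ∀ {g} m → 1ℚ + ι (suc m) * g ≡ 1ℚ + (1ℚ + ι m) * g
      next {g} m = cong (λ z → 1ℚ + z * g) (ι-suc m)

      node-mono : ∀ {g} m → 0ℚ ≤ g → 1ℚ + ι m * g ≤ 1ℚ + ι (suc m) * g
      node-mono {g} m 0≤g = ≤-by 0≤g (trans (solve 2 (λ g m → g := (con 1ℚ :+ (con 1ℚ :+ m) :* g)
          :- (con 1ℚ :+ m :* g)) refl g (ι m)) (cong (_- (1ℚ + ι m * g)) (sym (next m))))

      term : ∀ m → k * inv (1ℚ + ι m * k) - h * inv (1ℚ + ι m * h) ≡ (k - h) * (inv (1ℚ + ι m * k) *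
          inv (1ℚ + ι m * h))
      term m = trans (term-diff {1ℚ + ι m * k} {1ℚ + ι m * h} k h (0<node m 0≤k) (0<node m 0≤h))
          (cong (_* (inv (1ℚ + ι m * k) * inv (1ℚ + ι m * h)))
        (solve 3 (λ h k i → k :* (con 1ℚ :+ i :* h) :- h :* (con 1ℚ :+ i :* k) := k :- h) refl h k
            (ι m)))

      inv-≤ : ∀ m → inv (1ℚ + ι m * k) ≤ inv (1ℚ + ι m * h)
      inv-≤ m = inv-anti {1ℚ + ι m * h} {1ℚ + ι m * k} (0<node m 0≤h)
          (≤-by (*-nonNeg (0≤ι m) (diff-≤ h≤k)) (solve 3 (λ h k i → i :* (k :- h) := (con 1ℚ :+ i :* k)
          :- (con 1ℚ :+ i :* h)) refl h k (ι m)))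

    -- The i-th terms differ by (k - h)/((1 + ih)(1 + ik)). The majorant 1/((1 + (i-1)h)(1 + ih)) of
    -- the second factor telescopes to m/(1 + mh).
    rectangles-diff≤ : ∀ m → rectangles k m - rectangles h m ≤ (k - h) * (ι m * inv (1ℚ + ι m * h))
    rectangles-diff≤ zero = ≤-reflexive (solve 3 (λ h k c → con 0ℚ :- con 0ℚ := (k :- h)
        :* (con 0ℚ :* c)) refl h k (inv (1ℚ + ι 0 * h)))
    rectangles-diff≤ (suc m) = ≤-by (+-nonNeg (diff-≤ (rectangles-diff≤ m)) (*-nonNeg (diff-≤ h≤k)
        (+-nonNeg
        (*-nonNeg 0≤a (diff-≤ (inv-≤ (suc m))))
            (*-nonNeg 0≤a (diff-≤ (inv-anti {1ℚ + ι m * h} {1ℚ + ι (suc m) * h} (0<node m 0≤h)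
            (node-mono m 0≤h)))))))
      (begin
        ((k - h) * (ι m * c) - (rectangles k m - rectangles h m)) + (k - h) *
            (a * (a - b) + a * (c - a))
          ≡⟨ (solve 8 (λ h k i a b c R S → ((k :- h) :* (i :* c) :- (R :- S)) :+ (k :- h)
              :* (a :* (a :- b) :+ a :* (c :- a)) := (k :- h) :* (i :* c :+ a :* c)
              :- ((R :- S) :+ (k :- h) :* (b :* a))) refl h k (ι m) a b c (rectangles k m)
              (rectangles h m)) ⟩
        (k - h) * (ι m * c + a * c) - ((rectangles k m - rectangles h m) + (k - h) * (b * a))
          ≡⟨ cong₂ (λ s t → (k - h) * s - ((rectangles k m - rectangles h m) + t)) telescope
              (sym (term (suc m))) ⟩
        (k - h) * (ι (suc m) * a) - ((rectangles k m - rectangles h m) + (k * b - h * a))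
          ≡⟨ cong (λ z → (k - h) * (ι (suc m) * a) - z) (solve 4 (λ x y R S → (R :- S) :+ (x :- y) :=
              (R :+ x) :- (S :+ y)) refl (k * b) (h * a) (rectangles k m) (rectangles h m)) ⟩
        _ ∎)
      where
      open ≡-Reasoning
      a = inv (1ℚ + ι (suc m) * h)
      b = inv (1ℚ + ι (suc m) * k)
      c = inv (1ℚ + ι m * h)
      0≤a : 0ℚ ≤ a
      0≤a = <⇒≤ (inv>0 (0<node (suc m) 0≤h))
      telescope : ι m * c + a * c ≡ ι (suc m) * a
      telescope = begin
        ι m * c + a * c ≡⟨ (solve 3 (λ i a c → i :* c :+ a :* c := i :* c :* con 1ℚ :+ a :* c)
            refl (ι m) a c) ⟩
        ι m * c * 1ℚ + a * c ≡⟨ cong (λ z → ι m * c * z + a * c)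
            (sym (trans (cong (_* a) (sym (next m))) (q*inv (0<node (suc m) 0≤h)))) ⟩
        ι m * c * ((1ℚ + (1ℚ + ι m) * h) * a) + a * c
          ≡⟨ (solve 4 (λ i a c h → i :* c :* ((con 1ℚ :+ (con 1ℚ :+ i) :* h) :* a) :+ a :* c :=
              (con 1ℚ :+ i) :* a :* ((con 1ℚ :+ i :* h) :* c)) refl (ι m) a c h) ⟩
        (1ℚ + ι m) * a * ((1ℚ + ι m * h) * c) ≡⟨ cong ((1ℚ + ι m) * a *_) (q*inv (0<node m 0≤h)) ⟩
        (1ℚ + ι m) * a * 1ℚ ≡⟨ *-identityʳ ((1ℚ + ι m) * a) ⟩
        (1ℚ + ι m) * a ≡⟨ cong (_* a) (sym (ι-suc m)) ⟩
        ι (suc m) * a ∎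

    -- Mirror of the upper bound: the minorant 1/((1 + ik)(1 + (i+1)k)) telescopes to m/((1 + k)(1 +
    -- (m+1)k)).
    ≤rectangles-diff : ∀ m → (k - h) * (ι m * (inv (1ℚ + k) * inv (1ℚ + ι (suc m) * k))) ≤ rectangles k
        m - rectangles h m
    ≤rectangles-diff zero = ≤-reflexive (solve 3 (λ h k c → (k :- h) :* (con 0ℚ :* c) := con 0ℚ
        :- con 0ℚ) refl h k (inv (1ℚ + k) * inv (1ℚ + ι 1 * k)))
    ≤rectangles-diff (suc m) = ≤-by (+-nonNeg (diff-≤ (≤rectangles-diff m)) (*-nonNeg (diff-≤ h≤k)
        (+-nonNeg
        (*-nonNeg 0≤b (diff-≤ (inv-≤ (suc m))))
            (*-nonNeg 0≤b (diff-≤ (inv-anti {1ℚ + ι (suc m) * k} {1ℚ + ι (suc (suc m)) * k}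
            (0<node (suc m) 0≤k) (node-mono (suc m) 0≤k)))))))
      (begin
        ((rectangles k m - rectangles h m) - (k - h) * (ι m * (p * b))) + (k - h) *
            (b * (a - b) + b * (b - c))
          ≡⟨ (solve 9 (λ h k i a b c p R S → ((R :- S) :- (k :- h) :* (i :* (p :* b))) :+ (k :- h)
              :* (b :* (a :- b) :+ b :* (b :- c)) := ((R :- S) :+ (k :- h) :* (b :* a)) :- (k :- h)
              :* (i :* (p :* b) :+ b :* c)) refl h k (ι m) a b c p (rectangles k m) (rectangles h m)) ⟩
        ((rectangles k m - rectangles h m) + (k - h) * (b * a)) - (k - h) * (ι m * (p * b) + b * c)
          ≡⟨ cong₂ (λ s t → ((rectangles k m - rectangles h m) + t) - (k - h) * s) telescope
              (sym (term (suc m))) ⟩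
        ((rectangles k m - rectangles h m) + (k * b - h * a)) - (k - h) * (ι (suc m) * (p * c))
          ≡⟨ cong (_- (k - h) * (ι (suc m) * (p * c))) (solve 4 (λ x y R S → (R :- S) :+ (x :- y) :=
              (R :+ x) :- (S :+ y)) refl (k * b) (h * a) (rectangles k m) (rectangles h m)) ⟩
        _ ∎)
      where
      open ≡-Reasoning
      a = inv (1ℚ + ι (suc m) * h)
      b = inv (1ℚ + ι (suc m) * k)
      c = inv (1ℚ + ι (suc (suc m)) * k)
      p = inv (1ℚ + k)
      0≤b : 0ℚ ≤ b
      0≤b = <⇒≤ (inv>0 (0<node (suc m) 0≤k))
      telescope : ι m * (p * b) + b * c ≡ ι (suc m) * (p * c)
      telescope = begin
        ι m * (p * b) + b * c ≡⟨ (solve 4 (λ i b c p → i :* (p :* b) :+ b :* c := i :* (p :* b)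
            :* con 1ℚ :+ b :* c :* con 1ℚ) refl (ι m) b c p) ⟩
        ι m * (p * b) * 1ℚ + b * c * 1ℚ
          ≡⟨ cong₂ (λ s t → ι m * (p * b) * s + b * c * t)
               (sym (trans (cong (_* c) (trans (cong (λ z → 1ℚ + (1ℚ + z) * k) (sym (ι-suc m)))
                   (sym (next (suc m))))) (q*inv (0<node (suc (suc m)) 0≤k))))
               (sym (q*inv (0<1+ {k} 0≤k))) ⟩
        ι m * (p * b) * ((1ℚ + (1ℚ + (1ℚ + ι m)) * k) * c) + b * c * ((1ℚ + k) * p)
          ≡⟨ (solve 5 (λ i b c p k → i :* (p :* b) :* ((con 1ℚ :+ (con 1ℚ :+ (con 1ℚ :+ i)) :* k) :* c)
              :+ b :* c :* ((con 1ℚ :+ k) :* p) := (con 1ℚ :+ i) :* (p :* c)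
              :* ((con 1ℚ :+ (con 1ℚ :+ i) :* k) :* b)) refl (ι m) b c p k) ⟩
        (1ℚ + ι m) * (p * c) * ((1ℚ + (1ℚ + ι m) * k) * b)
          ≡⟨ cong ((1ℚ + ι m) * (p * c) *_) (trans (cong (_* b) (sym (next m)))
              (q*inv (0<node (suc m) 0≤k))) ⟩
        (1ℚ + ι m) * (p * c) * 1ℚ ≡⟨ *-identityʳ ((1ℚ + ι m) * (p * c)) ⟩
        (1ℚ + ι m) * (p * c) ≡⟨ cong (_* (p * c)) (sym (ι-suc m)) ⟩
        ι (suc m) * (p * c) ∎

  riemann-1 : ∀ n → riemann n 1ℚ ≡ 0ℚ
  riemann-1 n = trans (cong (λ h → rectangles h (2 ℕ.^ n)) (*-zeroˡ (½^ n))) (go (2 ℕ.^ n))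
    where
    go : ∀ m → rectangles 0ℚ m ≡ 0ℚ
    go zero    = refl
    go (suc m) = trans (cong₂ _+_ (go m) (*-zeroˡ (inv (1ℚ + ι (suc m) * 0ℚ)))) refl

  module _ (n : ℕ) where
    private
      N = 2 ℕ.^ n
      e = ½^ n
      R = riemann n
      0≤e = 0≤½^ n
      Ne : ι N * e ≡ 1ℚ
      Ne = ι2^*½^ n

      last-node : ∀ q → 1ℚ + ι N * ((q - 1ℚ) * e) ≡ q
      last-node q = trans (solve 3 (λ q N e → con 1ℚ :+ N :* ((q :- con 1ℚ) :* e) := con 1ℚ
          :+ (q :- con 1ℚ) :* (N :* e)) refl q (ι N) e)
        (trans (cong (λ z → 1ℚ + (q - 1ℚ) * z) Ne) (solve 1 (λ q → con 1ℚ :+ (q :- con 1ℚ) :* con 1ℚ :=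
            q) refl q))

      scale : ∀ s t c → ((t - 1ℚ) * e - (s - 1ℚ) * e) * (ι N * c) ≡ (t - s) * c
      scale s t c = trans (solve 5 (λ s t c N e → ((t :- con 1ℚ) :* e :- (s :- con 1ℚ) :* e)
          :* (N :* c) := (t :- s) :* c :* (N :* e)) refl s t c (ι N) e)
        (trans (cong ((t - s) * c *_) Ne) (*-identityʳ ((t - s) * c)))

      mesh-nonNeg : ∀ {q} → 1ℚ ≤ q → 0ℚ ≤ (q - 1ℚ) * e
      mesh-nonNeg 1≤q = *-nonNeg (diff-≤ 1≤q) 0≤e

      mesh-mono : ∀ {s t} → s ≤ t → (s - 1ℚ) * e ≤ (t - 1ℚ) * e
      mesh-mono {s} {t} s≤t = ≤-by (*-nonNeg (diff-≤ s≤t) 0≤e)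
          (solve 3 (λ s t e → (t :- s) :* e := (t :- con 1ℚ) :* e :- (s :- con 1ℚ) :* e) refl s t e)

    -- Discrete form of log (t/s) ≤ (t - s)/s, with no error term because the last node of the
    -- partition for s is s itself.
    riemann-diff≤ : ∀ {s t} → 1ℚ ≤ s → s ≤ t → R t - R s ≤ (t - s) * inv s
    riemann-diff≤ {s} {t} 1≤s s≤t = ≤-trans (rectangles-diff≤ (mesh-nonNeg 1≤s) (mesh-mono s≤t) N)
      (≤-reflexive (trans (scale s t (inv (1ℚ + ι N * ((s - 1ℚ) * e)))) (cong (λ z → (t - s) * inv z)
          (last-node s))))

    -- Discrete form of log (t/s) ≥ (t - s)/t. The telescoped bound has 1/((1 + h)(t + h)), h the
    -- mesh, in place of 1/t; as h = (t - 1) 2⁻ⁿ, the loss is at most 2 · 2⁻ⁿ uniformly in t.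
    ≤riemann-diff : ∀ {s t} → 1ℚ ≤ s → s ≤ t → (t - s) * (inv t - ι 2 * e) ≤ R t - R s
    ≤riemann-diff {s} {t} 1≤s s≤t = ≤-trans (*-monoˡ-≤-nonNeg (t - s) {{nonNegative (diff-≤ s≤t)}} core)
      (≤-trans (≤-reflexive (trans (cong (λ z → (t - s) * (p * inv z)) (sym node≡))
          (sym (scale s t (p * inv (1ℚ + ι (suc N) * h))))))
        (≤rectangles-diff (mesh-nonNeg 1≤s) (mesh-mono s≤t) N))
      where
      1≤t = ≤-trans 1≤s s≤t
      h = (t - 1ℚ) * e
      0≤h = mesh-nonNeg 1≤t
      p = inv (1ℚ + h)
      q = inv (t + h)
      r = inv t
      node≡ : 1ℚ + ι (suc N) * h ≡ t + h
      node≡ = trans (cong (λ z → 1ℚ + z * h) (ι-suc N))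
          (trans (solve 2 (λ N h → con 1ℚ :+ (con 1ℚ :+ N) :* h := (con 1ℚ :+ N :* h) :+ h) refl (ι N)
          h) (cong (_+ h) (last-node t)))
      0<t+h : 0ℚ < t + h
      0<t+h = 0<≥1 (≤-by (+-nonNeg (diff-≤ 1≤t) 0≤h) (solve 2 (λ t h → (t :- con 1ℚ) :+ h := (t :+ h)
          :- con 1ℚ) refl t h))
      0≤t = ≤-trans 0≤1 1≤t
      core : inv t - ι 2 * e ≤ p * q
      core = ≤-by (*-nonNeg (*-nonNeg 0≤e bracket) (*-nonNeg (<⇒≤ (inv>0 (0<1+ {h} 0≤h)))
          (*-nonNeg (<⇒≤ (inv>0 0<t+h)) (<⇒≤ (inv>0 (0<≥1 1≤t))))))
        (begin
          e * (t * ((t - 1ℚ) + h + ι 2 * (h * t) + ι 2 * (h * h)) + (1ℚ + t + h)) * (p * (q * r))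
            ≡⟨ (solve 4 (λ e t h P → e :* (t :* ((t :- con 1ℚ) :+ h :+ con (ι 2) :* (h :* t)
                :+ con (ι 2) :* (h :* h)) :+ (con 1ℚ :+ t :+ h)) :* P :=
                (con (ι 2) :* e :* (t :* ((con 1ℚ :+ h) :* (t :+ h))) :- ((t :- con 1ℚ) :* e)
                :* (con 1ℚ :+ t :+ h)) :* P) refl e t h (p * (q * r))) ⟩
          (ι 2 * e * (t * ((1ℚ + h) * (t + h))) - h * (1ℚ + t + h)) * (p * (q * r))
            ≡⟨ (solve 6 (λ e t h p q r → (con (ι 2) :* e :* (t :* ((con 1ℚ :+ h) :* (t :+ h))) :- h
                :* (con 1ℚ :+ t :+ h)) :* (p :* (q :* r)) := con (ι 2) :* e :* ((con 1ℚ :+ h) :* p)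
                :* ((t :+ h) :* q) :* (t :* r) :- (r :* ((con 1ℚ :+ h) :* p) :* ((t :+ h) :* q) :- p
                :* q :* (t :* r))) refl e t h p q r) ⟩
          ι 2 * e * ((1ℚ + h) * p) * ((t + h) * q) * (t * r) - (r * ((1ℚ + h) * p) * ((t + h) * q) - p
              * q * (t * r))
            ≡⟨ cong₂ (λ x y → ι 2 * e * x * y * (t * r) - (r * x * y - p * q * (t * r)))
                (q*inv (0<1+ {h} 0≤h)) (q*inv 0<t+h) ⟩
          ι 2 * e * 1ℚ * 1ℚ * (t * r) - (r * 1ℚ * 1ℚ - p * q * (t * r))
            ≡⟨ cong (λ x → ι 2 * e * 1ℚ * 1ℚ * x - (r * 1ℚ * 1ℚ - p * q * x)) (q*inv (0<≥1 1≤t)) ⟩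
          ι 2 * e * 1ℚ * 1ℚ * 1ℚ - (r * 1ℚ * 1ℚ - p * q * 1ℚ)
            ≡⟨ (solve 4 (λ e p q r → con (ι 2) :* e :* con 1ℚ :* con 1ℚ :* con 1ℚ
                :- (r :* con 1ℚ :* con 1ℚ :- p :* q :* con 1ℚ) := p :* q :- (r :- con (ι 2) :* e))
                refl e p q r) ⟩
          p * q - (inv t - ι 2 * e) ∎)
        where
        open ≡-Reasoning
        bracket : 0ℚ ≤ t * ((t - 1ℚ) + h + ι 2 * (h * t) + ι 2 * (h * h)) + (1ℚ + t + h)
        bracket = +-nonNeg (*-nonNeg 0≤t (+-nonNeg (+-nonNeg (+-nonNeg (diff-≤ 1≤t) 0≤h)
            (*-nonNeg (0≤ι 2) (*-nonNeg 0≤h 0≤t))) (*-nonNeg (0≤ι 2) (*-nonNeg 0≤h 0≤h))))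
          (+-nonNeg (+-nonNeg 0≤1 0≤t) 0≤h)

    riemann-nonNeg : ∀ {q} → 1ℚ ≤ q → 0ℚ ≤ R q
    riemann-nonNeg 1≤q = rectangles-nonNeg N (mesh-nonNeg 1≤q)

    riemann-mono : ∀ {s t} → 1ℚ ≤ s → s ≤ t → R s ≤ R t
    riemann-mono {s} {t} 1≤s s≤t = ≤-diff
        (≤-trans (*-nonNeg (*-nonNeg (diff-≤ (mesh-mono s≤t)) (0≤ι N))
        (*-nonNeg (<⇒≤ (inv>0 (0<1+ {h} 0≤h)))
        (<⇒≤ (inv>0 (0<1+ {ι (suc N) * h} (*-nonNeg (0≤ι (suc N)) 0≤h))))))
        (≤-trans (≤-reflexive (*-assoc (h - (s - 1ℚ) * e) (ι N)
            (inv (1ℚ + h) * inv (1ℚ + ι (suc N) * h)))) (≤rectangles-diff (mesh-nonNeg 1≤s)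
            (mesh-mono s≤t) N)))
      where
      h = (t - 1ℚ) * e
      0≤h = mesh-nonNeg (≤-trans 1≤s s≤t)

    -- The partition 1 + j h of [1, b], scaled by a, partitions [a, a b] with the same
    -- Riemann sum.
    module _ {a b : ℚ} (1≤a : 1ℚ ≤ a) (1≤b : 1ℚ ≤ b) where
      private
        h = (b - 1ℚ) * e
        0≤h = mesh-nonNeg 1≤b
        0≤a = ≤-trans 0≤1 1≤a
        v : ℕ → ℚ
        v j = 1ℚ + ι j * h
        0<v : ∀ j → 0ℚ < v j
        0<v j = 0<1+ {ι j * h} (*-nonNeg (0≤ι j) 0≤h)
        v-suc : ∀ j → v (suc j) ≡ v j + h
        v-suc j = trans (cong (λ z → 1ℚ + z * h) (ι-suc j)) (solve 2 (λ j h → con 1ℚ :+ (con 1ℚ :+ j)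
            :* h := (con 1ℚ :+ j :* h) :+ h) refl (ι j) h)
        1≤av : ∀ j → 1ℚ ≤ a * v j
        1≤av j = ≤-by (+-nonNeg (diff-≤ 1≤a) (*-nonNeg 0≤a (*-nonNeg (0≤ι j) 0≤h)))
            (solve 2 (λ a y → (a :- con 1ℚ) :+ a :* y := a :* (con 1ℚ :+ y) :- con 1ℚ) refl a (ι j * h))
        av-mono : ∀ j → a * v j ≤ a * v (suc j)
        av-mono j = ≤-by (*-nonNeg 0≤a 0≤h)
            (trans (solve 3 (λ a v h → a :* h := a :* (v :+ h) :- a :* v) refl a (v j) h)
            (cong (λ z → a * z - a * v j) (sym (v-suc j))))
        av-diff : ∀ j → a * v (suc j) - a * v j ≡ a * h
        av-diff j = trans (cong (λ z → a * z - a * v j) (v-suc j))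
            (solve 3 (λ a v h → a :* (v :+ h) :- a :* v := a :* h) refl a (v j) h)
        a-inv : ∀ j → a * h * inv (a * v j) ≡ h * inv (v j)
        a-inv j = begin
          a * h * inv (a * v j) ≡⟨ sym (*-identityʳ (a * h * inv (a * v j))) ⟩
          a * h * inv (a * v j) * 1ℚ ≡⟨ cong (a * h * inv (a * v j) *_) (sym (q*inv (0<v j))) ⟩
          a * h * inv (a * v j) * (v j * inv (v j)) ≡⟨ (solve 5 (λ a h v x y → a :* h :* x :* (v :* y)
              := h :* y :* ((a :* v) :* x)) refl a h (v j) (inv (a * v j)) (inv (v j))) ⟩
          h * inv (v j) * ((a * v j) * inv (a * v j)) ≡⟨ cong (h * inv (v j) *_)
              (q*inv (0<≥1 (1≤av j))) ⟩
          h * inv (v j) * 1ℚ ≡⟨ *-identityʳ (h * inv (v j)) ⟩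
          h * inv (v j) ∎
          where open ≡-Reasoning

        -- `riemann-diff≤` produces left endpoints where `rectangles` uses right ones; h (1 - 1/v
        -- j), the first left term minus the last right one, makes up the difference.
        upper : ∀ j → R (a * v j) - R a ≤ rectangles h j + h * (1ℚ - inv (v j))
        upper zero = ≤-reflexive (trans (cong (λ z → R z - R a)
            (trans (cong (λ z → a * (1ℚ + z)) (*-zeroˡ h)) (trans (cong (a *_) (+-identityʳ 1ℚ))
            (*-identityʳ a))))
          (trans (+-inverseʳ (R a)) (trans (solve 1 (λ h → con 0ℚ := con 0ℚ :+ h :* (con 1ℚ :- con 1ℚ))
              refl h) (cong (λ z → 0ℚ + h * (1ℚ - inv (1ℚ + z))) (sym (*-zeroˡ h))))))
        upper (suc j) = ≤-by (+-nonNeg (diff-≤ (upper j))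
            (diff-≤ (≤-trans (riemann-diff≤ (1≤av j) (av-mono j))
            (≤-reflexive (trans (cong (_* inv (a * v j)) (av-diff j)) (a-inv j))))))
          (solve 7 (λ h A C D x y r → ((r :+ h :* (con 1ℚ :- x)) :- (C :- D)) :+ (h :* x :- (A :- C))
              := ((r :+ h :* y) :+ h :* (con 1ℚ :- y)) :- (A :- D)) refl h (R (a * v (suc j)))
              (R (a * v j)) (R a) (inv (v j)) (inv (v (suc j))) (rectangles h j))

        lower : ∀ j → rectangles h j - ι j * (a * h * (ι 2 * e)) ≤ R (a * v j) - R a
        lower zero = ≤-reflexive (trans (solve 1 (λ x → con 0ℚ :- con 0ℚ :* x := con 0ℚ)
            refl (a * h * (ι 2 * e))) (sym (trans (cong (λ z → R z - R a)
          (trans (cong (λ z → a * (1ℚ + z)) (*-zeroˡ h)) (trans (cong (a *_) (+-identityʳ 1ℚ))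
              (*-identityʳ a)))) (+-inverseʳ (R a)))))
        lower (suc j) = ≤-by (+-nonNeg (diff-≤ (lower j))
            (diff-≤ (≤-trans (≤-reflexive step) (≤riemann-diff (1≤av j) (av-mono j)))))
          (trans (solve 8 (λ h A C D y r j E → ((C :- D) :- (r :- j :* E))
              :+ ((A :- C) :- (h :* y :- E)) := (A :- D) :- ((r :+ h :* y) :- (con 1ℚ :+ j) :* E))
              refl h (R (a * v (suc j))) (R (a * v j)) (R a) (inv (v (suc j))) (rectangles h j) (ι j)
              (a * h * (ι 2 * e)))
            (cong (λ z → (R (a * v (suc j)) - R a) - ((rectangles h j + h * inv (v (suc j))) - z *
                (a * h * (ι 2 * e)))) (sym (ι-suc j))))
          where
          step : h * inv (v (suc j)) - a * h * (ι 2 * e) ≡ (a * v (suc j) - a * v j) *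
              (inv (a * v (suc j)) - ι 2 * e)
          step = trans (cong (_- a * h * (ι 2 * e)) (sym (a-inv (suc j)))) (trans
            (solve 3 (λ x i f → x :* i :- x :* f := x :* (i :- f)) refl (a * h) (inv (a * v (suc j)))
                (ι 2 * e)) (cong (_* (inv (a * v (suc j)) - ι 2 * e)) (sym (av-diff j))))

      riemann-*≤ : R (a * b) - (R a + R b) ≤ ι 2 * (a * b) * e
      riemann-*≤ = ≤-by (+-nonNeg (+-nonNeg (diff-≤ (upper N)) (*-nonNeg 0≤h (<⇒≤ (inv>0 (0<v N)))))
          (*-nonNeg (+-nonNeg (+-nonNeg 0≤1 (*-nonNeg (diff-≤ 1≤a) 0≤b)) (*-nonNeg 0≤a 0≤b)) 0≤e))
        (trans (solve 7 (λ a b e A D x r → (((r :+ ((b :- con 1ℚ) :* e) :* (con 1ℚ :- x)) :- (A :- D))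
            :+ ((b :- con 1ℚ) :* e) :* x) :+ ((con 1ℚ :+ (a :- con 1ℚ) :* b) :+ a :* b) :* e :=
            con (ι 2) :* (a :* b) :* e :- (A :- (D :+ r))) refl a b e (R (a * v N)) (R a) (inv (v N))
            (R b))
          (cong (λ z → ι 2 * (a * b) * e - (R (a * z) - (R a + R b))) (last-node b)))
        where 0≤b = ≤-trans 0≤1 1≤b

      ≤riemann-* : (R a + R b) - R (a * b) ≤ ι 2 * (a * b) * e
      ≤riemann-* = ≤-by (+-nonNeg (diff-≤ (lower N)) (*-nonNeg (*-nonNeg (0≤ι 2) 0≤a) 0≤e))
        (trans (cong (_+ ι 2 * a * e) (cong₂ (λ s t → (R (a * s) - R a) - (R b - t)) (last-node b)
            mesh-sum))
          (solve 6 (λ a b e A D r → ((A :- D) :- (r :- (con (ι 2) :* a :* e :* (b :- con 1ℚ))))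
              :+ con (ι 2) :* a :* e := con (ι 2) :* (a :* b) :* e :- ((D :+ r) :- A)) refl a b e
              (R (a * b)) (R a) (R b)))
        where
        mesh-sum : ι N * (a * h * (ι 2 * e)) ≡ ι 2 * a * e * (b - 1ℚ)
        mesh-sum = trans (solve 4 (λ N a b e → N :* (a :* ((b :- con 1ℚ) :* e) :* (con (ι 2) :* e)) :=
            (con (ι 2) :* a :* e :* (b :- con 1ℚ)) :* (N :* e)) refl (ι N) a b e)
          (trans (cong (ι 2 * a * e * (b - 1ℚ) *_) Ne) (*-identityʳ (ι 2 * a * e * (b - 1ℚ))))

-- Exactly additive approximations of the logarithm on ℕ.

module LogApprox where
  open import Data.List.Base using (List; []; _∷_; _++_; length)
  open import Data.List.Relation.Binary.Permutation.Propositional as ↭ using (_↭_)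
  open import Data.List.Relation.Unary.All using (All; []; _∷_)
  import Data.List.Relation.Unary.All.Properties as All
  open import Data.Nat.Base as ℕ using (ℕ; zero; suc; z≤n; s≤s)
  open import Data.Nat.ListAction using (product)
  open import Data.Nat.ListAction.Properties using (product-++)
  open import Data.Nat.Primality using (Prime; productOfPrimes≥1; prime⇒nonZero)
  open import Data.Nat.Primality.Factorisation using (PrimeFactorisation; factorise;
      factorisationUnique; module PrimeFactorisation)
  import Data.Nat.Properties as ℕP
  open import Data.Product.Base using (_×_; _,_)
  open import Data.Rational.Base hiding (_÷_)
  open import Data.Rational.Properties
  open import Data.Rational.Solver using (module +-*-Solver)
  open import Relation.Binary.PropositionalEquality
  open RationalLemmas
  open +-*-Solver using (solve; _:+_; _:*_; _:-_; :-_; _:=_; con)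
  open Sums
  open Character
  open Mangoldt
  open Mertens
  open Riemann

  1≤ι : ∀ {m} → 1 ℕ.≤ m → 1ℚ ≤ ι m
  1≤ι {m} 1≤m = ι-mono {1} {m} 1≤m

  module Approx (n : ℕ) where
    private
      R : ℕ → ℚ
      R m = riemann n (ι m)
      e = ½^ n
      0≤e = 0≤½^ n

    ∑R : List ℕ → ℚ
    ∑R []       = 0ℚ
    ∑R (p ∷ ps) = R p + ∑R ps

    ∑R-++ : ∀ ps qs → ∑R (ps ++ qs) ≡ ∑R ps + ∑R qs
    ∑R-++ []       qs = sym (+-identityˡ (∑R qs))
    ∑R-++ (p ∷ ps) qs = trans (cong (λ z → R p + z) (∑R-++ ps qs)) (sym (+-assoc (R p) (∑R ps) (∑R qs)))

    ∑R-↭ : ∀ {ps qs} → ps ↭ qs → ∑R ps ≡ ∑R qs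
    ∑R-↭ ↭.refl = refl
    ∑R-↭ (↭.prep p σ) = cong (λ z → R p + z) (∑R-↭ σ)
    ∑R-↭ {_ ∷ _ ∷ ps} {_ ∷ _ ∷ qs} (↭.swap p q σ) = trans (cong (λ z → R p + (R q + z)) (∑R-↭ σ))
      (solve 3 (λ a b c → a :+ (b :+ c) := b :+ (a :+ c)) refl (R p) (R q) (∑R qs))
    ∑R-↭ (↭.trans σ τ) = trans (∑R-↭ σ) (∑R-↭ τ)

    -- Totally additive, and (unlike m ↦ riemann n m) exactly so.
    logℕ : ℕ → ℚ
    logℕ zero      = 0ℚ
    logℕ m@(suc _) = ∑R (PrimeFactorisation.factors (factorise m))

    logℕ-* : ∀ a b → 1 ℕ.≤ a → 1 ℕ.≤ b → logℕ (a ℕ.* b) ≡ logℕ a + logℕ b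
    logℕ-* a@(suc _) b@(suc _) _ _ = trans (∑R-↭ (factorisationUnique (factorise (a ℕ.* b)) both))
        (∑R-++ (factors fa) (factors fb))
      where
      open PrimeFactorisation
      fa = factorise a
      fb = factorise b
      both : PrimeFactorisation (a ℕ.* b)
      both = record
        { factors = factors fa ++ factors fb
        ; isFactorisation = trans (cong₂ ℕ._*_ (isFactorisation fa) (isFactorisation fb))
            (sym (product-++ (factors fa) (factors fb)))
        ; factorsPrime = All.++⁺ (factorsPrime fa) (factorsPrime fb)
        }

    ∑R-nonNeg : ∀ {ps} → All Prime ps → 0ℚ ≤ ∑R ps
    ∑R-nonNeg [] = ≤-refl
    ∑R-nonNeg {p ∷ _} (pp ∷ prs) = +-nonNeg (riemann-nonNeg n (1≤ι (ℕP.<⇒≤ (prime≥2 pp))))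
        (∑R-nonNeg prs)

    logℕ-nonNeg : ∀ m → 0ℚ ≤ logℕ m
    logℕ-nonNeg zero      = ≤-refl
    logℕ-nonNeg m@(suc _) = ∑R-nonNeg (PrimeFactorisation.factorsPrime (factorise m))

    -- Each factor split off uses approximate additivity once, at a cost of at most 2 B 2⁻ⁿ since
    -- the partial products do not exceed B.
    ∑R-close : ∀ B ps → All Prime ps → product ps ℕ.≤ B →
      ∣ ∑R ps - R (product ps) ∣ ≤ ι (length ps) * (ι 2 * ι B * e)
    ∑R-close B [] [] _ = ≤-trans (≤-reflexive (cong (λ z → ∣ 0ℚ - z ∣) (riemann-1 n)))
        (≤-reflexive (sym (*-zeroˡ (ι 2 * ι B * e))))
    ∑R-close B (p ∷ ps) (pp ∷ prs) pm≤B = ∣∣-cong-≤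
        (solve 4 (λ a b c d → (a :+ b) :- d := (b :- c) :+ ((a :+ c) :- d)) refl (R p) (∑R ps) (R m)
            (R (p ℕ.* m)))
        (≤-trans (triangle {∑R ps - R m} {(R p + R m) - R (p ℕ.* m)} (∑R-close B ps prs m≤B) close)
          (≤-reflexive (trans (solve 2 (λ l E → l :* E :+ E := (con 1ℚ :+ l) :* E) refl (ι (length ps))
              (ι 2 * ι B * e)) (cong (_* (ι 2 * ι B * e)) (sym (ι-suc (length ps)))))))
      where
      m = product ps
      1≤p = ℕP.<⇒≤ (prime≥2 pp)
      1≤m : 1 ℕ.≤ m
      1≤m = productOfPrimes≥1 prs
      m≤B : m ℕ.≤ B
      m≤B = ℕP.≤-trans (ℕP.m≤n*m m p {{prime⇒nonZero pp}}) pm≤B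
      bound : ι 2 * (ι p * ι m) * e ≤ ι 2 * ι B * e
      bound = *-monoʳ-≤-nonNeg e {{nonNegative 0≤e}} (*-monoˡ-≤-nonNeg (ι 2)
          (≤-trans (≤-reflexive (sym (ι-* p m))) (ι-mono pm≤B)))
      ιpm : riemann n (ι p * ι m) ≡ R (p ℕ.* m)
      ιpm = cong (riemann n) (sym (ι-* p m))
      close : ∣ (R p + R m) - R (p ℕ.* m) ∣ ≤ ι 2 * ι B * e
      close = ∣∣-≤ ((R p + R m) - R (p ℕ.* m))
        (≤-trans (≤-reflexive (cong (λ z → (R p + R m) - z) (sym ιpm)))
            (≤-trans (≤riemann-* n (1≤ι 1≤p) (1≤ι 1≤m)) bound))
        (≤-trans (≤-reflexive (trans (solve 3 (λ a b c → :- ((a :+ b) :- c) := c :- (a :+ b))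
            refl (R p) (R m) (R (p ℕ.* m))) (cong (_- (R p + R m)) (sym ιpm))))
          (≤-trans (riemann-*≤ n (1≤ι 1≤p) (1≤ι 1≤m)) bound))

    length<product : ∀ {ps} → All Prime ps → suc (length ps) ℕ.≤ product ps
    length<product [] = ℕP.≤-refl
    length<product {p ∷ ps} (pp ∷ prs) = ℕP.≤-trans (ℕP.+-mono-≤ (productOfPrimes≥1 prs)
        (length<product prs))
      (ℕP.≤-trans (ℕP.≤-reflexive (cong (λ z → product ps ℕ.+ z) (sym (ℕP.+-identityʳ (product ps)))))
          (ℕP.*-monoˡ-≤ (product ps) (prime≥2 pp)))

    -- A product of primes exceeds the number of its factors, so at most B errors accumulate.
    logℕ-close : ∀ {B m} → 1 ℕ.≤ m → m ℕ.≤ B → ∣ logℕ m - R m ∣ ≤ ι 2 * (ι B * ι B) * e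
    logℕ-close {B} {m@(suc _)} _ m≤B = ≤-trans
      (subst (λ z → ∣ ∑R factors - R z ∣ ≤ ι (length factors) * (ι 2 * ι B * e)) (sym isFactorisation)
        (∑R-close B factors factorsPrime (subst (ℕ._≤ B) isFactorisation m≤B)))
      (≤-trans (*-monoʳ-≤-nonNeg (ι 2 * ι B * e)
          {{nonNegative (*-nonNeg (*-nonNeg (0≤ι 2) (0≤ι B)) 0≤e)}}
          (ι-mono (ℕP.≤-trans (ℕP.<⇒≤ (length<product factorsPrime))
              (ℕP.≤-trans (ℕP.≤-reflexive (sym isFactorisation)) m≤B))))
        (≤-reflexive (solve 2 (λ b e → b :* (con (ι 2) :* b :* e) := con (ι 2) :* (b :* b) :* e)
            refl (ι B) e)))
      where open PrimeFactorisation (factorise m)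

    logℕ-2 : ½ - ι 2 * e ≤ logℕ 2
    logℕ-2 = ≤-trans (≤-reflexive (solve 1 (λ e → con ½ :- con (ι 2) :* e := con 1ℚ
        :* (con ½ :- con (ι 2) :* e)) refl e))
        (≤-trans (≤riemann-diff n {1ℚ} {ι 2} ≤-refl (1≤ι {2} (s≤s z≤n)))
      (≤-reflexive (trans (cong (λ z → R 2 - z) (riemann-1 n))
          (solve 1 (λ r → r :- con 0ℚ := r :+ con 0ℚ) refl (R 2)))))

    -- Consecutive logarithms up to B may be only about 1/B apart, while values of `logℕ` carry
    -- errors of order B² 2⁻ⁿ. Monotonicity therefore needs B³ 2⁻ⁿ to be small.
    module _ {B : ℕ} (1≤B : 1 ℕ.≤ B) (fine : ι 8 * (ι B * ι B * ι B) * e ≤ 1ℚ) where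
      private
        b = ι B
        1≤b = 1≤ι 1≤B
        0≤b = 0≤ι B
        δ = ι 2 * (b * b) * e
        0≤bb = *-nonNeg 0≤b 0≤b
        0≤δ = *-nonNeg (*-nonNeg (0≤ι 2) 0≤bb) 0≤e
        lower : ∀ {m} → 1 ℕ.≤ m → m ℕ.≤ B → R m - δ ≤ logℕ m
        lower {m} 1≤m m≤B = ≤-by (diff-≤ (≤-trans (≤-trans (p≤∣p∣ (- (logℕ m - R m)))
            (≤-reflexive (∣-p∣≡∣p∣ (logℕ m - R m)))) (logℕ-close 1≤m m≤B)))
            (solve 3 (λ d l r → d :- (:- (l :- r)) := l :- (r :- d)) refl δ (logℕ m) (R m))
        upper : ∀ {m} → 1 ℕ.≤ m → m ℕ.≤ B → logℕ m ≤ R m + δ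
        upper {m} 1≤m m≤B = ≤-by (diff-≤ (≤-trans (p≤∣p∣ (logℕ m - R m)) (logℕ-close 1≤m m≤B)))
            (solve 3 (λ d l r → d :- (l :- r) := (r :+ d) :- l) refl δ (logℕ m) (R m))

        bδ≤½ : b * δ ≤ ½
        bδ≤½ = ≤-by (+-nonNeg (*-nonNeg 0≤½ (diff-≤ fine))
            (*-nonNeg (*-nonNeg (0≤ι 2) (*-nonNeg 0≤bb 0≤b)) 0≤e))
          (solve 2 (λ b e → con ½ :* (con 1ℚ :- con (ι 8) :* (b :* b :* b) :* e) :+ con (ι 2)
              :* (b :* b :* b) :* e := con ½ :- b :* (con (ι 2) :* (b :* b) :* e)) refl b e)

      logℕ-bounds : ∀ {m} → 1 ℕ.≤ m → m ℕ.≤ B → (R m - 1ℚ ≤ logℕ m) × (logℕ m ≤ R m + 1ℚ)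
      logℕ-bounds {m} 1≤m m≤B =
          ≤-trans (≤-by (diff-≤ δ≤1) (solve 2 (λ r d → con 1ℚ :- d := (r :- d) :- (r :- con 1ℚ))
              refl (R m) δ)) (lower 1≤m m≤B)
        , ≤-trans (upper 1≤m m≤B) (+-monoʳ-≤ (R m) δ≤1)
        where
        δ≤1 : δ ≤ 1ℚ
        δ≤1 = ≤-by (+-nonNeg (+-nonNeg (diff-≤ bδ≤½) (*-nonNeg (diff-≤ 1≤b) 0≤δ)) 0≤½)
            (solve 2 (λ b d → (con ½ :- b :* d) :+ (b :- con 1ℚ) :* d :+ con ½ := con 1ℚ :- d) refl b δ)

      logℕ-logLike : LogLike B logℕ
      logℕ-logLike = record
        { ℓ-*      = logℕ-*
        ; ℓ-nonNeg = logℕ-nonNeg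
        ; ℓ-suc    = increasing
        ; ℓ-step   = step
        }
        where
        Δ≡1 : ∀ m → ι (suc m) - ι m ≡ 1ℚ
        Δ≡1 m = trans (cong (_- ι m) (ι-suc m)) (solve 1 (λ m → (con 1ℚ :+ m) :- m := con 1ℚ)
            refl (ι m))
        -- The constant 2 is 1 from m · (1/m) plus at most 1 from the two errors, 2 m δ ≤ 2 B δ ≤ 1.
        step : ∀ m → 1 ℕ.≤ m → m ℕ.< B → ι m * (logℕ (suc m) - logℕ m) ≤ ι 2
        step m 1≤m m<B = ≤-trans (*-monoˡ-≤-nonNeg (ι m) {{nonNegative (0≤ι m)}} (≤-trans
              (≤-by (+-nonNeg (diff-≤ (upper (s≤s z≤n) m<B)) (diff-≤ (lower 1≤m (ℕP.<⇒≤ m<B))))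
                (solve 5 (λ l k r s d → ((s :+ d) :- k) :+ (l :- (r :- d)) := ((s :- r) :+ con (ι 2)
                    :* d) :- (k :- l)) refl (logℕ m) (logℕ (suc m)) (R m) (R (suc m)) δ))
              (+-monoˡ-≤ (ι 2 * δ) (riemann-diff≤ n (1≤ι 1≤m) (ι-mono (ℕP.n≤1+n m))))))
            (≤-trans (≤-reflexive (trans (cong (λ z → ι m * (z * inv (ι m) + ι 2 * δ)) (Δ≡1 m))
                (trans (solve 3 (λ m i d → m :* (con 1ℚ :* i :+ con (ι 2) :* d) := m :* i :+ con (ι 2)
                    :* (m :* d)) refl (ι m) (inv (ι m)) δ) (cong (_+ ι 2 * (ι m * δ)) (ι*inv m 1≤m)))))
              (≤-by (*-nonNeg (0≤ι 2) (+-nonNeg (diff-≤ bδ≤½) (*-nonNeg (diff-≤ (ι-mono (ℕP.<⇒≤ m<B)))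
                  0≤δ)))
                (solve 3 (λ b m d → con (ι 2) :* ((con ½ :- b :* d) :+ (b :- m) :* d) := con (ι 2)
                    :- (con 1ℚ :+ con (ι 2) :* (m :* d))) refl b (ι m) δ)))
        increasing : ∀ m → 1 ℕ.≤ m → m ℕ.< B → logℕ m ≤ logℕ (suc m)
        increasing m 1≤m m<B = ≤-by (+-nonNeg (+-nonNeg (+-nonNeg (diff-≤ (lower (s≤s z≤n) m<B))
            (diff-≤ (upper 1≤m (ℕP.<⇒≤ m<B)))) (diff-≤ diff)) room)
            (solve 7 (λ l k r s d i e → (k :- (s :- d)) :+ ((r :+ d) :- l)
                :+ ((s :- r) :- (i :- con (ι 2) :* e)) :+ (i :- (con (ι 2) :* e :+ con (ι 2) :* d)) :=
                k :- l) refl (logℕ m) (logℕ (suc m)) (R m) (R (suc m)) δ (inv b) e)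
          where
          diff : inv b - ι 2 * e ≤ R (suc m) - R m
          diff = ≤-trans (+-monoˡ-≤ (- (ι 2 * e)) (inv-ι-anti (suc m) B (s≤s z≤n) m<B))
            (≤-trans (≤-reflexive (trans (sym (*-identityˡ (inv (ι (suc m)) - ι 2 * e)))
                (cong (_* (inv (ι (suc m)) - ι 2 * e)) (sym (Δ≡1 m)))))
              (≤riemann-diff n (1≤ι 1≤m) (ι-mono (ℕP.n≤1+n m))))
          room : 0ℚ ≤ inv b - (ι 2 * e + ι 2 * δ)
          room = diff-≤ (≤-trans (*≤⇒≤*inv {ι 2 * e + ι 2 * δ} {1ℚ} B 1≤B
              (≤-by (+-nonNeg (diff-≤ fine) (*-nonNeg (*-nonNeg (*-nonNeg (0≤ι 2) 0≤b)
                  (+-nonNeg (*-nonNeg (diff-≤ 1≤b) (+-nonNeg 0≤b 0≤1)) 0≤bb)) 0≤e))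
                (solve 2 (λ b e → (con 1ℚ :- con (ι 8) :* (b :* b :* b) :* e) :+ con (ι 2) :* b
                    :* ((b :- con 1ℚ) :* (b :+ con 1ℚ) :+ b :* b) :* e := con 1ℚ
                    :- (con (ι 2) :* e :+ con (ι 2) :* (con (ι 2) :* (b :* b) :* e)) :* b) refl b e)))
            (≤-reflexive (*-identityˡ (inv b))))

-- From integers and rational approximations to real x, y and u.

module LowerBound where
  open import Data.Empty using (⊥; ⊥-elim)
  open import Data.List.Base using (List; []; _∷_; _++_; length)
  open import Data.List.Membership.Propositional using (_∈_)
  open import Data.List.Membership.Propositional.Properties using (∈-∃++)
  open import Data.List.Relation.Binary.Permutation.Propositional using (_↭_)
  open import Data.List.Relation.Binary.Permutation.Propositional.Properties using
      (shift; ∈-resp-↭; ↭-length)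
  import Data.List.Relation.Unary.All as All
  open import Data.List.Relation.Unary.AllPairs using ([]; _∷_)
  open import Data.List.Relation.Unary.Any using (here; there)
  open import Data.List.Relation.Unary.Unique.Propositional using (Unique)
  open import Data.Nat.Base as ℕ using (ℕ; zero; suc; z≤n; s≤s)
  import Data.Nat.Properties as ℕP
  open import Data.Product.Base using (∃-syntax; _×_; _,_; proj₁; proj₂)
  open import Data.Rational.Base hiding (_÷_)
  open import Data.Rational.Properties
  open import Data.Rational.Solver using (module +-*-Solver)
  open import Data.Sum.Base using (_⊎_; inj₁; inj₂)
  open import Function.Bundles using (module Equivalence)
  open import Relation.Binary.PropositionalEquality
  open import Relation.Nullary using (Dec; yes; no)
  open RationalLemmas
  open +-*-Solver using (solve; _:+_; _:*_; _:-_; :-_; _:=_; con)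
  open Sums
  open Character
  open Mangoldt
  open Mertens
  open Friable
  open Riemann
  open LogApprox

  ¼ : ℚ
  ¼ = ½ * ½

  length-mono-⊆ : ∀ {A : Set} {xs ys : List A} → Unique xs → (∀ {x} → x ∈ xs → x ∈ ys) → length xs ℕ.≤
      length ys
  length-mono-⊆ [] _ = z≤n
  length-mono-⊆ {xs = x ∷ xs} (x∉ ∷ uniq) xs⊆ys with ∈-∃++ (xs⊆ys (here refl))
  ... | as , bs , refl = ℕP.≤-trans (s≤s (length-mono-⊆ uniq rest))
      (ℕP.≤-reflexive (sym (↭-length (shift x as bs))))
    where
    rest : ∀ {y} → y ∈ xs → y ∈ as ++ bs
    rest y∈ with ∈-resp-↭ (shift x as bs) (xs⊆ys (there y∈))
    ... | here refl = ⊥-elim (All.lookup x∉ y∈ refl)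
    ... | there m   = m

  module _ (Y : ℕ) where
    add : ∀ n → Dec (Y ℕ.< P⁺F n) → List ℕ → List ℕ
    add n (yes _) ns = ns
    add n (no _)  ns = n ∷ ns

    -- A concrete list for integer bounds; the list inside `IsΨF` is arbitrary and is compared with
    -- it by inclusion.
    friables : ℕ → List ℕ
    friables zero    = []
    friables (suc n) = add (suc n) (Y ℕP.<? P⁺F (suc n)) (friables n)

    friables-∈ : ∀ X {n} → n ∈ friables X → (1 ℕ.≤ n × n ℕ.≤ X) × P⁺F n ℕ.≤ Y
    friables-∈ (suc X) = go (Y ℕP.<? P⁺F (suc X))
      where
      weaken : ∀ {n} → n ∈ friables X → (1 ℕ.≤ n × n ℕ.≤ suc X) × P⁺F n ℕ.≤ Y
      weaken m with friables-∈ X m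
      ... | (1≤n , n≤X) , P≤Y = (1≤n , ℕP.m≤n⇒m≤1+n n≤X) , P≤Y
      go : ∀ d {n} → n ∈ add (suc X) d (friables X) → (1 ℕ.≤ n × n ℕ.≤ suc X) × P⁺F n ℕ.≤ Y
      go (yes _)   m           = weaken m
      go (no Y≮P) (here refl) = (s≤s z≤n , ℕP.≤-refl) , ℕP.≮⇒≥ Y≮P
      go (no _)    (there m)   = weaken m

    friables-unique : ∀ X → Unique (friables X)
    friables-unique zero = []
    friables-unique (suc X) = go (Y ℕP.<? P⁺F (suc X))
      where
      go : ∀ d → Unique (add (suc X) d (friables X))
      go (yes _) = friables-unique X
      go (no _)  = All.tabulate (λ m e → ℕP.<⇒≢ (s≤s (proj₂ (proj₁ (friables-∈ X m)))) (sym e)) ∷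
          friables-unique X

    friables-length : ∀ X → ι (length (friables X)) + unfriable X Y ≡ ι X
    friables-length zero = refl
    friables-length (suc X) = trans (go (Y ℕP.<? P⁺F (suc X))) (sym (ι-suc X))
      where
      f = ι (length (friables X))
      c = unfriable X Y
      go : ∀ d → ι (length (add (suc X) d (friables X))) + (c + ⟦ d ⟧) ≡ 1ℚ + ι X
      go (yes _) = trans (solve 2 (λ f c → f :+ (c :+ con 1ℚ) := con 1ℚ :+ (f :+ c)) refl f c)
          (cong (λ z → 1ℚ + z) (friables-length X))
      go (no _)  = trans (cong (_+ (c + 0ℚ)) (ι-suc (length (friables X))))
          (trans (solve 2 (λ f c → (con 1ℚ :+ f) :+ (c :+ con 0ℚ) := con 1ℚ :+ (f :+ c)) refl f c)
          (cong (λ z → 1ℚ + z) (friables-length X)))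

  module _ {B ℓ} (log-like : LogLike B ℓ) where
    open LogLike log-like

    ℓ-2^ : ∀ j → ℓ (2 ℕ.^ j) ≡ ι j * ℓ 2
    ℓ-2^ zero    = trans ℓ-1 (sym (*-zeroˡ (ℓ 2)))
    ℓ-2^ (suc j) = trans (ℓ-* 2 (2 ℕ.^ j) (s≤s z≤n) (ℕP.m^n>0 2 j))
        (trans (cong (λ z → ℓ 2 + z) (ℓ-2^ j))
      (trans (solve 2 (λ j l → l :+ j :* l := (con 1ℚ :+ j) :* l) refl (ι j) (ℓ 2))
          (cong (_* ℓ 2) (sym (ι-suc j)))))

  module Comparison (X Y j : ℕ) {ε₀ : ℚ} (0<ε₀ : 0ℚ < ε₀) (j-large : ι 480 ≤ ι j * ε₀) (8≤j : 8 ℕ.≤ j)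
    (2^j≤X : 2 ℕ.^ j ℕ.≤ X) (X≤Y : X ℕ.≤ Y) where

    -- Covers both X² + 1, which bounds every F n with n ≤ X, and Y + 2, which bounds y.
    B : ℕ
    B = F X ℕ.⊔ (2 ℕ.+ Y)

    private
      1≤X : 1 ℕ.≤ X
      1≤X = ℕP.≤-trans (ℕP.m^n>0 2 j) 2^j≤X
      1≤B : 1 ℕ.≤ B
      1≤B = ℕP.≤-trans (1≤F X) (ℕP.m≤m⊔n (F X) (2 ℕ.+ Y))
      Y+2≤B = ℕP.m≤n⊔m (F X) (2 ℕ.+ Y)
      X≤B : X ℕ.≤ B
      X≤B = ℕP.≤-trans (ℕP.≤-trans X≤Y (ℕP.m≤n+m Y 2)) Y+2≤B
      0≤ε₀ = <⇒≤ 0<ε₀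

    module _ (n : ℕ) (fine : ι 8 * (ι B * ι B * ι B) * ½^ n ≤ 1ℚ) where
      open Approx n
      private
        log-like = logℕ-logLike 1≤B fine
        open LogLike log-like
        R = riemann n
        e = ½^ n
        l = logℕ (2 ℕ.+ Y)
        lX = logℕ X

        bound : unfriable X Y * l ≤ ι X * (lX + ι 56)
        bound = FriableBound.unfriable-bound log-like X Y 1≤X X≤Y (ℕP.m≤m⊔n (F X) (2 ℕ.+ Y)) Y+2≤B

        e≤⅛ : ι 8 * e ≤ 1ℚ
        e≤⅛ = ≤-trans (≤-trans (≤-reflexive (solve 1 (λ e → con (ι 8) :* e := con (ι 8) :* con 1ℚ :* e)
            refl e)) (*-monoʳ-≤-nonNeg e {{nonNegative (0≤½^ n)}}
            (*-monoˡ-≤-nonNeg (ι 8) {1ℚ} {ι B * ι B * ι B} (*-mono {1ℚ} {ι B * ι B} 0≤1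
                (*-nonNeg (0≤ι B) (0≤ι B)) (*-mono {1ℚ} {ι B} {1ℚ} {ι B} 0≤1 (0≤ι B) (1≤ι 1≤B)
                (1≤ι 1≤B)) (1≤ι 1≤B))))) fine

        ¼≤ℓ2 : ¼ ≤ logℕ 2
        ¼≤ℓ2 = ≤-trans (≤-by (*-nonNeg (nonNegative⁻¹ ¼) (diff-≤ e≤⅛))
            (solve 1 (λ e → con ½ :* con ½ :* (con 1ℚ :- con (ι 8) :* e) := (con ½ :- con (ι 2) :* e)
            :- con ½ :* con ½) refl e)) logℕ-2

        j¼≤lX : ι j * ¼ ≤ lX
        j¼≤lX = ≤-trans (*-monoˡ-≤-nonNeg (ι j) {{nonNegative (0≤ι j)}} ¼≤ℓ2)
          (≤-trans (≤-reflexive (sym (ℓ-2^ log-like j))) (ℓ-mono (ℕP.m^n>0 2 j) 2^j≤X X≤B))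

        lX≤l : lX ≤ l
        lX≤l = ℓ-mono 1≤X (ℕP.≤-trans X≤Y (ℕP.m≤n+m Y 2)) Y+2≤B

      -- Here u, ε, x, y stand for the n-th terms of the real sequences, N is the count, and `N<tx`
      -- is the n-th instance of the denied conclusion.
      module _ {u ε x y δ N : ℚ} (ε₀≤ε : ε₀ ≤ ε) (X≤x : ι X ≤ x) (x≤X+2 : x ≤ ι (2 ℕ.+ X))
          (Y≤y : ι Y ≤ y) (y≤Y+2 : y ≤ ι (2 ℕ.+ Y))
        (0≤N : 0ℚ ≤ N) (X-c≤N : ι X - unfriable X Y ≤ N) (0<δ : 0ℚ < δ) (N<tx : N + δ ≤ (1ℚ - u - ε) *
            x) where
        private
          0≤x = ≤-trans (0≤ι X) X≤x
          lX-1≤Rx : lX - 1ℚ ≤ R x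
          lX-1≤Rx = ≤-trans (≤-by (diff-≤ (proj₂ (logℕ-bounds 1≤B fine 1≤X X≤B)))
              (solve 2 (λ l r → (r :+ con 1ℚ) :- l := r :- (l :- con 1ℚ)) refl lX (R (ι X))))
            (riemann-mono n (1≤ι 1≤X) X≤x)
          1≤y : 1ℚ ≤ y
          1≤y = ≤-trans (1≤ι (ℕP.≤-trans 1≤X X≤Y)) Y≤y
          Ry≤l+1 : R y ≤ l + 1ℚ
          Ry≤l+1 = ≤-trans (riemann-mono n 1≤y y≤Y+2)
            (≤-by (diff-≤ (proj₁ (logℕ-bounds 1≤B fine (s≤s z≤n) Y+2≤B)))
                (solve 2 (λ l r → l :- (r :- con 1ℚ) := (l :+ con 1ℚ) :- r) refl l (R (ι (2 ℕ.+ Y)))))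

          t = 1ℚ - u - ε₀

          N+δ≤tx : N + δ ≤ t * x
          N+δ≤tx = ≤-trans N<tx (≤-by (*-nonNeg (diff-≤ ε₀≤ε) 0≤x)
              (solve 4 (λ u a b x → (a :- b) :* x := (con 1ℚ :- u :- b) :* x :- (con 1ℚ :- u :- a)
              :* x) refl u ε ε₀ x))

          -- A negative t would make t x at most 0, while N + δ is positive. In particular u ≤ 1 -
          -- ε₀.
          0≤t : 0ℚ ≤ t
          0≤t = go (≤-total 0ℚ t)
            where
            go : 0ℚ ≤ t ⊎ t ≤ 0ℚ → 0ℚ ≤ t
            go (inj₁ 0≤t) = 0≤t
            go (inj₂ t≤0) = ⊥-elim (<-irrefl refl (<-≤-trans 0<δ
                (≤-by (+-nonNeg (+-nonNeg (diff-≤ N+δ≤tx) (*-nonNeg (diff-≤ t≤0) 0≤x)) 0≤N)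
              (solve 4 (λ N d t x → (t :* x :- (N :+ d)) :+ (con 0ℚ :- t) :* x :+ N := con 0ℚ :- d)
                  refl N δ t x))))

          -- Few friable n means many others, at least (u + ε₀) X - 3. Inserted in `unfriable-bound`
          -- this gives (u + ε₀/2) l ≤ lX + 56, and the surplus (ε₀/2) l outweighs every constant.
          nonneg-case : 0ℚ ≤ u → u * R y + 1ℚ ≤ R x
          nonneg-case 0≤u = ≤-trans (≤-by (+-nonNeg (*-nonNeg 0≤u (diff-≤ Ry≤l+1))
              (+-nonNeg (+-nonNeg (diff-≤ ul+4≤lX) 0≤1-u) (0≤ι 1)))
              (solve 4 (λ u r l k → u :* ((l :+ con 1ℚ) :- r) :+ ((k :- (u :* l :+ con (ι 4)))
                  :+ (con 1ℚ :- u) :+ con 1ℚ) := (k :- con 1ℚ) :- (u :* r :+ con 1ℚ)) refl u (R y) l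
                  lX)) lX-1≤Rx
            where
            0≤1-u : 0ℚ ≤ 1ℚ - u
            0≤1-u = ≤-by (+-nonNeg 0≤t 0≤ε₀) (solve 2 (λ u a → (con 1ℚ :- u :- a) :+ a := (con 1ℚ :- u)
                :- con 0ℚ) refl u ε₀)
            c = unfriable X Y
            -- From X - c ≤ N ≤ t x ≤ t (X + 2): replacing x by X costs 2 t, where t ≤ 1, and 3 is a
            -- generous bound.
            c≥ : (u + ε₀) * ι X - ι 3 ≤ c
            c≥ = ≤-by (+-nonNeg (+-nonNeg (diff-≤ X-c≤N)
                (diff-≤ (≤-trans (≤-by (<⇒≤ 0<δ) (solve 2 (λ N d → d := (N :+ d) :- N) refl N δ))
                N+δ≤tx)))
                (+-nonNeg (*-nonNeg 0≤t (diff-≤ (≤-trans x≤X+2 (≤-reflexive (ι-+ 2 X)))))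
                    (+-nonNeg (*-nonNeg (0≤ι 2) (+-nonNeg 0≤u 0≤ε₀)) 0≤1)))
              (solve 6 (λ u a x X c N → ((N :- (X :- c)) :+ ((con 1ℚ :- u :- a) :* x :- N))
                  :+ ((con 1ℚ :- u :- a) :* ((con (ι 2) :+ X) :- x) :+ (con (ι 2) :* (u :+ a)
                  :+ con 1ℚ)) := c :- ((u :+ a) :* X :- con (ι 3))) refl u ε₀ x (ι X) c N)
            j≤X : ι j ≤ ι X
            j≤X = ι-mono (ℕP.≤-trans (ℕP.<⇒≤ (n<q^n 2 j ℕP.≤-refl)) 2^j≤X)
            3≤ε₀X : ι 3 ≤ ε₀ * ½ * ι X
            3≤ε₀X = ≤-by (+-nonNeg (*-nonNeg 0≤½ (+-nonNeg (diff-≤ j-large)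
                (*-nonNeg 0≤ε₀ (diff-≤ j≤X)))) (0≤ι 237))
              (solve 3 (λ a j X → con ½ :* ((j :* a :- con (ι 480)) :+ a :* (X :- j)) :+ con (ι 237) :=
                  a :* con ½ :* X :- con (ι 3)) refl ε₀ (ι j) (ι X))
            0≤l : 0ℚ ≤ l
            0≤l = ℓ-nonNeg (2 ℕ.+ Y)
            cancelled : (u + ε₀ * ½) * l ≤ lX + ι 56
            cancelled = *-cancel-ι X 1≤X (≤-by
                (+-nonNeg (+-nonNeg (diff-≤ bound) (*-nonNeg (diff-≤ c≥) 0≤l)) (*-nonNeg (diff-≤ 3≤ε₀X)
                0≤l))
              (solve 6 (λ u a X c l k → ((X :* (k :+ con (ι 56)) :- c :* l)
                  :+ (c :- ((u :+ a) :* X :- con (ι 3))) :* l) :+ (a :* con ½ :* X :- con (ι 3)) :* l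
                  := X :* (k :+ con (ι 56)) :- X :* ((u :+ a :* con ½) :* l)) refl u ε₀ (ι X) c l lX))
            -- 480 = 60 · 2 · 4 undoes the factor ε₀/2 and the estimate lX ≥ j/4. Of the 60, 56 pays
            -- for `unfriable-bound` and 4 for passing to Riemann sums and for the gap of 1.
            60≤ : ι 60 ≤ ε₀ * ½ * l
            60≤ = ≤-by (+-nonNeg (*-nonNeg (*-nonNeg 0≤½ (nonNegative⁻¹ ¼)) (diff-≤ j-large))
                (*-nonNeg (*-nonNeg 0≤ε₀ 0≤½) (diff-≤ (≤-trans j¼≤lX lX≤l))))
              (solve 3 (λ a j l → con ½ :* (con ½ :* con ½) :* (j :* a :- con (ι 480)) :+ a :* con ½
                  :* (l :- j :* (con ½ :* con ½)) := a :* con ½ :* l :- con (ι 60)) refl ε₀ (ι j) l)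
            ul+4≤lX : u * l + ι 4 ≤ lX
            ul+4≤lX = ≤-by (+-nonNeg (diff-≤ cancelled) (diff-≤ 60≤))
                (solve 4 (λ u a l k → ((k :+ con (ι 56)) :- (u :+ a :* con ½) :* l)
                :+ (a :* con ½ :* l :- con (ι 60)) := k :- (u :* l :+ con (ι 4))) refl u ε₀ l lX)

          -- A single rational term of u may be non-positive. Then u R y ≤ 0, and R x ≥ 1 because lX
          -- ≥ j/4 ≥ 2.
          neg-case : u ≤ 0ℚ → u * R y + 1ℚ ≤ R x
          neg-case u≤0 = ≤-trans (≤-by (+-nonNeg (*-nonNeg (diff-≤ u≤0) (riemann-nonNeg n 1≤y))
              (+-nonNeg (diff-≤ j¼≤lX) (*-nonNeg (nonNegative⁻¹ ¼) (diff-≤ (ι-mono 8≤j)))))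
            (solve 4 (λ u r k j → (con 0ℚ :- u) :* r :+ ((k :- j :* (con ½ :* con ½))
                :+ (con ½ :* con ½) :* (j :- con (ι 8))) := (k :- con 1ℚ) :- (u :* r :+ con 1ℚ)) refl u
                (R y) lX (ι j))) lX-1≤Rx

        -- The gap of 1 does not depend on n, so having it at all late indices witnesses u log y <ℝ
        -- log x.
        log-gap : u * R y + 1ℚ ≤ R x
        log-gap = go (≤-total 0ℚ u)
          where
          go : 0ℚ ≤ u ⊎ u ≤ 0ℚ → u * R y + 1ℚ ≤ R x
          go (inj₁ 0≤u) = nonneg-case 0≤u
          go (inj₂ u≤0) = neg-case u≤0

  ι-cancel-< : ∀ {m n} → ι m < ι n → m ℕ.< n
  ι-cancel-< {m} {n} ιm<ιn with m ℕP.<? n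
  ... | yes m<n = m<n
  ... | no m≮n  = ⊥-elim (<-irrefl refl (<-≤-trans ιm<ιn (ι-mono (ℕP.≮⇒≥ m≮n))))

  floorℕ : ∀ q → 0ℚ ≤ q → ∃[ k ] (ι k ≤ q × q < ι (suc k))
  floorℕ q 0≤q = start (archimedean q)
    where
    search : ∀ n → q < ι n → ∃[ k ] (ι k ≤ q × q < ι (suc k))
    search zero    q<0 = ⊥-elim (<-irrefl refl (<-≤-trans q<0 0≤q))
    search (suc n) q<n+1 = go (≤-<-connex (ι n) q)
      where
      ≤-<-connex : ∀ p q → p ≤ q ⊎ q < p
      ≤-<-connex p q with p ≤? q
      ... | yes p≤q = inj₁ p≤q
      ... | no p≰q  = inj₂ (≰⇒> p≰q)
      go : ι n ≤ q ⊎ q < ι n → ∃[ k ] (ι k ≤ q × q < ι (suc k))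
      go (inj₁ n≤q) = n , n≤q , q<n+1
      go (inj₂ q<n) = search n q<n
    start : ∃[ n ] q ≤ ι n → ∃[ k ] (ι k ≤ q × q < ι (suc k))
    start (n , q≤n) = search (suc n) (≤-<-trans q≤n (subst (ι n <_) (sym (ι-suc n))
        (subst (_< 1ℚ + ι n) (+-identityˡ (ι n)) (+-monoˡ-< (ι n) 0<1))))

  0<¼ : 0ℚ < ¼
  0<¼ = positive⁻¹ ¼

  within : ∀ a b {r} → ∣ a - b ∣ ≤ r → (b - r ≤ a) × (a ≤ b + r)
  within a b {r} d = ≤-by (diff-≤ (≤-trans (p≤∣p∣ (- (a - b)))
      (≤-trans (≤-reflexive (∣-p∣≡∣p∣ (a - b))) d))) (solve 3 (λ a b r → r :- (:- (a :- b)) := a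
      :- (b :- r)) refl a b r)
    , ≤-by (diff-≤ (≤-trans (p≤∣p∣ (a - b)) d)) (solve 3 (λ a b r → r :- (a :- b) := (b :+ r) :- a)
        refl a b r)

  -- An eventual window [k, k + 2] around z, with k chosen monotonically in z M.
  Window : ℝ → ℕ → Set
  Window z M = ∃[ k ] ((ι k ≤ seq z M - ¼ × seq z M - ¼ < ι (suc k)) × (∀ n → M ℕ.≤ n → ι k ≤ seq z n ×
      seq z n ≤ ι (2 ℕ.+ k)))

  -- Starting from z M - 1/4 leaves room for oscillations of 1/4: later terms stay at least k and
  -- below k + 1 + 1/2.
  window : ∀ z M → 1ℚ ≤ seq z M → (∀ n → M ℕ.≤ n → ∣ seq z n - seq z M ∣ ≤ ¼) → Window z M
  window z M 1≤z close = build (floorℕ (seq z M - ¼)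
      (≤-by (+-nonNeg (diff-≤ 1≤z) (nonNegative⁻¹ (½ + ¼)))
      (solve 1 (λ z → (z :- con 1ℚ) :+ (con ½ :+ con ½ :* con ½) := (z :- con ½ :* con ½) :- con 0ℚ)
      refl (seq z M))))
    where
    build : ∃[ k ] (ι k ≤ seq z M - ¼ × seq z M - ¼ < ι (suc k)) → Window z M
    build (k , k≤ , <k+1) = k , (k≤ , <k+1) , λ n M≤n →
        ≤-trans k≤ (proj₁ (within (seq z n) (seq z M) (close n M≤n)))
      , ≤-trans (proj₂ (within (seq z n) (seq z M) (close n M≤n)))
          (≤-by (+-nonNeg (diff-≤ (<⇒≤ <k+1)) 0≤½)
              (trans (solve 2 (λ k z → (k :- (z :- con ½ :* con ½)) :+ con ½ := (con 1ℚ :+ k)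
              :- (z :+ con ½ :* con ½)) refl (ι (suc k)) (seq z M))
            (cong (_- (seq z M + ¼)) (sym (ι-suc (suc k))))))

  -- The integer bounds must inherit X ≤ Y, so that a prime above Y lies outside the range q ≤ X;
  -- taking both at the same index M ensures this.
  window-mono : ∀ {x y M} (v : Window x M) (w : Window y M) → seq x M ≤ seq y M → proj₁ v ℕ.≤ proj₁ w
  window-mono {x} {y} {M} (_ , (k≤ , _) , _) (_ , (_ , <l+1) , _) x≤y =
    ℕP.≤-pred (ι-cancel-< (≤-<-trans k≤ (≤-<-trans (+-monoˡ-≤ (- ¼) x≤y) <l+1)))

  module _ (ε : ℝ) {ε₀ : ℚ} (0<ε₀ : 0ℚ < ε₀) (Mε : ℕ) (ε≥ε₀ : ∀ n → Mε ℕ.≤ n → 0ℚ + ε₀ ≤ seq ε n)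
           (j : ℕ) (j-large : ι 480 ≤ ι j * ε₀) (8≤j : 8 ℕ.≤ j) where
    private
      K = 2 ℕ.^ j

    -- The conclusion unfolds to a negation, so a last argument provides δ and M₁ with N + δ ≤ (1 -
    -- u - ε) x at all indices from M₁ on. It is refuted through the half of `≃ℝ` that denies u log
    -- y <ℝ log x.
    Ψ-lower-bound : ∀ (x y u : ℝ) (0<x : 0ℝ <ℝ x) (0<y : 0ℝ <ℝ y) →
      fromℕ (K ℕ.+ 2) ≤ℝ x → x <ℝ y → y ≤ℝ x *ℝ x →
      u *ℝ log y 0<y ≃ℝ log x 0<x → ½ℝ ≤ℝ u → u <ℝ 1ℝ →
      ∀ (N : ℕ) → IsΨF x y N → (1ℝ -ℝ u -ℝ ε) *ℝ x ≤ℝ fromℕ N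
    Ψ-lower-bound x y u _ _ X₀≤x (η , 0<η , Mxy , x<y) _ (_ , ulogy≥logx) _ _ N
        (ns , _ , ns-spec , ns-length) (δ , 0<δ , M₁ , N<tx) =
      choose (cauchy x 0<¼) (cauchy y 0<¼)
      where
      choose : ∃[ M ] (∀ m n → M ℕ.≤ m → M ℕ.≤ n → ∣ seq x m - seq x n ∣ ≤ ¼) →
               ∃[ M ] (∀ m n → M ℕ.≤ m → M ℕ.≤ n → ∣ seq y m - seq y n ∣ ≤ ¼) → ⊥
      choose (Mx , close-x) (My , close-y) = compare wx wy (window-mono {x} {y} {M} wx wy x≤y)
        where
        M = Mxy ℕ.⊔ (Mx ℕ.⊔ My)
        Mxy≤ : ∀ {n} → M ℕ.≤ n → Mxy ℕ.≤ n
        Mxy≤ = ℕP.m⊔n≤o⇒m≤o Mxy (Mx ℕ.⊔ My)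
        Mx≤ : ∀ {n} → M ℕ.≤ n → Mx ℕ.≤ n
        Mx≤ M≤n = ℕP.m⊔n≤o⇒m≤o Mx My (ℕP.m⊔n≤o⇒n≤o Mxy (Mx ℕ.⊔ My) M≤n)
        My≤ : ∀ {n} → M ℕ.≤ n → My ℕ.≤ n
        My≤ M≤n = ℕP.m⊔n≤o⇒n≤o Mx My (ℕP.m⊔n≤o⇒n≤o Mxy (Mx ℕ.⊔ My) M≤n)
        near-x : ∀ n → M ℕ.≤ n → ∣ seq x n - seq x M ∣ ≤ ¼
        near-x n M≤n = close-x n M (Mx≤ M≤n) (Mx≤ {M} ℕP.≤-refl)
        near-y : ∀ n → M ℕ.≤ n → ∣ seq y n - seq y M ∣ ≤ ¼
        near-y n M≤n = close-y n M (My≤ M≤n) (My≤ {M} ℕP.≤-refl)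

        -- A value at most 1 at index M would keep x at most 5/4 from there on, although x ≥ 2.
        1≤x : 1ℚ ≤ seq x M
        1≤x = go (≤-total 1ℚ (seq x M))
          where
          go : 1ℚ ≤ seq x M ⊎ seq x M ≤ 1ℚ → 1ℚ ≤ seq x M
          go (inj₁ 1≤x) = 1≤x
          go (inj₂ x≤1) = ⊥-elim (X₀≤x (½ , positive⁻¹ ½ , M , λ n M≤n →
            ≤-trans (≤-by (+-nonNeg (+-nonNeg
                (diff-≤ (proj₂ (within (seq x n) (seq x M) (near-x n M≤n)))) (diff-≤ x≤1))
                (nonNegative⁻¹ ¼))
              (solve 2 (λ a b → ((b :+ con ½ :* con ½) :- a) :+ (con 1ℚ :- b) :+ con ½ :* con ½ :=
                  con (ι 2) :- (a :+ con ½)) refl (seq x n) (seq x M))) (ι-mono (ℕP.m≤n+m 2 K))))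

        x≤y : seq x M ≤ seq y M
        x≤y = ≤-trans (≤-by (<⇒≤ 0<η) (solve 2 (λ a h → h := (a :+ h) :- a) refl (seq x M) η))
            (x<y M (Mxy≤ {M} ℕP.≤-refl))

        wx = window x M 1≤x near-x
        wy = window y M (≤-trans 1≤x x≤y) near-y

        compare : (v : Window x M) (w : Window y M) → proj₁ v ℕ.≤ proj₁ w → ⊥
        compare (X , _ , bx) (Y , _ , by) X≤Y = conclude (K ℕP.≤? X)
          where
          conclude : Dec (K ℕ.≤ X) → ⊥
          -- X < K would give x + 1 ≤ X + 3 ≤ K + 2; the summand 2 in the threshold K + 2 pays for
          -- the width of the window.
          conclude (no K≰X) = X₀≤x (1ℚ , 0<1 , M , λ n M≤n → ≤-trans (+-monoˡ-≤ 1ℚ (proj₂ (bx n M≤n)))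
            (≤-trans (≤-reflexive (trans (+-comm (ι (2 ℕ.+ X)) 1ℚ) (sym (ι-suc (2 ℕ.+ X)))))
                (ι-mono (ℕP.≤-trans (ℕP.≤-reflexive (ℕP.+-comm 3 X))
              (ℕP.≤-trans (ℕP.≤-reflexive (ℕP.+-suc X 2)) (ℕP.+-monoˡ-≤ 2 (ℕP.≰⇒> K≰X)))))))
          conclude (yes K≤X) = refine (½^-small (ι 8 * (ι B * ι B * ι B)) 0<1)
            where
            open Comparison X Y j 0<ε₀ j-large 8≤j K≤X X≤Y
            below : ∀ {z w k m} → (∀ n → M ℕ.≤ n → ι k ≤ seq z n × w n) → m ℕ.≤ k → fromℕ m ≤ℝ z
            below {z} {k = k} {m} b m≤k (θ , 0<θ , M₂ , z<m) = <-irrefl refl (<-≤-trans 0<θ (≤-by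
                (+-nonNeg (diff-≤ (z<m n (ℕP.m≤n⊔m M M₂)))
                    (diff-≤ (≤-trans (ι-mono m≤k) (proj₁ (b n (ℕP.m≤m⊔n M M₂))))))
                (solve 3 (λ m z t → (m :- (z :+ t)) :+ (z :- m) := con 0ℚ :- t) refl (ι m) (seq z n)
                    θ)))
              where n = M ℕ.⊔ M₂
            members : ∀ {n} → n ∈ friables Y X → n ∈ ns
            members {n} n∈ = inside (friables-∈ Y X n∈)
              where
              inside : (1 ℕ.≤ n × n ℕ.≤ X) × P⁺F n ℕ.≤ Y → n ∈ ns
              inside ((1≤n , n≤X) , P≤Y) = Equivalence.from (ns-spec n)
                  (1≤n , below {x} {λ i → seq x i ≤ ι (2 ℕ.+ X)} {X} {n} bx n≤X , below {y}
                  {λ i → seq y i ≤ ι (2 ℕ.+ Y)} {Y} {P⁺F n} by P≤Y)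
            X-c≤N : ι X - unfriable X Y ≤ ι N
            X-c≤N = ≤-trans (≤-reflexive (trans (cong (_- unfriable X Y) (sym (friables-length Y X)))
                (solve 2 (λ f c → (f :+ c) :- c := f) refl (ι (length (friables Y X)))
                (unfriable X Y))))
              (ι-mono (subst (length (friables Y X) ℕ.≤_) ns-length
                  (length-mono-⊆ (friables-unique Y X) members)))
            -- B is already fixed here, so the precision it demands holds from some index M₃ on,
            -- independently of the other thresholds.
            refine : ∃[ M₃ ] (∀ n → M₃ ℕ.≤ n → ι 8 * (ι B * ι B * ι B) * ½^ n ≤ 1ℚ) → ⊥
            refine (M₃ , fine) = ulogy≥logx (1ℚ , 0<1 , M ℕ.⊔ M₁ ℕ.⊔ Mε ℕ.⊔ M₃ , λ n M′≤n →
              let M≤n₁ = ℕP.m⊔n≤o⇒m≤o (M ℕ.⊔ M₁ ℕ.⊔ Mε) M₃ M′≤n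
                  M≤n₂ = ℕP.m⊔n≤o⇒m≤o (M ℕ.⊔ M₁) Mε M≤n₁
                  M≤n  = ℕP.m⊔n≤o⇒m≤o M M₁ M≤n₂
              in log-gap n (fine n (ℕP.m⊔n≤o⇒n≤o (M ℕ.⊔ M₁ ℕ.⊔ Mε) M₃ M′≤n)) {seq u n} {seq ε n} {seq x n} {seq y n} {δ} {ι N}
                   (subst (_≤ seq ε n) (+-identityˡ ε₀) (ε≥ε₀ n (ℕP.m⊔n≤o⇒n≤o (M ℕ.⊔ M₁) Mε M≤n₁)))
                   (proj₁ (bx n M≤n)) (proj₂ (bx n M≤n)) (proj₁ (by n M≤n)) (proj₂ (by n M≤n))
                   (0≤ι N) X-c≤N 0<δ (N<tx n (ℕP.m⊔n≤o⇒n≤o M M₁ M≤n₂)))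

  large-multiple : ∀ {ε₀} → 0ℚ < ε₀ → ∃[ j ] (ι 480 ≤ ι j * ε₀ × 8 ℕ.≤ j)
  large-multiple {ε₀} 0<ε₀ = build (archimedean (ι 480 * inv ε₀))
    where
    build : ∃[ k ] ι 480 * inv ε₀ ≤ ι k → ∃[ j ] (ι 480 ≤ ι j * ε₀ × 8 ℕ.≤ j)
    build (k , b) = 8 ℕ.+ k , ≤-trans
        (≤-reflexive (sym (trans (solve 3 (λ c a i → c :* i :* a := c :* (a :* i)) refl (ι 480) ε₀
        (inv ε₀)) (trans (cong (ι 480 *_) (proj₁ (inv-pos 0<ε₀))) (*-identityʳ (ι 480))))))
        (*-monoʳ-≤-nonNeg ε₀ {{nonNegative (<⇒≤ 0<ε₀)}} (≤-trans b (ι-mono (ℕP.m≤n+m k 8))))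
      , ℕP.m≤m+n 8 k

  Ψ-lower-bound-eventually : ∀ (ε : ℝ) → 0ℝ <ℝ ε →
    ∃[ X₀ ] (∀ (x y u : ℝ) (0<x : 0ℝ <ℝ x) (0<y : 0ℝ <ℝ y) →
      X₀ ≤ℝ x → x <ℝ y → y ≤ℝ x *ℝ x →
      u *ℝ log y 0<y ≃ℝ log x 0<x → ½ℝ ≤ℝ u → u <ℝ 1ℝ →
      ∀ (N : ℕ) → IsΨF x y N → (1ℝ -ℝ u -ℝ ε) *ℝ x ≤ℝ fromℕ N)
  Ψ-lower-bound-eventually ε (ε₀ , 0<ε₀ , Mε , ε≥ε₀) = build (large-multiple 0<ε₀)
    where
    build : ∃[ j ] (ι 480 ≤ ι j * ε₀ × 8 ℕ.≤ j) → _
    build (j , j-large , 8≤j) = fromℕ (2 ℕ.^ j ℕ.+ 2) , Ψ-lower-bound ε 0<ε₀ Mε ε≥ε₀ j j-large 8≤j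

mainTheorem3 : ∀ (ε : ℝ) → 0ℝ <ℝ ε →
    ∃[ X₀ ] (∀ (x y u : ℝ) (0<x : 0ℝ <ℝ x) (0<y : 0ℝ <ℝ y) →
    X₀ ≤ℝ x →
    x <ℝ y → y ≤ℝ x *ℝ x →
    u *ℝ log y 0<y ≃ℝ log x 0<x →
    ½ℝ ≤ℝ u → u <ℝ 1ℝ →
    ∀ (N : ℕ) → IsΨF x y N →
    (1ℝ -ℝ u -ℝ ε) *ℝ x ≤ℝ fromℕ N)
mainTheorem3 = LowerBound.Ψ-lower-bound-eventually
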